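{- Let $\ell$ and $m_1,\ldots,m_\ell$ be positive integers such that $m_i \ge 2$ for $i=1,\ldots,\ell$. Let $s=m_1+\ldots+m_\ell$ and let $t$ be an integer with $t>s$. Let $a$ be the number of odd integers in the multiset $\{\!\{m_1,\ldots,m_\ell\}\!\}$ and assume $a \le 2\lfloor t/2\rfloor - s$. If $\mathrm{OP}^\ast(m_1,\ldots,m_\ell)$ has a solution, then (1) $\mathrm{OP}^\ast(m_1,\ldots,m_\ell,t)$ has a solution; and (2) if $t$ is even, $\mathrm{OP}^\ast(m_1,\ldots,m_\ell,2^{\langle t/2\rangle})$ has a solution.
   Context: $K_n^\ast$ denotes the complete symmetric digraph of order $n$. For integers $m_1,\ldots,m_k \ge 2$ with $n=m_1+\ldots+m_k$, $\mathrm{OP}^\ast(m_1,\ldots,m_k)$ asks for a decomposition of $K_n^\ast$ into spanning subdigraphs, each a disjoint union of $k$ directed cycles of lengths $m_1,\ldots,m_k$; such a decomposition is a solution. The notation $2^{\langle r\rangle}$ in a list of cycle lengths denotes $r$ copies of $2$. -}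

module Defs where

open import Data.Nat using (ℕ; zero; suc; _<_; _≤_; _%_; _≟_)
open import Data.Nat.Properties using (_<?_)
open import Data.Fin using (Fin; zero; suc; toℕ; fromℕ<)
open import Data.List using (List; length; lookup; filter)
open import Data.Nat.ListAction using (sum)
open import Data.Product using (Σ; ∃; _×_; _,_)
open import Relation.Binary.PropositionalEquality using (_≡_; _≢_)
open import Relation.Nullary using (yes; no)
open import Function.Definitions using (Injective)

next : ∀ {m} → Fin m → Fin m
next {suc k} i with suc (toℕ i) <? suc k
... | yes p = fromℕ< p
... | no _  = zero

-- A directed cycle of length m in a digraph on vertex set Fin n:
-- distinct vertices v₀,…,v_{m-1} with arcs v_i → v_{i+1 mod m}.
record DiCycle (n m : ℕ) : Set where
  field
    vert : Fin m → Fin n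
    inj  : Injective _≡_ _≡_ vert

open DiCycle public

CycleArc : ∀ {n m} → DiCycle n m → Fin n → Fin n → Set
CycleArc C u v = Σ _ λ i → (vert C i ≡ u) × (vert C (next i) ≡ v)

record Factor (n : ℕ) (ms : List ℕ) : Set where
  field
    cyc      : (i : Fin (length ms)) → DiCycle n (lookup ms i)
    disjoint : ∀ i j a b → vert (cyc i) a ≡ vert (cyc j) b → i ≡ j
    spanning : ∀ (v : Fin n) → Σ (Fin (length ms)) λ i → Σ _ λ a → vert (cyc i) a ≡ v

open Factor public

FactorArc : ∀ {n ms} → Factor n ms → Fin n → Fin n → Set
FactorArc F u v = Σ _ λ i → CycleArc (cyc F i) u v

-- OP*(m_1,…,m_k) has a solution: K_n^* (n = m_1+…+m_k, vertex set Fin n,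
-- arcs all (u , v) with u ≢ v) decomposes into factors of type ms, i.e. every
-- arc of K_n^* lies in exactly one factor of the family.
-- (Every arc of a factor is an arc of K_n^*, since cycles have length ≥ 2.)
OPSolvable : List ℕ → Set
OPSolvable ms =
  Σ ℕ λ r → Σ (Fin r → Factor (sum ms) ms) λ F →
    ∀ (u v : Fin (sum ms)) → u ≢ v →
      Σ (Fin r) λ j → FactorArc (F j) u v × (∀ j′ → FactorArc (F j′) u v → j′ ≡ j)

numOdd : List ℕ → ℕ
numOdd ms = length (filter (λ m → m % 2 ≟ 1) ms)

{-# OPTIONS --safe #-}
-- Let X be the vertex set of the given solution, with s vertices, and let Y be the residues
-- modulo t. Each of the s - 1 given factors is completed by a factor of Y. The remaining t
-- factors contain no arc inside X; they are the rotations of a single one, so that they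
-- contain all arcs between X and Y, and one orbit of arcs of Y for each difference occurring
-- in it. In that factor the vertices of X link s disjoint paths of Y into cycles: a cycle of
-- even length m takes m / 2 single points, one of odd length an arc and single points, and
-- the last cycle takes whatever is left.
--
-- The paths come from a zigzag through half of Y and the reversed translate of it, which
-- consume the long differences ± d, and from concentric arcs, which consume 2, 4, ..., 2 n.
-- The other differences are paired off as ± a, ± b with a and b coprime. The circulant graph
-- with steps a and b splits into two Hamilton cycles: start from the cosets of ⟨a⟩ and ⟨b⟩
-- and exchange opposite edges in a staircase of squares that continues as a zigzag. What
-- remains, such as the difference t / 2, is treated by parity.
--
-- Since each factor has one arc out of each vertex, s + t - 1 factors covering all arcs
-- cover each of them once.
module Submission where

module ResidueClasses where
  open import Data.Nat as ℕ using (ℕ; zero; suc; NonZero)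
  import Data.Nat.Properties as ℕ
  import Data.Nat.DivMod as ℕ
  open import Data.Integer using (ℤ; +_; -[1+_]; +[1+_]; -_; _+_; _*_; _-_; _%ℕ_; _/ℕ_)
  import Data.Integer.Properties as ℤ
  open import Data.Integer.DivMod using (n%ℕd<d; a≡a%ℕn+[a/ℕn]*n)
  open import Data.Integer.Tactic.RingSolver using (solve-∀)
  open import Data.Fin using (Fin; toℕ; fromℕ<)
  open import Data.Fin.Properties using (toℕ-injective; toℕ<n; toℕ-fromℕ<)
  open import Data.Product using (∃; _,_)
  open import Data.Empty using (⊥-elim)
  open import Relation.Binary.PropositionalEquality using (_≡_; sym; trans; cong; subst; module ≡-Reasoning)

  residue-unique : ∀ {t r r′} k → r ℕ.< t → r′ ℕ.< t → + r ≡ + r′ + k * + t → r ≡ r′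
  residue-unique {t} {r} {r′} (+ zero) _ _ eq = ℤ.+-injective (trans eq (ℤ.+-identityʳ (+ r′)))
  residue-unique {t} {r} {r′} (+[1+ k ]) r<t _ eq = ⊥-elim (ℕ.<⇒≱ r<t t≤r)
    where
    eq′ : r ≡ r′ ℕ.+ suc k ℕ.* t
    eq′ = ℤ.+-injective (trans eq (cong (λ z → + r′ + z) (sym (ℤ.pos-* (suc k) t))))
    t≤r : t ℕ.≤ r
    t≤r = subst (t ℕ.≤_) (sym eq′) (ℕ.≤-trans (ℕ.m≤m+n t (k ℕ.* t)) (ℕ.m≤n+m _ r′))
  residue-unique {t} {r} {r′} -[1+ k ] r<t r′<t eq =
    sym (residue-unique (+[1+ k ]) r′<t r<t (trans (lemma (+ r′) (+[1+ k ] * + t))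
      (cong (_+ +[1+ k ] * + t) (trans (cong (λ z → + r′ + z) (ℤ.neg-distribˡ-* +[1+ k ] (+ t))) (sym eq)))))
    where
    lemma : ∀ x y → x ≡ x + - y + y
    lemma = solve-∀

  module Residues (t : ℕ) .{{_ : NonZero t}} where

    infixl 6 _⊕_

    abstract
      ⟦_⟧ : ℤ → Fin t
      ⟦ z ⟧ = fromℕ< (n%ℕd<d z t)

      toℕ-⟦⟧ : ∀ z → toℕ ⟦ z ⟧ ≡ z %ℕ t
      toℕ-⟦⟧ z = toℕ-fromℕ< (n%ℕd<d z t)

      ⟦⟧-cong : ∀ {x y} k → x ≡ y + k * + t → ⟦ x ⟧ ≡ ⟦ y ⟧
      ⟦⟧-cong {x} {y} k eq = toℕ-injective (trans (toℕ-⟦⟧ x) (trans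
          (residue-unique (y /ℕ t + k - x /ℕ t) (n%ℕd<d x t) (n%ℕd<d y t) eq′) (sym (toℕ-⟦⟧ y))))
        where
        expand : ∀ rx qx ry qy k t → rx + qx * t ≡ (ry + qy * t) + k * t → rx ≡ ry + (qy + k - qx) * t
        expand rx qx ry qy k t h = begin
          rx                               ≡⟨ l₁ rx (qx * t) ⟩
          rx + qx * t - qx * t             ≡⟨ cong (_- qx * t) h ⟩
          (ry + qy * t) + k * t - qx * t   ≡⟨ l₂ ry qy k qx t ⟩
          ry + (qy + k - qx) * t           ∎
          where
          open ≡-Reasoning
          l₁ : ∀ a b → a ≡ a + b - b
          l₁ = solve-∀
          l₂ : ∀ ry qy k qx t → (ry + qy * t) + k * t - qx * t ≡ ry + (qy + k - qx) * t
          l₂ = solve-∀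
        eq′ : + (x %ℕ t) ≡ + (y %ℕ t) + (y /ℕ t + k - x /ℕ t) * + t
        eq′ = expand (+ (x %ℕ t)) (x /ℕ t) (+ (y %ℕ t)) (y /ℕ t) k (+ t)
                (trans (sym (a≡a%ℕn+[a/ℕn]*n x t)) (trans eq (cong (_+ k * + t) (a≡a%ℕn+[a/ℕn]*n y t))))

      ⟦⟧-injective : ∀ {x y} → ⟦ x ⟧ ≡ ⟦ y ⟧ → ∃ λ k → x ≡ y + k * + t
      ⟦⟧-injective {x} {y} eq = x /ℕ t - y /ℕ t , (begin
          x                                                    ≡⟨ a≡a%ℕn+[a/ℕn]*n x t ⟩
          + (x %ℕ t) + x /ℕ t * + t                            ≡⟨ cong (λ r → + r + x /ℕ t * + t) r≡ ⟩
          + (y %ℕ t) + x /ℕ t * + t                            ≡⟨ l (+ (y %ℕ t)) (x /ℕ t) (y /ℕ t) (+ t) ⟩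
          + (y %ℕ t) + y /ℕ t * + t + (x /ℕ t - y /ℕ t) * + t  ≡⟨ cong (_+ (x /ℕ t - y /ℕ t) * + t) (sym (a≡a%ℕn+[a/ℕn]*n y t)) ⟩
          y + (x /ℕ t - y /ℕ t) * + t                          ∎)
        where
        open ≡-Reasoning
        r≡ : x %ℕ t ≡ y %ℕ t
        r≡ = trans (sym (toℕ-⟦⟧ x)) (trans (cong toℕ eq) (toℕ-⟦⟧ y))
        l : ∀ r qx qy t → r + qx * t ≡ r + qy * t + (qx - qy) * t
        l = solve-∀

      ⟦toℕ⟧ : ∀ v → ⟦ + toℕ v ⟧ ≡ v
      ⟦toℕ⟧ v = toℕ-injective (trans (toℕ-⟦⟧ (+ toℕ v)) (ℕ.m<n⇒m%n≡m (toℕ<n v)))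

      _⊕_ : Fin t → ℤ → Fin t
      v ⊕ z = ⟦ + toℕ v + z ⟧

      ⟦⟧-⊕ : ∀ x z → ⟦ x ⟧ ⊕ z ≡ ⟦ x + z ⟧
      ⟦⟧-⊕ x z with ⟦⟧-injective {+ toℕ ⟦ x ⟧} {x} (⟦toℕ⟧ ⟦ x ⟧)
      ... | k , eq = ⟦⟧-cong {+ toℕ ⟦ x ⟧ + z} {x + z} k (trans (cong (_+ z) eq) (l x (k * + t) z))
        where
        l : ∀ x k z → x + k + z ≡ x + z + k
        l = solve-∀

      ⊕-⊕ : ∀ v x y → v ⊕ x ⊕ y ≡ v ⊕ (x + y)
      ⊕-⊕ v x y = trans (⟦⟧-⊕ (+ toℕ v + x) y) (cong ⟦_⟧ (ℤ.+-assoc (+ toℕ v) x y))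

      ⊕-identityʳ : ∀ v → v ⊕ + 0 ≡ v
      ⊕-identityʳ v = trans (cong ⟦_⟧ (ℤ.+-identityʳ (+ toℕ v))) (⟦toℕ⟧ v)

      ⊕-inverse : ∀ v z → v ⊕ - z ⊕ z ≡ v
      ⊕-inverse v z = trans (⊕-⊕ v (- z) z) (trans (cong (v ⊕_) (ℤ.+-inverseˡ z)) (⊕-identityʳ v))

      ⊕-inverse′ : ∀ v z → v ⊕ z ⊕ - z ≡ v
      ⊕-inverse′ v z = trans (⊕-⊕ v z (- z)) (trans (cong (v ⊕_) (ℤ.+-inverseʳ z)) (⊕-identityʳ v))

      ⊕-comm : ∀ v x y → v ⊕ x ⊕ y ≡ v ⊕ y ⊕ x
      ⊕-comm v x y = trans (⊕-⊕ v x y) (trans (cong (v ⊕_) (ℤ.+-comm x y)) (sym (⊕-⊕ v y x)))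

      ⊕-cancelʳ : ∀ {u v} z → u ⊕ z ≡ v ⊕ z → u ≡ v
      ⊕-cancelʳ {u} {v} z eq = trans (sym (⊕-inverse′ u z)) (trans (cong (_⊕ - z) eq) (⊕-inverse′ v z))

    ⟦⟧-injective-< : ∀ {j k} → j ℕ.< t → k ℕ.< t → ⟦ + j ⟧ ≡ ⟦ + k ⟧ → j ≡ k
    ⟦⟧-injective-< j<t k<t eq with ⟦⟧-injective eq
    ... | q , eq′ = residue-unique q j<t k<t eq′

    record Ham : Set where
      field
        walk   : ℕ → Fin t
        period : ∀ i → walk (t ℕ.+ i) ≡ walk i
        onto   : ∀ v → ∃ λ i → walk i ≡ v

    open Ham public

module Orbits where
  open ResidueClasses
  open import Data.Nat as ℕ using (ℕ; zero; suc; NonZero; _<_; _≤_; s≤s; _%_; _/_)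
  import Data.Nat.Properties as ℕ
  import Data.Nat.DivMod as ℕ
  open import Data.Integer using (ℤ; +_; -_)
  open import Data.Fin as Fin using (Fin; toℕ; fromℕ<; combine)
  open import Data.Fin.Properties as Fin using (toℕ<n; toℕ-fromℕ<; combine-injective; pigeonhole; any?; injective⇒≤)
  open import Data.Bool as Bool using (Bool; true; false; not)
  open import Data.Bool.Properties using (not-involutive; ¬-not)
  open import Data.Product using (∃; _×_; _,_; proj₁; proj₂)
  open import Data.Product.Properties using (≡-dec)
  open import Data.Sum using (_⊎_; inj₁; inj₂)
  open import Data.Empty using (⊥-elim)
  open import Function using (_∘_; mk⇔)
  open import Relation.Binary using (tri<; tri≈; tri>)
  open import Relation.Nullary.Decidable using (dec-true; does-⇔)
  open import Relation.Nullary using (¬_; Dec; yes; no; does)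
  open import Relation.Binary.PropositionalEquality using (_≡_; _≢_; refl; sym; trans; cong; cong₂; subst)

  least : ∀ {P : ℕ → Set} → (∀ n → Dec (P n)) → ∀ n → P n → ∃ λ m → P m × (∀ k → k < m → ¬ P k)
  least P? zero    p = zero , p , λ k ()
  least {P} P? (suc n) p with P? zero
  ... | yes p₀ = zero , p₀ , λ k ()
  ... | no ¬p₀ with least (λ k → P? (suc k)) n p
  ...   | m , pm , min = suc m , pm , min′
    where
    min′ : ∀ k → k < suc m → ¬ P k
    min′ zero    _         = ¬p₀
    min′ (suc k) (s≤s k<m) = min k k<m

  module Square (t : ℕ) .{{_ : NonZero t}} where
    open Residues t

    -- Invariance under the edges of one colour: walking along d, with the edges
    -- d of the squares in E replaced by the edges e of the same squares.
    record Closed (d e : ℤ) (E : Fin t → Set) (f : Fin t → Bool) : Set where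
      field
        straight : ∀ v → ¬ E v → ¬ E (v ⊕ - e) → f v ≡ f (v ⊕ d)
        near     : ∀ v → E v → f v ≡ f (v ⊕ e)
        far      : ∀ v → E v → f (v ⊕ d) ≡ f (v ⊕ d ⊕ e)

    open Closed public

    Connected : (d e : ℤ) (E : Fin t → Set) → Set
    Connected d e E = ∀ f → Closed d e E f → ∀ u v → f u ≡ f v

    UArc : Ham → Fin t → Fin t → Set
    UArc h u v = ∃ λ i → (walk h i ≡ u × walk h (suc i) ≡ v) ⊎ (walk h i ≡ v × walk h (suc i) ≡ u)

    module Orbit (d e : ℤ) (E : Fin t → Set) (E? : ∀ v → Dec (E v))
                 (E#d : ∀ {v} → E v → ¬ E (v ⊕ d)) (E#e : ∀ {v} → E v → ¬ E (v ⊕ e))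
                 (d≢0 : ∀ v → v ⊕ d ≢ v) (e≢0 : ∀ v → v ⊕ e ≢ v) where

      Dart : Set
      Dart = Fin t × Bool

      flip : Dart → Dart
      flip (v , s) = v , not s

      -- A dart leaves its vertex by the slot true (forwards) or false (backwards);
      -- an exchanged edge joins two slots of the same kind.
      φ : Dart → Dart
      φ (v , true) with E? v | E? (v ⊕ - e)
      ... | yes _ | _     = v ⊕ e , false
      ... | no _  | yes _ = v ⊕ - e , false
      ... | no _  | no _  = v ⊕ d , true
      φ (v , false) with E? (v ⊕ - d) | E? (v ⊕ - d ⊕ - e)
      ... | yes _ | _     = v ⊕ e , true
      ... | no _  | yes _ = v ⊕ - e , true
      ... | no _  | no _  = v ⊕ - d , false

      φ-near : ∀ {v} → E v → φ (v , true) ≡ (v ⊕ e , false)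
      φ-near {v} ev with E? v | E? (v ⊕ - e)
      ... | yes _ | _ = refl
      ... | no ¬e | _ = ⊥-elim (¬e ev)

      φ-near′ : ∀ {v} → E v → φ (v ⊕ e , true) ≡ (v , false)
      φ-near′ {v} ev with E? (v ⊕ e) | E? (v ⊕ e ⊕ - e)
      ... | yes e′ | _     = ⊥-elim (E#e ev e′)
      ... | no _   | yes _ = cong (_, false) (⊕-inverse′ v e)
      ... | no _   | no ¬e = ⊥-elim (¬e (subst E (sym (⊕-inverse′ v e)) ev))

      φ-straight : ∀ {v} → ¬ E v → ¬ E (v ⊕ - e) → φ (v , true) ≡ (v ⊕ d , true)
      φ-straight {v} ¬e ¬e′ with E? v | E? (v ⊕ - e)
      ... | yes x | _     = ⊥-elim (¬e x)
      ... | no _  | yes x = ⊥-elim (¬e′ x)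
      ... | no _  | no _  = refl

      φ-far : ∀ {v} → E v → φ (v ⊕ d , false) ≡ (v ⊕ d ⊕ e , true)
      φ-far {v} ev with E? (v ⊕ d ⊕ - d) | E? (v ⊕ d ⊕ - d ⊕ - e)
      ... | yes _ | _ = refl
      ... | no ¬e | _ = ⊥-elim (¬e (subst E (sym (⊕-inverse′ v d)) ev))

      corner : ∀ v → v ⊕ d ⊕ e ⊕ - d ≡ v ⊕ e
      corner v = trans (cong (_⊕ - d) (⊕-comm v d e)) (⊕-inverse′ (v ⊕ e) d)

      φ-far′ : ∀ {v} → E v → φ (v ⊕ d ⊕ e , false) ≡ (v ⊕ d , true)
      φ-far′ {v} ev with E? (v ⊕ d ⊕ e ⊕ - d) | E? (v ⊕ d ⊕ e ⊕ - d ⊕ - e)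
      ... | yes e′ | _     = ⊥-elim (E#e ev (subst E (corner v) e′))
      ... | no _   | yes _ = cong (_, true) (⊕-inverse′ (v ⊕ d) e)
      ... | no _   | no ¬e = ⊥-elim (¬e (subst E (sym (trans (cong (_⊕ - e) (corner v)) (⊕-inverse′ v e))) ev))

      φ-back : ∀ {v} → ¬ E v → ¬ E (v ⊕ - e) → φ (v ⊕ d , false) ≡ (v , false)
      φ-back {v} ¬e ¬e′ with E? (v ⊕ d ⊕ - d) | E? (v ⊕ d ⊕ - d ⊕ - e)
      ... | yes x | _     = ⊥-elim (¬e (subst E (⊕-inverse′ v d) x))
      ... | no _  | yes x = ⊥-elim (¬e′ (subst (λ u → E (u ⊕ - e)) (⊕-inverse′ v d) x))
      ... | no _  | no _  = cong (_, false) (⊕-inverse′ v d)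

      data Edge : Dart → Dart → Set where
        nearᵉ     : ∀ {v} → E v → Edge (v , true) (v ⊕ e , true)
        straightᵉ : ∀ {v} → ¬ E v → ¬ E (v ⊕ - e) → Edge (v , true) (v ⊕ d , false)
        farᵉ      : ∀ {v} → E v → Edge (v ⊕ d , false) (v ⊕ d ⊕ e , false)

      edge-φ : ∀ {x y} → Edge x y → φ x ≡ flip y × φ y ≡ flip x
      edge-φ (nearᵉ ev)       = φ-near ev , φ-near′ ev
      edge-φ (straightᵉ p q)  = φ-straight p q , φ-back p q
      edge-φ (farᵉ ev)        = φ-far ev , φ-far′ ev

      edge : ∀ x → ∃ λ y → Edge x y ⊎ Edge y x
      edge (v , true) with E? v | E? (v ⊕ - e)
      ... | yes p | _     = _ , inj₁ (nearᵉ p)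
      ... | no _  | yes p = _ , inj₂ (subst (λ u → Edge (v ⊕ - e , true) (u , true)) (⊕-inverse v e) (nearᵉ p))
      ... | no p  | no q  = _ , inj₁ (straightᵉ p q)
      edge (v , false) with E? (v ⊕ - d) | E? (v ⊕ - d ⊕ - e)
      ... | yes p | _     = _ , inj₁ (subst (λ u → Edge (u , false) (u ⊕ e , false)) (⊕-inverse v d) (farᵉ p))
      ... | no _  | yes p = _ , inj₂ (subst (λ u → Edge (v ⊕ - d ⊕ - e ⊕ d , false) (u , false)) eq (farᵉ p))
        where
        eq : v ⊕ - d ⊕ - e ⊕ d ⊕ e ≡ v
        eq = trans (cong (_⊕ e) (⊕-comm (v ⊕ - d) (- e) d))
               (trans (⊕-inverse (v ⊕ - d ⊕ d) e) (⊕-inverse v d))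
      ... | no p  | no q  = _ , inj₂ (subst (λ u → Edge (v ⊕ - d , true) (u , false)) (⊕-inverse v d) (straightᵉ p q))

      mate : ∀ x → φ (flip (φ x)) ≡ flip x
      mate x with edge x
      ... | y , inj₁ xy = let p , q = edge-φ xy in
        trans (cong (λ z → φ (flip z)) p) (trans (cong (λ b → φ (proj₁ y , b)) (not-involutive (proj₂ y))) q)
      ... | y , inj₂ yx = let q , p = edge-φ yx in
        trans (cong (λ z → φ (flip z)) p) (trans (cong (λ b → φ (proj₁ y , b)) (not-involutive (proj₂ y))) q)

      flip-involutive : ∀ x → flip (flip x) ≡ x
      flip-involutive (v , s) = cong (v ,_) (not-involutive s)

      flip-injective : ∀ {x y} → flip x ≡ flip y → x ≡ y
      flip-injective {x} {y} eq = trans (sym (flip-involutive x)) (trans (cong flip eq) (flip-involutive y))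

      φ-injective : ∀ {x y} → φ x ≡ φ y → x ≡ y
      φ-injective {x} {y} eq = flip-injective (trans (sym (mate x)) (trans (cong (λ z → φ (flip z)) eq) (mate y)))

      edge-loopless : ∀ {x y} → Edge x y → proj₁ x ≢ proj₁ y
      edge-loopless (nearᵉ {v} _)       q = e≢0 v (sym q)
      edge-loopless (straightᵉ {v} _ _) q = d≢0 v (sym q)
      edge-loopless (farᵉ {v} _)        q = e≢0 (v ⊕ d) (sym q)

      φ-loopless : ∀ x → proj₁ (φ x) ≢ proj₁ x
      φ-loopless x eq with edge x
      ... | y , inj₁ xy = edge-loopless xy (trans (sym eq) (cong proj₁ (proj₁ (edge-φ xy))))
      ... | y , inj₂ yx = edge-loopless yx (trans (sym (cong proj₁ (proj₂ (edge-φ yx)))) eq)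

      start : Dart
      start = ⟦ + 0 ⟧ , true

      orbit : ℕ → Dart
      orbit zero    = start
      orbit (suc i) = φ (orbit i)

      orbit-shift : ∀ {i j} → orbit i ≡ orbit j → ∀ k → orbit (k ℕ.+ i) ≡ orbit (k ℕ.+ j)
      orbit-shift eq zero    = eq
      orbit-shift eq (suc k) = cong φ (orbit-shift eq k)

      orbit-cancel : ∀ i j → orbit (i ℕ.+ j) ≡ orbit i → orbit j ≡ start
      orbit-cancel zero    j eq = eq
      orbit-cancel (suc i) j eq = orbit-cancel i j (φ-injective eq)

      code : Dart → Fin (t ℕ.* 2)
      code (v , true)  = combine v Fin.zero
      code (v , false) = combine v (Fin.suc Fin.zero)

      code-injective : ∀ {x y} → code x ≡ code y → x ≡ y
      code-injective {v , true}  {w , true}  eq = cong (_, true) (proj₁ (combine-injective v _ w _ eq))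
      code-injective {v , true}  {w , false} eq with combine-injective v _ w _ eq
      ... | _ , ()
      code-injective {v , false} {w , true}  eq with combine-injective v _ w _ eq
      ... | _ , ()
      code-injective {v , false} {w , false} eq = cong (_, false) (proj₁ (combine-injective v _ w _ eq))

      recurrence : ∃ λ p → orbit (suc p) ≡ start
      recurrence with pigeonhole (ℕ.n<1+n (t ℕ.* 2)) (λ i → code (orbit (toℕ i)))
      ... | i , j , i<j , eq with ℕ.m≤n⇒∃[o]m+o≡n i<j
      ...   | p , i+p≡j = p , orbit-cancel (toℕ i) (suc p)
        (sym (trans (code-injective eq) (cong orbit (trans (sym i+p≡j) (sym (ℕ.+-suc (toℕ i) p))))))

      _≟D_ : (x y : Dart) → Dec (x ≡ y)
      _≟D_ = ≡-dec Fin._≟_ Bool._≟_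

      abstract
        minimal : ∃ λ p → orbit (suc p) ≡ start × (∀ k → k < p → orbit (suc k) ≢ start)
        minimal = least (λ p → orbit (suc p) ≟D start) (proj₁ recurrence) (proj₂ recurrence)

      p : ℕ
      p = suc (proj₁ minimal)

      orbit-p : orbit p ≡ start
      orbit-p = proj₁ (proj₂ minimal)

      orbit-+p : ∀ i → orbit (i ℕ.+ p) ≡ orbit i
      orbit-+p i = trans (orbit-shift {p} {0} orbit-p i) (cong orbit (ℕ.+-identityʳ i))

      orbit-*p : ∀ i k → orbit (i ℕ.+ k ℕ.* p) ≡ orbit i
      orbit-*p i zero    = cong orbit (ℕ.+-identityʳ i)
      orbit-*p i (suc k) = trans (cong orbit (trans (cong (i ℕ.+_) (ℕ.+-comm p (k ℕ.* p))) (sym (ℕ.+-assoc i (k ℕ.* p) p))))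
                             (trans (orbit-+p (i ℕ.+ k ℕ.* p)) (orbit-*p i k))

      orbit-% : ∀ i → orbit (i % p) ≡ orbit i
      orbit-% i = trans (sym (orbit-*p (i % p) (i / p))) (cong orbit (sym (ℕ.m≡m%n+[m/n]*n i p)))

      orbit-injective : ∀ {i j} → i < j → j < p → orbit i ≢ orbit j
      orbit-injective {i} {j} i<j (s≤s j<p) eq with ℕ.m≤n⇒∃[o]m+o≡n i<j
      ... | k , i+k≡j = proj₂ (proj₂ minimal) k (ℕ.≤-trans k<j j<p) (orbit-cancel i (suc k) (trans (cong orbit i+sk≡j) (sym eq)))
        where
        i+sk≡j : i ℕ.+ suc k ≡ j
        i+sk≡j = trans (ℕ.+-suc i k) i+k≡j
        k<j : k < j
        k<j = subst (suc k ≤_) i+sk≡j (ℕ.m≤n+m (suc k) i)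

      -- If the orbit met a vertex in both directions, then halfway between the two
      -- visits it would turn round at a vertex or traverse a loop.
      reversal : ∀ j i → orbit (i ℕ.+ j) ≢ flip (orbit i)
      reversal zero          i eq with proj₂ (orbit i) | cong proj₂ (trans (cong orbit (sym (ℕ.+-identityʳ i))) eq)
      ... | true  | ()
      ... | false | ()
      reversal (suc zero)    i eq = φ-loopless (orbit i) (cong proj₁ (trans (cong orbit (sym (ℕ.+-comm i 1))) eq))
      reversal (suc (suc j)) i eq = reversal j (suc i)
          (trans (sym (flip-involutive z)) (cong flip (trans (sym (mate z)) (cong φ back))))
        where
        z : Dart
        z = orbit (suc i ℕ.+ j)
        back : flip (φ z) ≡ orbit i
        back = trans (cong flip (trans (cong orbit (trans (cong suc (sym (ℕ.+-suc i j))) (sym (ℕ.+-suc i (suc j))))) eq))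
                 (flip-involutive (orbit i))

      vertices-distinct : ∀ {i j} → i < j → j < p → proj₁ (orbit i) ≢ proj₁ (orbit j)
      vertices-distinct {i} {j} i<j j<p eq with proj₂ (orbit i) Bool.≟ proj₂ (orbit j)
      ... | yes eq′ = orbit-injective i<j j<p (cong₂ _,_ eq eq′)
      ... | no neq = reversal (j ℕ.∸ i) i (trans (cong orbit (ℕ.m+[n∸m]≡n (ℕ.<⇒≤ i<j))) (cong₂ _,_ (sym eq) (¬-not (neq ∘ sym))))

      p≤t : p ≤ t
      p≤t = injective⇒≤ {f = λ (i : Fin p) → proj₁ (orbit (toℕ i))} inj
        where
        inj : ∀ {i j : Fin p} → proj₁ (orbit (toℕ i)) ≡ proj₁ (orbit (toℕ j)) → i ≡ j
        inj {i} {j} eq with ℕ.<-cmp (toℕ i) (toℕ j)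
        ... | tri< lt _ _ = ⊥-elim (vertices-distinct lt (toℕ<n j) eq)
        ... | tri≈ _ q _ = Fin.toℕ-injective q
        ... | tri> _ _ gt = ⊥-elim (vertices-distinct gt (toℕ<n i) (sym eq))

      Reached : Fin t → Set
      Reached v = ∃ λ (i : Fin p) → proj₁ (orbit (toℕ i)) ≡ v

      Reached? : ∀ v → Dec (Reached v)
      Reached? v = any? (λ i → proj₁ (orbit (toℕ i)) Fin.≟ v)

      reach : ∀ i {v} → proj₁ (orbit i) ≡ v → Reached v
      reach i eq = fromℕ< (ℕ.m%n<n i p) ,
        trans (cong proj₁ (trans (cong orbit (toℕ-fromℕ< (ℕ.m%n<n i p))) (orbit-% i))) eq

      -- The neighbour behind the dart orbit i is visited just before it.
      before : ∀ i → flip (φ (flip (orbit i))) ≡ orbit (ℕ.pred p ℕ.+ i)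
      before i = trans (cong (λ x → flip (φ (flip x))) (sym (trans (cong orbit (ℕ.+-comm p i)) (orbit-+p i))))
                   (trans (cong flip (mate (orbit (ℕ.pred p ℕ.+ i)))) (flip-involutive _))

      reached-φ : ∀ v s → Reached v → Reached (proj₁ (φ (v , s)))
      reached-φ v s (i , eq) with proj₂ (orbit (toℕ i)) Bool.≟ s
      ... | yes eq′ = reach (suc (toℕ i)) (cong (λ x → proj₁ (φ x)) (cong₂ _,_ eq eq′))
      ... | no neq  = reach (ℕ.pred p ℕ.+ toℕ i) (trans (cong proj₁ (sym (before (toℕ i)))) (cong (λ x → proj₁ (φ x)) (cong₂ _,_ eq (sym (¬-not (neq ∘ sym))))))

      indicator : Fin t → Bool
      indicator v = does (Reached? v)

      indicator-cong : ∀ {u v} → (Reached u → Reached v) → (Reached v → Reached u) → indicator u ≡ indicator v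
      indicator-cong {u} {v} to from = does-⇔ (mk⇔ to from) (Reached? u) (Reached? v)

      edge-reached : ∀ {x y} → Edge x y → indicator (proj₁ x) ≡ indicator (proj₁ y)
      edge-reached {x} {y} xy = indicator-cong
        (λ r → subst Reached (cong proj₁ (proj₁ (edge-φ xy))) (reached-φ (proj₁ x) (proj₂ x) r))
        (λ r → subst Reached (cong proj₁ (proj₂ (edge-φ xy))) (reached-φ (proj₁ y) (proj₂ y) r))

      module _ (conn : Connected d e E) where

        all-reached : ∀ v → Reached v
        all-reached v = decided (Reached? v) (trans (sym (conn indicator closed ⟦ + 0 ⟧ v)) (dec-true (Reached? ⟦ + 0 ⟧) (reach 0 refl)))
          where
          closed : Closed d e E indicator
          closed = record { straight = λ v a b → edge-reached (straightᵉ a b)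
                          ; near     = λ v a → edge-reached (nearᵉ a)
                          ; far      = λ v a → edge-reached (farᵉ a) }
          decided : ∀ {A : Set} (a? : Dec A) → does a? ≡ true → A
          decided (yes a) _ = a

        t≤p : t ≤ p
        t≤p = injective⇒≤ {f = λ v → proj₁ (all-reached v)} (λ {u} {v} eq →
          trans (sym (proj₂ (all-reached u))) (trans (cong (λ i → proj₁ (orbit (toℕ i))) eq) (proj₂ (all-reached v))))

        ham : Ham
        ham = record
          { walk   = λ i → proj₁ (orbit i)
          ; period = λ i → cong proj₁ (trans (cong orbit (trans (cong (ℕ._+ i) (ℕ.≤-antisym t≤p p≤t)) (ℕ.+-comm p i))) (orbit-+p i))
          ; onto   = λ v → toℕ (proj₁ (all-reached v)) , proj₂ (all-reached v)
          }

        ham-φ : ∀ v s → UArc ham v (proj₁ (φ (v , s)))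
        ham-φ v s with all-reached v
        ... | i , eq with proj₂ (orbit (toℕ i)) Bool.≟ s
        ...   | yes eq′ = toℕ i , inj₁ (eq , cong (λ x → proj₁ (φ x)) (cong₂ _,_ eq eq′))
        ...   | no neq = ℕ.pred p ℕ.+ toℕ i , inj₂
            ( trans (cong proj₁ (sym (before (toℕ i)))) (cong (λ x → proj₁ (φ x)) (cong₂ _,_ eq (sym (¬-not (neq ∘ sym)))))
            , trans (cong proj₁ (trans (cong orbit (ℕ.+-comm p (toℕ i))) (orbit-+p (toℕ i)))) eq)

        ham-edge : ∀ {x y} → Edge x y → UArc ham (proj₁ x) (proj₁ y)
        ham-edge {v , s} xy = subst (UArc ham v) (cong proj₁ (proj₁ (edge-φ xy))) (ham-φ v s)

module CosetCuts where
  open ResidueClasses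
  open Orbits
  open import Data.Nat as ℕ using (ℕ; zero; suc; NonZero; _<_; _≤_; s≤s; z≤n; _%_; _/_)
  import Data.Nat.Properties as ℕ
  import Data.Nat.DivMod as ℕ
  open import Data.Integer using (ℤ; +_; -_; _+_; _*_; _-_)
  import Data.Integer.Properties as ℤ
  open import Data.Fin as Fin using (Fin; toℕ; fromℕ<)
  open import Data.Fin.Properties as Fin using (toℕ<n; toℕ-fromℕ<)
  open import Data.Bool using (Bool)
  open import Data.Product using (∃; _×_; _,_; proj₁; proj₂)
  open import Data.Sum using (_⊎_; inj₁; inj₂; [_,_]′)
  open import Data.Empty using (⊥; ⊥-elim)
  open import Function using (_∘_)
  open import Relation.Nullary using (¬_; Dec; yes; no)
  open import Relation.Nullary.Decidable using (_⊎-dec_)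
  open import Relation.Binary.PropositionalEquality using (_≡_; _≢_; refl; sym; trans; cong; subst; module ≡-Reasoning)

  module Cosets (t : ℕ) .{{_ : NonZero t}} where
    open Residues t
    open Square t

    infixl 6 _▹_·_
    _▹_·_ : Fin t → ℕ → ℤ → Fin t
    v ▹ zero · d  = v
    v ▹ suc i · d = v ⊕ d ▹ i · d

    ▹-+ : ∀ v i j d → v ▹ (i ℕ.+ j) · d ≡ v ▹ i · d ▹ j · d
    ▹-+ v zero    j d = refl
    ▹-+ v (suc i) j d = ▹-+ (v ⊕ d) i j d

    ▹-* : ∀ v i d → v ▹ i · d ≡ v ⊕ (+ i * d)
    ▹-* v zero    d = sym (trans (cong (v ⊕_) (ℤ.*-zeroˡ d)) (⊕-identityʳ v))
    ▹-* v (suc i) d = trans (▹-* (v ⊕ d) i d) (trans (⊕-⊕ v d (+ i * d)) (cong (v ⊕_) (sym (ℤ.suc-* (+ i) d))))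

    ▹-cycle : ∀ v i k d → v ▹ i · d ≡ v → v ▹ (k ℕ.* i) · d ≡ v
    ▹-cycle v i zero    d eq = refl
    ▹-cycle v i (suc k) d eq = trans (▹-+ v i (k ℕ.* i) d) (trans (cong (_▹ (k ℕ.* i) · d) eq) (▹-cycle v i k d eq))

    record Index (d e : ℤ) (n : ℕ) .{{_ : NonZero n}} : Set where
      private module N = Residues n
      field
        κ     : Fin t → Fin n
        κ-d   : ∀ v → κ (v ⊕ d) ≡ κ v
        κ-e   : ∀ v → κ (v ⊕ e) ≡ κ v N.⊕ + 1
        coset : ∀ u v → κ u ≡ κ v → ∃ λ i → u ▹ i · d ≡ v

    Nodes : ℕ → (ℕ → Fin t) → Fin t → Set
    Nodes K y v = ∃ λ k → k < K × y k ≡ v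

    nodes? : ∀ K y v → Dec (Nodes K y v)
    nodes? K y v with Fin.any? {n = K} (λ i → y (toℕ i) Fin.≟ v)
    ... | yes (i , eq) = yes (toℕ i , toℕ<n i , eq)
    ... | no ¬p = no λ (k , k<K , eq) → ¬p (fromℕ< k<K , trans (cong y (toℕ-fromℕ< k<K)) eq)

    module Walk (d e : ℤ) (E : Fin t → Set) (E? : ∀ v → Dec (E v)) (f : Fin t → Bool) (closed : Closed d e E f) where

      Cut : Fin t → Set
      Cut v = E v ⊎ E (v ⊕ - e)

      cut? : ∀ v → Dec (Cut v)
      cut? v = E? v ⊎-dec E? (v ⊕ - e)

      uncut : ∀ j u → (∀ l → l < j → ¬ Cut (u ▹ l · d)) → f u ≡ f (u ▹ j · d)
      uncut zero    u _ = refl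
      uncut (suc j) u h = trans (straight closed u (h 0 (s≤s z≤n) ∘ inj₁) (h 0 (s≤s z≤n) ∘ inj₂))
                            (uncut j (u ⊕ d) (λ l l<j → h (suc l) (s≤s l<j)))

      first : ∀ i u → Cut (u ▹ i · d) → ∃ λ j → Cut (u ▹ j · d) × (∀ l → l < j → ¬ Cut (u ▹ l · d))
      first i u c = least (λ j → cut? (u ▹ j · d)) i c

      to-cut : ∀ i u → Cut (u ▹ i · d) → ∃ λ j → Cut (u ▹ j · d) × f u ≡ f (u ▹ j · d)
      to-cut i u c with first i u c
      ... | j , c′ , h = j , c′ , uncut j u h

      -- If u and z are the only cut vertices of their coset, the walk from u + d ends in z.
      segment : ∀ {u z} i → u ▹ i · d ≡ z → u ≢ z → Cut z →
                (∀ j → Cut (u ▹ j · d) → u ▹ j · d ≡ u ⊎ u ▹ j · d ≡ z) → f (u ⊕ d) ≡ f z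
      segment {u} {z} zero    eq u≢z _  _    = ⊥-elim (u≢z eq)
      segment {u} {z} (suc i) eq u≢z cz only with first i (u ⊕ d) (subst Cut (sym eq) cz)
      ... | j , c , h with only (suc j) c
      ...   | inj₂ eq′ = trans (uncut j (u ⊕ d) h) (cong f eq′)
      ...   | inj₁ eq′ = ⊥-elim (contra (suc i % suc j) refl)
        where
        reduce : u ▹ (suc i % suc j) · d ≡ z
        reduce = begin
          u ▹ (suc i % suc j) · d
            ≡⟨ cong (_▹ (suc i % suc j) · d) (▹-cycle u (suc j) (suc i / suc j) d eq′) ⟨
          u ▹ (suc i / suc j ℕ.* suc j) · d ▹ (suc i % suc j) · d
            ≡⟨ ▹-+ u (suc i / suc j ℕ.* suc j) (suc i % suc j) d ⟨
          u ▹ (suc i / suc j ℕ.* suc j ℕ.+ suc i % suc j) · d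
            ≡⟨ cong (λ m → u ▹ m · d) (trans (ℕ.+-comm _ (suc i % suc j)) (sym (ℕ.m≡m%n+[m/n]*n (suc i) (suc j)))) ⟩
          u ▹ suc i · d
            ≡⟨ eq ⟩
          z ∎
          where open ≡-Reasoning
        contra : ∀ r → suc i % suc j ≡ r → ⊥
        contra zero    r≡ = u≢z (trans (cong (λ m → u ▹ m · d) (sym r≡)) reduce)
        contra (suc r) r≡ = h r (ℕ.≤-pred (subst (_< suc j) r≡ (ℕ.m%n<n (suc i) (suc j))))
          (subst Cut (trans (sym reduce) (cong (λ m → u ▹ m · d) r≡)) cz)

    module Ring (d e : ℤ) (n : ℕ) .{{_ : NonZero n}} (I : Index d e n) (K : ℕ) (y : ℕ → Fin t)
                (y-index : ∀ k → k < K → Index.κ I (y k) ≡ Residues.⟦_⟧ n (+ k))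
                (y#e : ∀ {v} → Nodes K y v → ¬ Nodes K y (v ⊕ e))
                (0<K : 0 < K) (size : suc K ≡ n ⊎ (K ≡ n × ∃ λ j → n ≡ suc (j ℕ.+ j))) where
      open Index I
      private module N = Residues n

      K≤n : K ≤ n
      K≤n = [ (λ eq → ℕ.≤-trans (ℕ.n≤1+n K) (ℕ.≤-reflexive eq)) , ℕ.≤-reflexive ∘ proj₁ ]′ size

      node-unique : ∀ {j k v} → j < K → y j ≡ v → k < n → κ v ≡ N.⟦ + k ⟧ → j ≡ k
      node-unique j<K refl k<n eq = N.⟦⟧-injective-< (ℕ.≤-trans j<K K≤n) k<n (trans (sym (y-index _ j<K)) eq)

      κ-y⊕e : ∀ {k} → k < K → κ (y k ⊕ e) ≡ N.⟦ + suc k ⟧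
      κ-y⊕e {k} k<K = trans (κ-e (y k)) (trans (cong (N._⊕ + 1) (y-index k k<K))
        (trans (N.⟦⟧-⊕ (+ k) (+ 1)) (cong (λ m → N.⟦ + m ⟧) (ℕ.+-comm k 1))))

      connected : Connected d e (Nodes K y)
      connected f closed u v = trans (to-L₀ u) (sym (to-L₀ v))
        where
        open Walk d e (Nodes K y) (nodes? K y) f closed

        node : ∀ {k} → k < K → Nodes K y (y k)
        node k<K = _ , k<K , refl

        cut-right : ∀ {k} → k < K → Cut (y k ⊕ e)
        cut-right {k} k<K = inj₂ (k , k<K , sym (⊕-inverse′ (y k) e))

        κ-▹ : ∀ i u → κ (u ▹ i · d) ≡ κ u
        κ-▹ zero    u = refl
        κ-▹ (suc i) u = trans (κ-▹ i (u ⊕ d)) (κ-d u)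

        cut-cases : ∀ {w} → Cut w → (∃ λ k → k < K × w ≡ y k) ⊎ (∃ λ k → k < K × w ≡ y k ⊕ e)
        cut-cases (inj₁ (k , k<K , eq)) = inj₁ (k , k<K , sym eq)
        cut-cases {w} (inj₂ (k , k<K , eq)) = inj₂ (k , k<K , trans (sym (⊕-inverse w e)) (cong (_⊕ e) (sym eq)))

        L R : ℕ → Bool
        L k = f (y k)
        R k = f (y k ⊕ d)

        module Adjacent (k : ℕ) (k<K : suc k < K) where
          only : ∀ {w} → κ w ≡ N.⟦ + suc k ⟧ → Cut w → w ≡ y (suc k) ⊎ w ≡ y k ⊕ e
          only {w} κw c with cut-cases c
          ... | inj₁ (j , j<K , eq) with node-unique j<K (sym eq) (ℕ.≤-trans k<K K≤n) κw
          ...   | refl = inj₁ eq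
          only {w} κw c | inj₂ (j , j<K , eq) with ℕ.m≤n⇒m<n∨m≡n (ℕ.≤-trans j<K K≤n)
          ...   | inj₁ sj<n with N.⟦⟧-injective-< sj<n (ℕ.≤-trans k<K K≤n) (trans (sym (κ-y⊕e j<K)) (trans (cong κ (sym eq)) κw))
          ...     | refl = inj₂ eq
          only {w} κw c | inj₂ (j , j<K , eq) | inj₂ sj≡n
            with N.⟦⟧-injective-< {0} {suc k} (ℕ.≤-trans (ℕ.≤-trans (s≤s z≤n) k<K) K≤n) (ℕ.≤-trans k<K K≤n)
                  (trans (N.⟦⟧-cong (- + 1) (wrap n)) (trans (cong (λ m → N.⟦ + m ⟧) (sym sj≡n)) (trans (sym (κ-y⊕e j<K)) (trans (cong κ (sym eq)) κw))))
            where
            wrap : ∀ n → + 0 ≡ + n + - + 1 * + n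
            wrap n = sym (trans (cong (λ z → + n + z) (ℤ.-1*i≡-i (+ n))) (ℤ.+-inverseʳ (+ n)))
          ... | ()

          κu : κ (y (suc k)) ≡ N.⟦ + suc k ⟧
          κu = y-index (suc k) k<K
          κz : κ (y k ⊕ e) ≡ N.⟦ + suc k ⟧
          κz = κ-y⊕e (ℕ.<-trans (ℕ.n<1+n k) k<K)

          u≢z : y (suc k) ≢ y k ⊕ e
          u≢z eq = y#e (node (ℕ.<-trans (ℕ.n<1+n k) k<K)) (subst (Nodes K y) eq (node k<K))

          R-L : R (suc k) ≡ L k
          R-L = let i , eq = coset (y (suc k)) (y k ⊕ e) (trans κu (sym κz)) in
            trans (segment i eq u≢z (cut-right (ℕ.<-trans (ℕ.n<1+n k) k<K))
                    (λ j c → only (trans (κ-▹ j _) κu) c))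
                  (sym (near closed (y k) (node (ℕ.<-trans (ℕ.n<1+n k) k<K))))

          L-R : L (suc k) ≡ R k
          L-R = let i , eq = coset (y k ⊕ e) (y (suc k)) (trans κz (sym κu)) in
            sym (trans (far closed (y k) (node (ℕ.<-trans (ℕ.n<1+n k) k<K)))
                  (trans (cong f (⊕-comm (y k) d e))
                    (segment i eq (u≢z ∘ sym) (inj₁ (node k<K))
                      (λ j c → [ inj₂ , inj₁ ]′ (only (trans (κ-▹ j _) κz) c)))))

        even : ∀ j → j ℕ.+ j < K → L (j ℕ.+ j) ≡ L 0 × R (j ℕ.+ j) ≡ R 0
        even zero    _ = refl , refl
        even (suc j) h = let k = j ℕ.+ j
                             h′ : suc (suc k) < K
                             h′ = subst (_< K) (cong suc (ℕ.+-suc j j)) h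
                             h″ = ℕ.<-trans (ℕ.n<1+n (suc k)) h′
                             l , r = even j (ℕ.<-trans (ℕ.n<1+n k) h″)
                             eq = cong suc (ℕ.+-suc j j) in
          trans (cong L eq) (trans (Adjacent.L-R (suc k) h′) (trans (Adjacent.R-L k h″) l)) ,
          trans (cong R eq) (trans (Adjacent.R-L (suc k) h′) (trans (Adjacent.L-R k h″) r))

        R₀≡L₀ : R 0 ≡ L 0
        R₀≡L₀ = base size
          where
          0<n : 0 < n
          0<n = ℕ.≤-trans 0<K K≤n
          κu : κ (y 0) ≡ N.⟦ + 0 ⟧
          κu = y-index 0 0<K
          base : (suc K ≡ n ⊎ (K ≡ n × ∃ λ j → n ≡ suc (j ℕ.+ j))) → R 0 ≡ L 0
          base (inj₁ sK≡n) with coset (y 0 ⊕ d) (y 0) (κ-d (y 0))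
          ... | i , eq with to-cut i (y 0 ⊕ d) (subst Cut (sym eq) (inj₁ (node 0<K)))
          ...   | j , c , feq = trans feq (cong f (only c))
            where
            w = y 0 ⊕ d ▹ j · d
            κw : κ w ≡ N.⟦ + 0 ⟧
            κw = trans (κ-▹ (suc j) (y 0)) κu
            only : Cut w → w ≡ y 0
            only c with cut-cases c
            ... | inj₁ (k , k<K , eq′) with node-unique k<K (sym eq′) 0<n κw
            ...   | refl = eq′
            only c | inj₂ (k , k<K , eq′) with N.⟦⟧-injective-< {suc k} {0} (subst (suc k <_) sK≡n (s≤s k<K)) 0<n
                                                  (trans (sym (κ-y⊕e k<K)) (trans (cong κ (sym eq′)) κw))
            ... | ()
          base (inj₂ (K≡n , j , n≡)) = trans R₀-L (proj₁ (even j j+j<K))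
            where
            j+j<K : j ℕ.+ j < K
            j+j<K = ℕ.≤-reflexive (trans (sym n≡) (sym K≡n))
            z = y (j ℕ.+ j) ⊕ e
            κz : κ z ≡ N.⟦ + 0 ⟧
            κz = trans (κ-y⊕e j+j<K) (N.⟦⟧-cong (+ 1) (trans (cong +_ (sym n≡)) (sym (trans (ℤ.+-identityˡ _) (ℤ.*-identityˡ (+ n))))))
            u≢z : y 0 ≢ z
            u≢z eq = y#e (node j+j<K) (subst (Nodes K y) eq (node 0<K))
            only : ∀ {w} → κ w ≡ N.⟦ + 0 ⟧ → Cut w → w ≡ y 0 ⊎ w ≡ z
            only {w} κw c with cut-cases c
            ... | inj₁ (k , k<K , eq′) with node-unique k<K (sym eq′) 0<n κw
            ...   | refl = inj₁ eq′
            only {w} κw c | inj₂ (k , k<K , eq′) with ℕ.m≤n⇒m<n∨m≡n (ℕ.≤-trans k<K K≤n)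
            ...   | inj₂ sk≡n = inj₂ (trans eq′ (cong (λ m → y m ⊕ e) (ℕ.suc-injective (trans sk≡n n≡))))
            ...   | inj₁ sk<n with N.⟦⟧-injective-< {suc k} {0} sk<n 0<n (trans (sym (κ-y⊕e k<K)) (trans (cong κ (sym eq′)) κw))
            ...     | ()
            R₀-L : R 0 ≡ L (j ℕ.+ j)
            R₀-L = let i , eq = coset (y 0) z (trans κu (sym κz)) in
              trans (segment i eq u≢z (cut-right j+j<K) (λ l c → only (trans (κ-▹ l _) κu) c))
                    (sym (near closed (y (j ℕ.+ j)) (node j+j<K)))

        all : ∀ k → k < K → L k ≡ L 0 × R k ≡ L 0
        all zero    _   = refl , R₀≡L₀
        all (suc k) k<K = let l , r = all k (ℕ.<-trans (ℕ.n<1+n k) k<K) in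
          trans (Adjacent.L-R k k<K) r , trans (Adjacent.R-L k k<K) l

        cut-L₀ : ∀ {w} → Cut w → f w ≡ L 0
        cut-L₀ c with cut-cases c
        ... | inj₁ (k , k<K , eq) = trans (cong f eq) (proj₁ (all k k<K))
        ... | inj₂ (k , k<K , eq) = trans (cong f eq) (trans (sym (near closed (y k) (node k<K))) (proj₁ (all k k<K)))

        coset-cut : ∀ v → ∃ λ i → Cut (v ▹ i · d)
        coset-cut v with ℕ._<?_ (toℕ (κ v)) K
        ... | yes c<K = let i , eq = coset v (y (toℕ (κ v))) (trans (sym (N.⟦toℕ⟧ (κ v))) (sym (y-index _ c<K))) in
                        i , subst Cut (sym eq) (inj₁ (node c<K))
        ... | no c≮K = go size
          where
          go : (suc K ≡ n ⊎ (K ≡ n × ∃ λ j → n ≡ suc (j ℕ.+ j))) → ∃ λ i → Cut (v ▹ i · d)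
          go (inj₂ (K≡n , _)) = ⊥-elim (c≮K (subst (toℕ (κ v) <_) (sym K≡n) (toℕ<n (κ v))))
          go (inj₁ sK≡n) = i , subst Cut (sym eq) (cut-right pK<K)
            where
            pK = ℕ.pred K
            spK : suc pK ≡ K
            spK = ℕ.suc-pred K {{ℕ.>-nonZero 0<K}}
            pK<K : pK < K
            pK<K = ℕ.≤-reflexive spK
            c≡K : toℕ (κ v) ≡ K
            c≡K = ℕ.≤-antisym (ℕ.≤-pred (subst (toℕ (κ v) <_) (sym sK≡n) (toℕ<n (κ v)))) (ℕ.≮⇒≥ c≮K)
            reach = coset v (y pK ⊕ e) (trans (sym (N.⟦toℕ⟧ (κ v))) (trans (cong (λ m → N.⟦ + m ⟧) (trans c≡K (sym spK))) (sym (κ-y⊕e pK<K))))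
            i = proj₁ reach
            eq = proj₂ reach

        to-L₀ : ∀ v → f v ≡ L 0
        to-L₀ v = let i , c = coset-cut v
                      j , c′ , feq = to-cut i v c in trans feq (cut-L₀ c′)

module Lifting where
  open ResidueClasses
  open Orbits
  open CosetCuts
  open import Data.Nat as ℕ using (ℕ; suc; NonZero; _<_; _≤_; s≤s; z≤n)
  import Data.Nat.Properties as ℕ
  open import Data.Integer using (ℤ; +_; -_)
  open import Data.Fin as Fin using (Fin)
  open import Data.Fin.Properties as Fin using (_≟_)
  open import Data.Bool using (Bool)
  open import Data.Product using (_,_)
  open import Data.Sum using (_⊎_; inj₁; inj₂)
  open import Data.Empty using (⊥-elim)
  open import Function using (_∘_)
  open import Relation.Nullary using (¬_; yes; no)
  open import Relation.Binary.PropositionalEquality using (_≡_; _≢_; refl; sym; trans; cong; subst)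

  module Zigzag (t : ℕ) .{{_ : NonZero t}} where
    open Residues t
    open Square t
    open Cosets t

    nodes-suc : ∀ {K x v} → Nodes (suc K) x v → Nodes K x v ⊎ x K ≡ v
    nodes-suc (k , s≤s k≤K , eq) with ℕ.m≤n⇒m<n∨m≡n k≤K
    ... | inj₁ k<K = inj₁ (k , k<K , eq)
    ... | inj₂ refl = inj₂ eq

    nodes-weaken : ∀ {K x v} → Nodes K x v → Nodes (suc K) x v
    nodes-weaken (k , k<K , eq) = k , ℕ.m<n⇒m<1+n k<K , eq

    -- Two further nodes above the last node X only lengthen the cut strands
    -- through X and X + b, and let the strand through X - b make a detour.
    module _ (a b : ℤ) (g : ℕ) .{{_ : NonZero g}} (I : Index b a g)
             (x : ℕ → Fin t) (r₀ : ℕ)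
             (x₁ : x (suc r₀) ≡ x r₀ ⊕ a ⊕ - b) (x₂ : x (suc (suc r₀)) ≡ x r₀ ⊕ a ⊕ a)
             (bound : suc (suc (suc r₀)) ≤ g) (x-row : ∀ r → r < suc (suc (suc r₀)) → Index.κ I (x r) ≡ Residues.⟦_⟧ g (+ r))
             (b≢0 : ∀ v → v ⊕ b ≢ v) (2b≢0 : ∀ v → v ⊕ b ⊕ b ≢ v)
             where
      open Index I
      private module G = Residues g

      Old New : Fin t → Set
      Old = Nodes (suc r₀) x
      New = Nodes (suc (suc (suc r₀))) x

      private
        X L₁ M₁ R₁ L₂ M₂ R₂ M₃ R₃ : Fin t
        X = x r₀
        M₁ = X ⊕ a
        M₂ = M₁ ⊕ a
        M₃ = M₂ ⊕ a
        R₁ = M₁ ⊕ b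
        R₂ = M₂ ⊕ b
        R₃ = M₃ ⊕ b
        L₁ = M₁ ⊕ - b
        L₂ = M₂ ⊕ - b

        new : ∀ {v} → Old v → New v
        new = nodes-weaken ∘ nodes-weaken

        new-X : New X
        new-X = r₀ , ℕ.m<n⇒m<1+n (ℕ.m<n⇒m<1+n ℕ.≤-refl) , refl

        new-L₁ : New L₁
        new-L₁ = suc r₀ , ℕ.m<n⇒m<1+n ℕ.≤-refl , x₁

        new-M₂ : New M₂
        new-M₂ = suc (suc r₀) , ℕ.≤-refl , x₂

        new-cases : ∀ {v} → New v → Old v ⊎ (v ≡ L₁ ⊎ v ≡ M₂)
        new-cases n with nodes-suc n
        ... | inj₂ eq = inj₂ (inj₂ (trans (sym eq) x₂))
        ... | inj₁ n′ with nodes-suc n′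
        ...   | inj₁ o = inj₁ o
        ...   | inj₂ eq = inj₂ (inj₁ (trans (sym eq) x₁))

        row-⊕a : ∀ {v k} → κ v ≡ G.⟦ + k ⟧ → κ (v ⊕ a) ≡ G.⟦ + suc k ⟧
        row-⊕a {v} {k} eq = trans (κ-e v) (trans (cong (G._⊕ + 1) eq)
          (trans (G.⟦⟧-⊕ (+ k) (+ 1)) (cong (λ m → G.⟦ + m ⟧) (ℕ.+-comm k 1))))

        row-M₁ : κ M₁ ≡ G.⟦ + suc r₀ ⟧
        row-M₁ = row-⊕a (x-row r₀ (ℕ.m<n⇒m<1+n (ℕ.m<n⇒m<1+n ℕ.≤-refl)))

        row-M₂ : κ M₂ ≡ G.⟦ + suc (suc r₀) ⟧
        row-M₂ = row-⊕a row-M₁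

        +2-row : ∀ v → κ (v ⊕ a ⊕ a) ≢ κ v
        +2-row v eq with ⟦⟧-0 (trans (sym (trans (κ-e (v ⊕ a)) (trans (cong (G._⊕ + 1) (κ-e v)) (G.⊕-⊕ (κ v) (+ 1) (+ 1))))) eq)
          where
          ⟦⟧-0 : κ v G.⊕ + 2 ≡ κ v → G.⟦ + 2 ⟧ ≡ G.⟦ + 0 ⟧
          ⟦⟧-0 eq = trans (sym (G.⟦⟧-⊕ (+ 0) (+ 2))) (G.⊕-cancelʳ (+ toℕκ) (trans (G.⊕-comm G.⟦ + 0 ⟧ (+ 2) _)
                     (trans (cong (G._⊕ + 2) κv) (trans eq (sym κv)))))
            where
            toℕκ = Fin.toℕ (κ v)
            κv : G.⟦ + 0 ⟧ G.⊕ + toℕκ ≡ κ v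
            κv = trans (G.⟦⟧-⊕ (+ 0) (+ toℕκ)) (G.⟦toℕ⟧ (κ v))
        ... | eq′ with G.⟦⟧-injective-< (ℕ.≤-trans (s≤s (s≤s (s≤s z≤n))) bound) (ℕ.≤-trans (s≤s z≤n) bound) eq′
        ...   | ()

        +1-row : ∀ v → κ (v ⊕ a) ≢ κ v
        +1-row v eq = +2-row v (trans (κ-e (v ⊕ a)) (trans (cong (G._⊕ + 1) eq) (trans (sym (κ-e v)) eq)))

        π : Fin t → Fin t
        π v with v ≟ M₁ | v ≟ M₂ | v ≟ R₁ | v ≟ R₂
        ... | yes _ | _ | _ | _ = M₃
        ... | no _ | yes _ | _ | _ = M₃
        ... | no _ | no _ | yes _ | _ = R₃
        ... | no _ | no _ | no _ | yes _ = R₃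
        ... | no _ | no _ | no _ | no _ = v

        data View (v : Fin t) : Set where
          is-M₁ : v ≡ M₁ → View v
          is-M₂ : v ≡ M₂ → View v
          is-R₁ : v ≡ R₁ → View v
          is-R₂ : v ≡ R₂ → View v
          fixed : v ≢ M₁ → v ≢ M₂ → v ≢ R₁ → v ≢ R₂ → π v ≡ v → View v

        view : ∀ v → View v
        view v with v ≟ M₁ | v ≟ M₂ | v ≟ R₁ | v ≟ R₂ | fixed {v}
        ... | yes p | _ | _ | _ | _ = is-M₁ p
        ... | no _ | yes p | _ | _ | _ = is-M₂ p
        ... | no _ | no _ | yes p | _ | _ = is-R₁ p
        ... | no _ | no _ | no _ | yes p | _ = is-R₂ p
        ... | no p | no q | no r | no s | fix = fix p q r s refl

        M≢R : ∀ {u} → u ≢ u ⊕ b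
        M≢R = b≢0 _ ∘ sym

        M₁-row≢M₂ : κ M₁ ≢ κ M₂
        M₁-row≢M₂ = +1-row M₁ ∘ sym

        π-M₁ : π M₁ ≡ M₃
        π-M₁ with M₁ ≟ M₁
        ... | yes _ = refl
        ... | no ¬p = ⊥-elim (¬p refl)

        π-M₂ : π M₂ ≡ M₃
        π-M₂ with M₂ ≟ M₁ | M₂ ≟ M₂
        ... | yes _ | _ = refl
        ... | no _ | yes _ = refl
        ... | no _ | no ¬p = ⊥-elim (¬p refl)

        π-R₁ : π R₁ ≡ R₃
        π-R₁ with R₁ ≟ M₁ | R₁ ≟ M₂ | R₁ ≟ R₁
        ... | yes p | _ | _ = ⊥-elim (M≢R (sym p))
        ... | no _ | yes p | _ = ⊥-elim (M₁-row≢M₂ (trans (sym (κ-d M₁)) (cong κ p)))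
        ... | no _ | no _ | yes _ = refl
        ... | no _ | no _ | no ¬p = ⊥-elim (¬p refl)

        π-R₂ : π R₂ ≡ R₃
        π-R₂ with R₂ ≟ M₁ | R₂ ≟ M₂ | R₂ ≟ R₁ | R₂ ≟ R₂
        ... | yes p | _ | _ | _ = ⊥-elim (M₁-row≢M₂ (trans (cong κ (sym p)) (κ-d M₂)))
        ... | no _ | yes p | _ | _ = ⊥-elim (M≢R (sym p))
        ... | no _ | no _ | yes _ | _ = refl
        ... | no _ | no _ | no _ | yes _ = refl
        ... | no _ | no _ | no _ | no ¬p = ⊥-elim (¬p refl)

        π-row : ∀ {v} → κ v ≢ κ M₁ → κ v ≢ κ M₂ → π v ≡ v
        π-row {v} ≢₁ ≢₂ with view v
        ... | is-M₁ p = ⊥-elim (≢₁ (cong κ p))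
        ... | is-M₂ p = ⊥-elim (≢₂ (cong κ p))
        ... | is-R₁ p = ⊥-elim (≢₁ (trans (cong κ p) (κ-d M₁)))
        ... | is-R₂ p = ⊥-elim (≢₂ (trans (cong κ p) (κ-d M₂)))
        ... | fixed _ _ _ _ p = p

        π-number : ∀ {v k} → k < suc r₀ → κ v ≡ G.⟦ + k ⟧ → π v ≡ v
        π-number {v} {k} k<N eq = π-row
          (λ p → ℕ.<⇒≢ k<N (G.⟦⟧-injective-< (ℕ.≤-trans (ℕ.m<n⇒m<1+n (ℕ.m<n⇒m<1+n k<N)) bound)
                   (ℕ.≤-trans (ℕ.m<n⇒m<1+n ℕ.≤-refl) bound) (trans (sym eq) (trans p row-M₁))))
          (λ p → ℕ.<⇒≢ (ℕ.m<n⇒m<1+n k<N) (G.⟦⟧-injective-< (ℕ.≤-trans (ℕ.m<n⇒m<1+n (ℕ.m<n⇒m<1+n k<N)) bound)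
                   bound (trans (sym eq) (trans p row-M₂))))

        π-M₃ : π M₃ ≡ M₃
        π-M₃ = π-row (+2-row M₁) (+1-row M₂)

        π-R₃ : π R₃ ≡ R₃
        π-R₃ = π-row (+2-row M₁ ∘ trans (sym (κ-d M₃))) (+1-row M₂ ∘ trans (sym (κ-d M₃)))

        κ-⊖b : ∀ v → κ (v ⊕ - b) ≡ κ v
        κ-⊖b v = trans (sym (κ-d (v ⊕ - b))) (cong κ (⊕-inverse v b))

        ⊖≢⊕ : ∀ v → v ⊕ - b ≢ v ⊕ b
        ⊖≢⊕ v eq = 2b≢0 (v ⊕ - b) (trans (cong (_⊕ b) (⊕-inverse v b)) (sym eq))

        ⊖≢ : ∀ v → v ⊕ - b ≢ v
        ⊖≢ v eq = b≢0 (v ⊕ - b) (trans (⊕-inverse v b) (sym eq))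

        π-L₁ : π L₁ ≡ L₁
        π-L₁ with view L₁
        ... | is-M₁ p = ⊥-elim (⊖≢ M₁ p)
        ... | is-M₂ p = ⊥-elim (M₁-row≢M₂ (trans (sym (κ-⊖b M₁)) (cong κ p)))
        ... | is-R₁ p = ⊥-elim (⊖≢⊕ M₁ p)
        ... | is-R₂ p = ⊥-elim (M₁-row≢M₂ (trans (sym (κ-⊖b M₁)) (trans (cong κ p) (κ-d M₂))))
        ... | fixed _ _ _ _ p = p

        π-L₂ : π L₂ ≡ L₂
        π-L₂ with view L₂
        ... | is-M₁ p = ⊥-elim (M₁-row≢M₂ (trans (cong κ (sym p)) (κ-⊖b M₂)))
        ... | is-M₂ p = ⊥-elim (⊖≢ M₂ p)
        ... | is-R₁ p = ⊥-elim (M₁-row≢M₂ (trans (sym (κ-d M₁)) (trans (cong κ (sym p)) (κ-⊖b M₂))))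
        ... | is-R₂ p = ⊥-elim (⊖≢⊕ M₂ p)
        ... | fixed _ _ _ _ p = p

        not-old : ∀ {v} → κ v ≡ κ M₁ → ¬ Old v
        not-old {v} eq (k , k<N , eq′) = ℕ.<⇒≢ k<N (G.⟦⟧-injective-< (ℕ.≤-trans k<N+2 bound) (ℕ.≤-trans (ℕ.m<n⇒m<1+n ℕ.≤-refl) bound)
            (trans (sym (x-row k k<N+2)) (trans (cong κ eq′) (trans eq row-M₁))))
          where
          k<N+2 : k < suc (suc (suc r₀))
          k<N+2 = ℕ.m<n⇒m<1+n (ℕ.m<n⇒m<1+n k<N)

        module Invariant (f : Fin t → Bool) (closed : Closed a b New f) where

          L₁M₁ : f L₁ ≡ f M₁
          L₁M₁ = trans (near closed L₁ new-L₁) (cong f (⊕-inverse M₁ b))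

          M₁R₁ : f M₁ ≡ f R₁
          M₁R₁ = far closed X new-X

          R₁R₂ : f R₁ ≡ f R₂
          R₁R₂ = trans (straight closed R₁ ¬R₁ ¬M₁) (cong f (⊕-comm M₁ b a))
            where
            ¬R₁ : ¬ New R₁
            ¬R₁ n with new-cases n
            ... | inj₁ o = not-old (κ-d M₁) o
            ... | inj₂ (inj₁ p) = ⊖≢⊕ M₁ (sym p)
            ... | inj₂ (inj₂ p) = M₁-row≢M₂ (trans (sym (κ-d M₁)) (cong κ p))
            ¬M₁ : ¬ New (R₁ ⊕ - b)
            ¬M₁ n with new-cases (subst New (⊕-inverse′ M₁ b) n)
            ... | inj₁ o = not-old refl o
            ... | inj₂ (inj₁ p) = ⊖≢ M₁ (sym p)
            ... | inj₂ (inj₂ p) = M₁-row≢M₂ (cong κ p)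

          R₂M₂ : f R₂ ≡ f M₂
          R₂M₂ = sym (near closed M₂ new-M₂)

          M₂L₂ : f M₂ ≡ f L₂
          M₂L₂ = sym (trans (cong f (⊕-comm M₁ a (- b))) (trans (far closed L₁ new-L₁)
                   (cong f (trans (cong (_⊕ b) (⊕-comm M₁ (- b) a)) (⊕-inverse M₂ b)))))

          q : Fin t → Bool
          q v = f (π v)

          q≡f : ∀ {v} → π v ≡ v → q v ≡ f v
          q≡f = cong f

          closed-q : Closed a b Old q
          closed-q = record { straight = straight-q ; near = near-q ; far = far-q }
            where
            row : ∀ {k} → k < suc r₀ → κ (x k) ≡ G.⟦ + k ⟧
            row k<N = x-row _ (ℕ.m<n⇒m<1+n (ℕ.m<n⇒m<1+n k<N))

            near-q : ∀ v → Old v → q v ≡ q (v ⊕ b)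
            near-q v o@(k , k<N , refl) = trans (q≡f (π-number k<N (row k<N)))
              (trans (near closed v (new o)) (sym (q≡f (π-number k<N (trans (κ-d v) (row k<N))))))

            far-q : ∀ v → Old v → q (v ⊕ a) ≡ q (v ⊕ a ⊕ b)
            far-q v o@(k , k<N@(s≤s k≤r) , refl) with ℕ.m≤n⇒m<n∨m≡n k≤r
            ... | inj₁ k<r = trans (q≡f (π-number (s≤s k<r) (row-⊕a (row k<N))))
                  (trans (far closed v (new o)) (sym (q≡f (π-number (s≤s k<r) (trans (κ-d _) (row-⊕a (row k<N)))))))
            ... | inj₂ refl = trans (cong f π-M₁) (trans (far closed M₂ new-M₂) (sym (cong f π-R₁)))

            straight-q : ∀ v → ¬ Old v → ¬ Old (v ⊕ - b) → q v ≡ q (v ⊕ a)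
            straight-q v ¬o ¬o′ with view v
            ... | is-M₁ refl = cong f (trans π-M₁ (sym π-M₂))
            ... | is-M₂ refl = cong f (trans π-M₂ (sym π-M₃))
            ... | is-R₁ refl = cong f (trans π-R₁ (sym (trans (cong π (⊕-comm M₁ b a)) π-R₂)))
            ... | is-R₂ refl = cong f (trans π-R₂ (sym (trans (cong π (⊕-comm M₂ b a)) π-R₃)))
            ... | fixed ≢M₁ ≢M₂ ≢R₁ ≢R₂ π≡ with v ≟ L₁
            ...   | yes refl = trans (cong f π-L₁) (trans L₁M₁ (trans M₁R₁ (trans R₁R₂ (trans R₂M₂ (trans M₂L₂
                      (sym (trans (cong q (⊕-comm M₁ (- b) a)) (cong f π-L₂))))))))
            ...   | no ≢L₁ = trans (cong f π≡) (trans (straight closed v ¬n ¬n′) (sym (cong f π≡′)))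
              where
              ¬n : ¬ New v
              ¬n n with new-cases n
              ... | inj₁ o = ¬o o
              ... | inj₂ (inj₁ p) = ≢L₁ p
              ... | inj₂ (inj₂ p) = ≢M₂ p
              ¬n′ : ¬ New (v ⊕ - b)
              ¬n′ n with new-cases n
              ... | inj₁ o = ¬o′ o
              ... | inj₂ (inj₁ p) = ≢M₁ (⊕-cancelʳ (- b) p)
              ... | inj₂ (inj₂ p) = ≢R₂ (trans (sym (⊕-inverse v b)) (cong (_⊕ b) p))
              π≡′ : π (v ⊕ a) ≡ v ⊕ a
              π≡′ with view (v ⊕ a)
              ... | is-M₁ p = ⊥-elim (¬o (r₀ , ℕ.≤-refl , sym (⊕-cancelʳ a p)))
              ... | is-M₂ p = ⊥-elim (≢M₁ (⊕-cancelʳ a p))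
              ... | is-R₁ p = ⊥-elim (¬o′ (r₀ , ℕ.≤-refl , sym (trans (cong (_⊕ - b) (⊕-cancelʳ a (trans p (⊕-comm X a b)))) (⊕-inverse′ X b))))
              ... | is-R₂ p = ⊥-elim (≢R₁ (⊕-cancelʳ a (trans p (⊕-comm M₁ a b))))
              ... | fixed _ _ _ _ p = p

          constant : Connected a b Old → ∀ u → f u ≡ q L₁
          constant conn u with view u
          ... | is-M₁ refl = trans (sym L₁M₁) (sym (cong f π-L₁))
          ... | is-R₁ refl = trans (sym (trans L₁M₁ M₁R₁)) (sym (cong f π-L₁))
          ... | is-R₂ refl = trans (sym (trans L₁M₁ (trans M₁R₁ R₁R₂))) (sym (cong f π-L₁))
          ... | is-M₂ refl = trans (sym (trans L₁M₁ (trans M₁R₁ (trans R₁R₂ R₂M₂)))) (sym (cong f π-L₁))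
          ... | fixed _ _ _ _ p = trans (sym (cong f p)) (conn q closed-q u L₁)

      lift : Connected a b Old → Connected a b New
      lift conn f closed u v = trans (Invariant.constant f closed conn u) (sym (Invariant.constant f closed conn v))

module CosetIndices where
  open ResidueClasses
  open Orbits
  open CosetCuts
  open Lifting
  open import Data.Nat as ℕ using (ℕ; NonZero)
  import Data.Nat.Properties as ℕ
  import Data.Nat.DivMod as ℕ
  open import Data.Nat.Divisibility as ℕ using (_∣_; divides)
  open import Data.Nat.GCD using (gcd; gcd-GCD; gcd[m,n]∣m; gcd[m,n]∣n; gcd[m,n]≢0; module Bézout)
  open import Data.Nat.Coprimality using (Coprime)
  open import Data.Integer as ℤ using (ℤ; +_; -_; _+_; _*_; _-_; _%ℕ_; _/ℕ_)
  import Data.Integer.Properties as ℤ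
  open import Data.Integer.DivMod using (a≡a%ℕn+[a/ℕn]*n)
  open import Data.Integer.Tactic.RingSolver using (solve-∀)
  open import Data.Fin using (Fin; toℕ)
  open import Data.Product using (∃; ∃₂; _,_; proj₁; proj₂)
  open import Data.Sum using (inj₂)
  open import Relation.Binary.PropositionalEquality using (_≡_; sym; trans; cong; cong₂; module ≡-Reasoning)

  bezout : ∀ m n → ∃₂ λ u v → + gcd m n ≡ u * + m + v * + n
  bezout m n with Bézout.identity (gcd-GCD m n)
  ... | Bézout.Identity.+- x y eq = + x , - + y , (begin
      + gcd m n                                      ≡⟨ l (+ gcd m n) (+ y * + n) ⟩
      (+ gcd m n + + y * + n) + - (+ y * + n)        ≡⟨ cong (_+ - (+ y * + n)) (trans (cong (λ z → + gcd m n + z) (sym (ℤ.pos-* y n))) (cong +_ eq)) ⟩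
      + (x ℕ.* m) + - (+ y * + n)                    ≡⟨ cong₂ _+_ (ℤ.pos-* x m) (ℤ.neg-distribˡ-* (+ y) (+ n)) ⟩
      + x * + m + - + y * + n                        ∎)
    where
    open ≡-Reasoning
    l : ∀ g y → g ≡ (g + y) + - y
    l = solve-∀
  ... | Bézout.Identity.-+ x y eq = - + x , + y , (begin
      + gcd m n                                      ≡⟨ l (+ gcd m n) (+ x * + m) ⟩
      - (+ x * + m) + (+ gcd m n + + x * + m)        ≡⟨ cong (λ z → - (+ x * + m) + z) (trans (cong (λ z → + gcd m n + z) (sym (ℤ.pos-* x m))) (cong +_ eq)) ⟩
      - (+ x * + m) + + (y ℕ.* n)                    ≡⟨ cong₂ _+_ (ℤ.neg-distribˡ-* (+ x) (+ m)) (ℤ.pos-* y n) ⟩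
      - + x * + m + + y * + n                        ∎)
    where
    open ≡-Reasoning
    l : ∀ g y → g ≡ - y + (g + y)
    l = solve-∀

  pos-quotient : ∀ {m n} → m ∣ n → ∃ λ k → + n ≡ k * + m
  pos-quotient {m} (divides k eq) = + k , trans (cong +_ eq) (ℤ.pos-* k m)

  module Indices (t : ℕ) .{{_ : NonZero t}} where
    open Residues t
    open Cosets t

    ⊕-def : ∀ v z → v ⊕ z ≡ ⟦ + toℕ v + z ⟧
    ⊕-def v z = trans (cong (_⊕ z) (sym (⟦toℕ⟧ v))) (⟦⟧-⊕ (+ toℕ v) z)

    module _ (d e : ℕ) (coprime : Coprime d e) where

      n : ℕ
      n = gcd d t

      instance
        n≢0 : NonZero n
        n≢0 = ℕ.≢-nonZero (gcd[m,n]≢0 d t (inj₂ (ℕ.≢-nonZero⁻¹ t)))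

      private
        module N = Residues n

        inverse : ∃₂ λ e′ k → + e * e′ ≡ + 1 + k * + n
        inverse with gcd e n in eq | bezout e n | gcd[m,n]∣m e n | gcd[m,n]∣n e n
        ... | g | u , v , bz | g∣e | g∣n = u , - v , (begin
            + e * u                          ≡⟨ l (+ e) u v (+ n) ⟩
            (u * + e + v * + n) + - v * + n  ≡⟨ cong (_+ - v * + n) (sym bz) ⟩
            + g + - v * + n                  ≡⟨ cong (λ z → + z + - v * + n) g≡1 ⟩
            + 1 + - v * + n                  ∎)
          where
          open ≡-Reasoning
          l : ∀ e u v n → e * u ≡ (u * e + v * n) + - v * n
          l = solve-∀
          g≡1 : g ≡ 1
          g≡1 = coprime (ℕ.∣-trans g∣n (gcd[m,n]∣m d t) , g∣e)

        e′ k′ : ℤ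
        e′ = proj₁ inverse
        k′ = proj₁ (proj₂ inverse)
        ee′ : + e * e′ ≡ + 1 + k′ * + n
        ee′ = proj₂ (proj₂ inverse)

        d/n = proj₁ (pos-quotient (gcd[m,n]∣m d t))
        d≡ = proj₂ (pos-quotient (gcd[m,n]∣m d t))
        t/n = proj₁ (pos-quotient (gcd[m,n]∣n d t))
        t≡ = proj₂ (pos-quotient (gcd[m,n]∣n d t))

        κ : Fin t → Fin n
        κ v = N.⟦ + toℕ v * e′ ⟧

        κ-⟦⟧ : ∀ x → κ ⟦ x ⟧ ≡ N.⟦ x * e′ ⟧
        κ-⟦⟧ x with ⟦⟧-injective (⟦toℕ⟧ ⟦ x ⟧)
        ... | k , eq = N.⟦⟧-cong (k * t/n * e′) (trans (cong (_* e′) (trans eq (cong (λ z → x + k * z) t≡))) (l x k t/n (+ n) e′))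
          where
          l : ∀ x k t n e → (x + k * (t * n)) * e ≡ x * e + k * t * e * n
          l = solve-∀

        κ-⊕ : ∀ v z → κ (v ⊕ z) ≡ κ v N.⊕ (z * e′)
        κ-⊕ v z = trans (cong κ (⊕-def v z)) (trans (κ-⟦⟧ (+ toℕ v + z))
          (trans (cong N.⟦_⟧ (ℤ.*-distribʳ-+ e′ (+ toℕ v) z)) (sym (N.⟦⟧-⊕ (+ toℕ v * e′) (z * e′)))))

        ⊕-multiple : ∀ (c : Fin n) {x} y k → x ≡ y + k * + n → c N.⊕ x ≡ c N.⊕ y
        ⊕-multiple c {x} y k eq = trans (cong (N._⊕ x) (sym (N.⟦toℕ⟧ c))) (trans (N.⟦⟧-⊕ (+ toℕ c) x)
          (trans (N.⟦⟧-cong k (trans (cong (λ z → + toℕ c + z) eq) (sym (ℤ.+-assoc (+ toℕ c) y (k * + n)))))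
          (trans (sym (N.⟦⟧-⊕ (+ toℕ c) y)) (cong (N._⊕ y) (N.⟦toℕ⟧ c)))))

        coset : ∀ u v → κ u ≡ κ v → ∃ λ i → u ▹ i · + d ≡ v
        coset u v eq with N.⟦⟧-injective eq | bezout d t
        ... | k , U≡ | p , r , n≡ = i , (begin
            u ▹ i · + d                       ≡⟨ ▹-* u i (+ d) ⟩
            u ⊕ (+ i * + d)                   ≡⟨ ⊕-def u (+ i * + d) ⟩
            ⟦ + toℕ u + + i * + d ⟧           ≡⟨ ⟦⟧-cong (w * r - (- (w * p)) /ℕ t * + d) final ⟩
            ⟦ + toℕ v ⟧                       ≡⟨ ⟦toℕ⟧ v ⟩
            v ∎)
          where
          open ≡-Reasoning
          U V w : ℤ
          U = + toℕ u
          V = + toℕ v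
          w = k * + e - k′ * (U - V)
          i : ℕ
          i = (- (w * p)) %ℕ t
          U-V : U ≡ V + w * + n
          U-V = begin
            U                                           ≡⟨ l₁ U e′ (+ e) k′ (+ n) ⟩
            (U * e′) * + e + U * ((+ 1 + k′ * + n) - + e * e′) - U * k′ * + n
              ≡⟨ cong (λ z → z * + e + U * ((+ 1 + k′ * + n) - + e * e′) - U * k′ * + n) U≡ ⟩
            (V * e′ + k * + n) * + e + U * ((+ 1 + k′ * + n) - + e * e′) - U * k′ * + n
              ≡⟨ cong (λ z → (V * e′ + k * + n) * + e + U * z - U * k′ * + n) zero-diff ⟩
            (V * e′ + k * + n) * + e + U * + 0 - U * k′ * + n
              ≡⟨ l₂ U V e′ (+ e) k k′ (+ n) ⟩
            V * (+ e * e′) + (k * + e - k′ * U) * + n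
              ≡⟨ cong (λ z → V * z + (k * + e - k′ * U) * + n) ee′ ⟩
            V * (+ 1 + k′ * + n) + (k * + e - k′ * U) * + n
              ≡⟨ l₃ U V (+ e) k k′ (+ n) ⟩
            V + w * + n ∎
            where
            zero-diff : (+ 1 + k′ * + n) - + e * e′ ≡ + 0
            zero-diff = trans (cong (λ z → (+ 1 + k′ * + n) - z) ee′) (ℤ.+-inverseʳ (+ 1 + k′ * + n))
            l₁ : ∀ U e′ e k′ n → U ≡ (U * e′) * e + U * ((+ 1 + k′ * n) - e * e′) - U * k′ * n
            l₁ = solve-∀
            l₂ : ∀ U V e′ e k k′ n → (V * e′ + k * n) * e + U * + 0 - U * k′ * n ≡ V * (e * e′) + (k * e - k′ * U) * n
            l₂ = solve-∀
            l₃ : ∀ U V e k k′ n → V * (+ 1 + k′ * n) + (k * e - k′ * U) * n ≡ V + (k * e - k′ * (U - V)) * n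
            l₃ = solve-∀
          m : ℤ
          m = (- (w * p)) /ℕ t
          i≡ : + i ≡ - (w * p) - m * + t
          i≡ = trans (l (+ i) (m * + t)) (cong (_- m * + t) (sym (a≡a%ℕn+[a/ℕn]*n (- (w * p)) t)))
            where
            l : ∀ i x → i ≡ (i + x) - x
            l = solve-∀
          final : U + + i * + d ≡ V + (w * r - m * + d) * + t
          final = begin
            U + + i * + d                                              ≡⟨ cong₂ (λ x y → x + y * + d) U-V i≡ ⟩
            (V + w * + n) + (- (w * p) - m * + t) * + d                ≡⟨ cong (λ z → (V + w * z) + (- (w * p) - m * + t) * + d) n≡ ⟩
            (V + w * (p * + d + r * + t)) + (- (w * p) - m * + t) * + d ≡⟨ l V w p r m (+ d) (+ t) ⟩
            V + (w * r - m * + d) * + t                                ∎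
            where
            l : ∀ V w p r m d t → (V + w * (p * d + r * t)) + (- (w * p) - m * t) * d ≡ V + (w * r - m * d) * t
            l = solve-∀

      abstract
        index : Index (+ d) (+ e) n
        index = record
          { κ     = κ
          ; κ-d   = λ v → trans (κ-⊕ v (+ d)) (trans (⊕-multiple (κ v) (+ 0) (d/n * e′) (trans (cong (_* e′) d≡) (l d/n (+ n) e′))) (N.⊕-identityʳ (κ v)))
          ; κ-e   = λ v → trans (κ-⊕ v (+ e)) (⊕-multiple (κ v) (+ 1) k′ ee′)
          ; coset = coset
          }
          where
          l : ∀ d n e → d * n * e ≡ + 0 + d * e * n
          l = solve-∀

        κ-coordinates : ∀ r c → Index.κ index ⟦ r * + e + c * + d ⟧ ≡ N.⟦ r ⟧
        κ-coordinates r c = trans (κ-⟦⟧ (r * + e + c * + d)) (N.⟦⟧-cong (r * k′ + c * d/n * e′) (begin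
            (r * + e + c * + d) * e′                ≡⟨ cong (λ z → (r * + e + c * z) * e′) d≡ ⟩
            (r * + e + c * (d/n * + n)) * e′        ≡⟨ l₁ r (+ e) e′ c d/n (+ n) ⟩
            r * (+ e * e′) + c * d/n * e′ * + n     ≡⟨ cong (λ z → r * z + c * d/n * e′ * + n) ee′ ⟩
            r * (+ 1 + k′ * + n) + c * d/n * e′ * + n ≡⟨ l₂ r k′ c d/n e′ (+ n) ⟩
            r + (r * k′ + c * d/n * e′) * + n       ∎))
          where
          open ≡-Reasoning
          l₁ : ∀ r e e′ c d n → (r * e + c * (d * n)) * e′ ≡ r * (e * e′) + c * d * e′ * n
          l₁ = solve-∀
          l₂ : ∀ r k c d e n → r * (+ 1 + k * n) + c * d * e * n ≡ r + (r * k + c * d * e) * n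
          l₂ = solve-∀

module Exchanges where
  open ResidueClasses
  open Orbits
  open CosetCuts
  open Lifting
  open CosetIndices
  open import Data.Nat as ℕ using (ℕ; zero; suc; NonZero; _<_; _≤_; s≤s; z≤n; _⊓_; _∸_)
  import Data.Nat.Properties as ℕ
  open import Data.Nat.Divisibility as ℕ using (_∣_; divides; ∣⇒≤)
  open import Data.Nat.GCD using (gcd; gcd[m,n]∣m; gcd[m,n]∣n; gcd-greatest)
  open import Data.Nat.Coprimality as Coprimality using (Coprime)
  open import Data.Integer as ℤ using (ℤ; +_; -_; _+_; _*_; _-_; ∣_∣)
  import Data.Integer.Properties as ℤ
  open import Data.Integer.Tactic.RingSolver using (solve-∀)
  open import Data.Fin using (Fin; toℕ)
  open import Data.Product using (∃; ∃₂; _×_; _,_; proj₁; proj₂)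
  open import Data.Sum using (_⊎_; inj₁; inj₂; [_,_]′)
  open import Relation.Nullary using (¬_; Dec; yes; no)
  open import Relation.Binary.PropositionalEquality using (_≡_; _≢_; refl; sym; trans; cong; cong₂; subst; module ≡-Reasoning)

  data Parity : ℕ → Set where
    even : ∀ j → Parity (j ℕ.+ j)
    odd  : ∀ j → Parity (suc (j ℕ.+ j))

  parity : ∀ n → Parity n
  parity zero = even 0
  parity (suc n) with parity n
  ... | even j = odd j
  ... | odd j  = subst Parity (ℕ.+-suc (suc j) j) (even (suc j))

  record OddBelow (n : ℕ) : Set where
    field
      half : ℕ
      size : suc (suc (half ℕ.+ half)) ≡ n ⊎ suc (half ℕ.+ half) ≡ n

  odd-below : ∀ n → 0 < n → OddBelow n
  odd-below n 0<n with parity n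
  ... | odd j = record { half = j ; size = inj₂ refl }
  odd-below _ () | even zero
  ... | even (suc j) = record { half = j ; size = inj₁ (cong suc (sym (ℕ.+-suc j j))) }

  module Exchange (t : ℕ) .{{_ : NonZero t}} where
    open Residues t
    open Square t
    open Cosets t
    open Zigzag t
    open Indices t

    no-fixed-point : ∀ {k} → 0 < k → k < t → ∀ v → v ⊕ + k ≢ v
    no-fixed-point {k} 0<k k<t v eq = ℕ.<⇒≢ 0<k (sym (⟦⟧-injective-< k<t (ℕ.<-trans 0<k k<t) (begin
        ⟦ + k ⟧                               ≡⟨ cong ⟦_⟧ (l (+ toℕ v) (+ k)) ⟩
        ⟦ + toℕ v + + k + - + toℕ v ⟧         ≡⟨ ⟦⟧-⊕ (+ toℕ v + + k) (- + toℕ v) ⟨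
        ⟦ + toℕ v + + k ⟧ ⊕ - + toℕ v         ≡⟨ cong (_⊕ - + toℕ v) (trans (sym (⊕-def v (+ k))) (trans eq (sym (⟦toℕ⟧ v)))) ⟩
        ⟦ + toℕ v ⟧ ⊕ - + toℕ v               ≡⟨ ⟦⟧-⊕ (+ toℕ v) (- + toℕ v) ⟩
        ⟦ + toℕ v + - + toℕ v ⟧               ≡⟨ cong ⟦_⟧ (ℤ.+-inverseʳ (+ toℕ v)) ⟩
        ⟦ + 0 ⟧                               ∎)))
      where
      open ≡-Reasoning
      l : ∀ v k → k ≡ v + k + - v
      l = solve-∀

    alternate : ℕ → ℤ
    alternate zero          = + 0
    alternate (suc zero)    = - + 1
    alternate (suc (suc i)) = alternate i

    alternate-even : ∀ i → alternate (i ℕ.+ i) ≡ + 0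
    alternate-even zero    = refl
    alternate-even (suc i) = trans (cong (λ m → alternate (suc m)) (ℕ.+-suc i i)) (alternate-even i)

    alternate-odd : ∀ i → alternate (suc (i ℕ.+ i)) ≡ - + 1
    alternate-odd zero    = refl
    alternate-odd (suc i) = trans (cong (λ m → alternate (suc (suc m))) (ℕ.+-suc i i)) (alternate-odd i)

    alternate-step : ∀ i → alternate (suc i) ≡ alternate i + - + 1 ⊎ alternate (suc i) ≡ alternate i + + 1
    alternate-step zero          = inj₁ refl
    alternate-step (suc zero)    = inj₂ refl
    alternate-step (suc (suc i)) = alternate-step i

    module _ (a b : ℕ) (0<a : 0 < a) (0<b : 0 < b) (2a<t : a ℕ.+ a < t) (2b<t : b ℕ.+ b < t) (a⊥b : Coprime a b)
             (rows : OddBelow (gcd b t)) (columns : OddBelow (gcd a t)) (columns≤rows : OddBelow.half columns ≤ OddBelow.half rows) where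

      private
        b⊥a : Coprime b a
        b⊥a = Coprimality.sym a⊥b

        g q : ℕ
        g = gcd b t
        q = gcd a t

        instance
          g≢0 : NonZero g
          g≢0 = n≢0 b a b⊥a
          q≢0 : NonZero q
          q≢0 = n≢0 a b a⊥b

        module G = Residues g
        module Q = Residues q

        J H h : ℕ
        J = OddBelow.half rows
        H = OddBelow.half columns
        h = J ∸ H

        N′ K′ : ℕ
        N′ = J ℕ.+ J
        K′ = H ℕ.+ H

        a<t : a < t
        a<t = ℕ.≤-<-trans (ℕ.m≤m+n a a) 2a<t
        b<t : b < t
        b<t = ℕ.≤-<-trans (ℕ.m≤m+n b b) 2b<t

        a≢0 : ∀ v → v ⊕ + a ≢ v
        a≢0 = no-fixed-point 0<a a<t
        b≢0 : ∀ v → v ⊕ + b ≢ v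
        b≢0 = no-fixed-point 0<b b<t
        2b≢0 : ∀ v → v ⊕ + b ⊕ + b ≢ v
        2b≢0 v eq = no-fixed-point (ℕ.≤-trans 0<b (ℕ.m≤m+n b b)) 2b<t v (trans (sym (⊕-⊕ v (+ b) (+ b))) eq)

        N≤g : suc N′ ≤ g
        N≤g = [ (λ eq → ℕ.≤-trans (ℕ.n≤1+n _) (ℕ.≤-reflexive eq)) , ℕ.≤-reflexive ]′ (OddBelow.size rows)

        K≤q : suc K′ ≤ q
        K≤q = [ (λ eq → ℕ.≤-trans (ℕ.n≤1+n _) (ℕ.≤-reflexive eq)) , ℕ.≤-reflexive ]′ (OddBelow.size columns)

        c : ℕ → ℤ
        c r = + (r ⊓ K′) + alternate (r ∸ K′)

        x : ℕ → Fin t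
        x r = ⟦ + r * + a + c r * + b ⟧

        c-low : ∀ {r} → r ≤ K′ → c r ≡ + r
        c-low {r} r≤K = trans (cong₂ (λ m n → + m + alternate n) (ℕ.m≤n⇒m⊓n≡m r≤K) (ℕ.m≤n⇒m∸n≡0 r≤K)) (ℤ.+-identityʳ (+ r))

        c-high : ∀ i → c (K′ ℕ.+ i) ≡ + K′ + alternate i
        c-high i = cong₂ (λ m n → + m + alternate n) (ℕ.m≥n⇒m⊓n≡n (ℕ.m≤m+n K′ i)) (ℕ.m+n∸m≡n K′ i)

        c-step : ∀ r → c (suc r) ≡ c r + - + 1 ⊎ c (suc r) ≡ c r + + 1
        c-step r with ℕ.<-≤-connex r K′
        ... | inj₁ r<K = inj₂ (trans (c-low r<K) (trans (cong +_ (ℕ.+-comm 1 r)) (cong (_+ + 1) (sym (c-low (ℕ.<⇒≤ r<K))))))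
        ... | inj₂ K≤r with ℕ.m≤n⇒∃[o]m+o≡n K≤r
        ...   | i , refl with alternate-step i
        ...     | inj₁ eq = inj₁ (trans (cong c (sym (ℕ.+-suc K′ i))) (trans (c-high (suc i)) (trans (cong (λ z → + K′ + z) eq)
                              (trans (sym (ℤ.+-assoc (+ K′) (alternate i) (- + 1))) (cong (_+ - + 1) (sym (c-high i)))))))
        ...     | inj₂ eq = inj₂ (trans (cong c (sym (ℕ.+-suc K′ i))) (trans (c-high (suc i)) (trans (cong (λ z → + K′ + z) eq)
                              (trans (sym (ℤ.+-assoc (+ K′) (alternate i) (+ 1))) (cong (_+ + 1) (sym (c-high i)))))))

        x-suc : ∀ r z → c (suc r) ≡ c r + z → x (suc r) ≡ x r ⊕ + a ⊕ (z * + b)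
        x-suc r z eq = begin
          ⟦ + suc r * + a + c (suc r) * + b ⟧             ≡⟨ cong (λ y → ⟦ + suc r * + a + y * + b ⟧) eq ⟩
          ⟦ + suc r * + a + (c r + z) * + b ⟧             ≡⟨ cong ⟦_⟧ (l (+ r) (+ a) (c r) z (+ b)) ⟩
          ⟦ + r * + a + c r * + b + (+ a + z * + b) ⟧     ≡⟨ ⟦⟧-⊕ _ (+ a + z * + b) ⟨
          x r ⊕ (+ a + z * + b)                           ≡⟨ ⊕-⊕ (x r) (+ a) (z * + b) ⟨
          x r ⊕ + a ⊕ (z * + b)                           ∎
          where
          open ≡-Reasoning
          l : ∀ r a c z b → (+ 1 + r) * a + (c + z) * b ≡ r * a + c * b + (a + z * b)
          l = solve-∀

        x-row : ∀ r → Index.κ (index b a b⊥a) (x r) ≡ G.⟦ + r ⟧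
        x-row r = κ-coordinates b a b⊥a (+ r) (c r)

        x-column : ∀ r → Index.κ (index a b a⊥b) (x r) ≡ Q.⟦ c r ⟧
        x-column r = trans (cong (λ z → Index.κ (index a b a⊥b) ⟦ z ⟧) (ℤ.+-comm (+ r * + a) (c r * + b))) (κ-coordinates a b a⊥b (c r) (+ r))

        E : Fin t → Set
        E = Nodes (suc N′) x

        E? : ∀ v → Dec (E v)
        E? = nodes? (suc N′) x

        E#b : ∀ {v} → E v → ¬ E (v ⊕ + b)
        E#b (r , r<N , refl) (s , s<N , eq) with G.⟦⟧-injective-< (ℕ.≤-trans s<N N≤g) (ℕ.≤-trans r<N N≤g)
          (trans (sym (x-row s)) (trans (cong (Index.κ (index b a b⊥a)) eq) (trans (Index.κ-d (index b a b⊥a) (x r)) (x-row r))))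
        ... | refl = b≢0 (x r) (sym eq)

        c-last : c N′ ≡ + K′
        c-last = begin
          c N′                       ≡⟨ cong c split ⟩
          c (K′ ℕ.+ (h ℕ.+ h))       ≡⟨ c-high (h ℕ.+ h) ⟩
          + K′ + alternate (h ℕ.+ h) ≡⟨ cong (λ z → + K′ + z) (alternate-even h) ⟩
          + K′ + + 0                 ≡⟨ ℤ.+-identityʳ (+ K′) ⟩
          + K′                       ∎
          where
          open ≡-Reasoning
          split : N′ ≡ K′ ℕ.+ (h ℕ.+ h)
          split = trans (cong₂ ℕ._+_ (sym (ℕ.m+[n∸m]≡n columns≤rows)) (sym (ℕ.m+[n∸m]≡n columns≤rows))) (ℕ-l H h)
            where
            ℕ-l : ∀ H h → H ℕ.+ h ℕ.+ (H ℕ.+ h) ≡ H ℕ.+ H ℕ.+ (h ℕ.+ h)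
            ℕ-l H h = trans (ℕ.+-assoc H h (H ℕ.+ h)) (trans (cong (H ℕ.+_) (trans (sym (ℕ.+-assoc h H h)) (trans (cong (ℕ._+ h) (ℕ.+-comm h H)) (ℕ.+-assoc H h h)))) (sym (ℕ.+-assoc H H (h ℕ.+ h))))

        -- The squares of the last and the first row do not meet: otherwise g a would
        -- vanish, so that t / g would divide a and t, and hence q, which is at most 2.
        no-wrap : suc N′ ≡ g → x N′ ⊕ + a ≢ x 0
        no-wrap N≡g eq = ℕ.<⇒≱ 2b<t t≤2b
          where
          column : Index.κ (index a b a⊥b) (x N′ ⊕ + a) ≡ Q.⟦ + K′ ⟧
          column = trans (Index.κ-d (index a b a⊥b) (x N′)) (trans (x-column N′) (cong Q.⟦_⟧ c-last))
          0<q : 0 < q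
          0<q = ℕ.≤-trans (s≤s z≤n) K≤q
          K′≡0 : K′ ≡ 0
          K′≡0 = Q.⟦⟧-injective-< K≤q 0<q (trans (sym column) (trans (cong (Index.κ (index a b a⊥b)) eq) (trans (x-column 0) (cong Q.⟦_⟧ (c-low z≤n)))))
          q≤2 : q ≤ 2
          q≤2 = [ (λ e → ℕ.≤-reflexive (trans (sym e) (cong (λ m → suc (suc m)) K′≡0)))
                , (λ e → ℕ.≤-trans (ℕ.≤-reflexive (trans (sym e) (cong suc K′≡0))) (s≤s z≤n)) ]′ (OddBelow.size columns)
          vanish : ∃ λ k → + (g ℕ.* a) ≡ + 0 + k * + t
          vanish = ⟦⟧-injective {+ (g ℕ.* a)} {+ 0} (begin
            ⟦ + (g ℕ.* a) ⟧                                   ≡⟨ cong (λ m → ⟦ + (m ℕ.* a) ⟧) N≡g ⟨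
            ⟦ + (suc N′ ℕ.* a) ⟧                              ≡⟨ cong ⟦_⟧ (trans (ℤ.pos-* (suc N′) a) (l (+ N′) (+ a) (+ b))) ⟩
            ⟦ + N′ * + a + + 0 * + b + + a ⟧                  ≡⟨ ⟦⟧-⊕ _ (+ a) ⟨
            ⟦ + N′ * + a + + 0 * + b ⟧ ⊕ + a                  ≡⟨ cong (λ z → ⟦ + N′ * + a + z * + b ⟧ ⊕ + a) (trans c-last (cong +_ K′≡0)) ⟨
            x N′ ⊕ + a                                        ≡⟨ eq ⟩
            x 0                                               ≡⟨ cong (λ z → ⟦ + 0 * + a + z * + b ⟧) (c-low z≤n) ⟩
            ⟦ + 0 * + a + + 0 * + b ⟧                         ≡⟨ cong ⟦_⟧ (l₀ (+ a) (+ b)) ⟩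
            ⟦ + 0 ⟧                                           ∎)
            where
            open ≡-Reasoning
            l : ∀ n a b → (+ 1 + n) * a ≡ n * a + + 0 * b + a
            l = solve-∀
            l₀ : ∀ a b → + 0 * a + + 0 * b ≡ + 0
            l₀ = solve-∀
          t∣ga : t ∣ g ℕ.* a
          t∣ga = divides ∣ proj₁ vanish ∣ (trans (cong ∣_∣ (trans (proj₂ vanish) (ℤ.+-identityˡ (proj₁ vanish * + t)))) (ℤ.abs-* (proj₁ vanish) (+ t)))
          t≤2b : t ≤ b ℕ.+ b
          t≤2b with gcd[m,n]∣n b t
          ... | divides t′ t≡ = ℕ.≤-trans (ℕ.≤-reflexive t≡) (ℕ.≤-trans (ℕ.*-mono-≤ t′≤2 (∣⇒≤ {{ℕ.>-nonZero 0<b}} (gcd[m,n]∣m b t)))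
                                   (ℕ.≤-reflexive (cong (b ℕ.+_) (ℕ.+-identityʳ b))))
            where
            t′∣a : t′ ∣ a
            t′∣a = ℕ.*-cancelˡ-∣ g (subst (_∣ g ℕ.* a) (trans t≡ (ℕ.*-comm t′ g)) t∣ga)
            t′≤2 : t′ ≤ 2
            t′≤2 = ℕ.≤-trans (∣⇒≤ (gcd-greatest t′∣a (divides g (trans t≡ (ℕ.*-comm t′ g))))) q≤2

        E#a : ∀ {v} → E v → ¬ E (v ⊕ + a)
        E#a (r , r<N , refl) (s , s<N , eq) with ℕ.m≤n⇒m<n∨m≡n (ℕ.≤-trans r<N N≤g)
        ... | inj₁ sr<g with G.⟦⟧-injective-< (ℕ.≤-trans s<N N≤g) sr<g (trans (sym (x-row s)) (trans (cong (Index.κ (index b a b⊥a)) eq)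
                              (trans (Index.κ-e (index b a b⊥a) (x r)) (trans (cong (G._⊕ + 1) (x-row r)) (trans (G.⟦⟧-⊕ (+ r) (+ 1)) (cong (λ m → G.⟦ + m ⟧) (ℕ.+-comm r 1)))))))
        ...   | refl with c-step r
        ...     | inj₁ step = b≢0 _ (trans (cong (_⊕ + b) (trans (sym eq) (trans (x-suc r (- + 1) step) (cong (x r ⊕ + a ⊕_) (ℤ.-1*i≡-i (+ b)))))) (⊕-inverse (x r ⊕ + a) (+ b)))
        ...     | inj₂ step = b≢0 (x r ⊕ + a) (sym (trans (sym eq) (trans (x-suc r (+ 1) step) (cong (x r ⊕ + a ⊕_) (ℤ.*-identityˡ (+ b))))))
        E#a (r , r<N , refl) (s , s<N , eq) | inj₂ sr≡g with ℕ.≤-antisym (ℕ.≤-pred r<N) (ℕ.≤-pred (ℕ.≤-trans N≤g (ℕ.≤-reflexive (sym sr≡g))))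
        ... | refl with G.⟦⟧-injective-< {s} {0} (ℕ.≤-trans s<N N≤g) (ℕ.≤-trans (s≤s z≤n) N≤g) (trans (sym (x-row s)) (trans (cong (Index.κ (index b a b⊥a)) eq)
                              (trans (Index.κ-e (index b a b⊥a) (x r)) (trans (cong (G._⊕ + 1) (x-row r)) (trans (G.⟦⟧-⊕ (+ r) (+ 1))
                                (G.⟦⟧-cong (+ 1) (trans (cong +_ (trans (ℕ.+-comm r 1) sr≡g)) (sym (trans (ℤ.+-identityˡ _) (ℤ.*-identityˡ (+ g))))))))))) 
        ...   | refl = no-wrap sr≡g (sym eq)

        connected-b : Connected (+ b) (+ a) E
        connected-b = Ring.connected (+ b) (+ a) g (index b a b⊥a) (suc N′) x (λ k _ → x-row k) E#a (s≤s z≤n)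
          ([ inj₁ , (λ eq → inj₂ (eq , J , sym eq)) ]′ (OddBelow.size rows))

        K≤N : suc K′ ≤ suc N′
        K≤N = s≤s (ℕ.+-mono-≤ columns≤rows columns≤rows)

        extend : ∀ {K v} → K ≤ suc N′ → Nodes K x v → E v
        extend K≤N (k , k<K , eq) = k , ℕ.≤-trans k<K K≤N , eq

        connected-staircase : Connected (+ a) (+ b) (Nodes (suc K′) x)
        connected-staircase = Ring.connected (+ a) (+ b) q (index a b a⊥b) (suc K′) x
          (λ k k<K → trans (x-column k) (cong Q.⟦_⟧ (c-low (ℕ.≤-pred k<K))))
          (λ e e′ → E#b (extend K≤N e) (extend K≤N e′)) (s≤s z≤n)
          ([ inj₁ , (λ eq → inj₂ (eq , H , sym eq)) ]′ (OddBelow.size columns))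

        raise : ∀ i → H ℕ.+ i ≤ J → Connected (+ a) (+ b) (Nodes (suc (K′ ℕ.+ (i ℕ.+ i))) x)
        raise zero    _ = subst (λ m → Connected (+ a) (+ b) (Nodes (suc m) x)) (sym (ℕ.+-identityʳ K′)) connected-staircase
        raise (suc i) le = subst (λ m → Connected (+ a) (+ b) (Nodes (suc m) x)) r₀+2
            (lift (+ a) (+ b) g (index b a b⊥a) x r₀ x₁ x₂ bound (λ r _ → x-row r) b≢0 2b≢0 (raise i (ℕ.≤-trans (ℕ.+-monoʳ-≤ H (ℕ.n≤1+n i)) le)))
          where
          r₀ : ℕ
          r₀ = K′ ℕ.+ (i ℕ.+ i)
          r₀+2 : suc (suc r₀) ≡ K′ ℕ.+ (suc i ℕ.+ suc i)
          r₀+2 = trans (sym (trans (ℕ.+-suc K′ (suc (i ℕ.+ i))) (cong suc (ℕ.+-suc K′ (i ℕ.+ i))))) (cong (λ m → K′ ℕ.+ suc m) (sym (ℕ.+-suc i i)))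
          c₀ : c r₀ ≡ + K′
          c₀ = trans (c-high (i ℕ.+ i)) (trans (cong (λ z → + K′ + z) (alternate-even i)) (ℤ.+-identityʳ (+ K′)))
          c₁ : c (suc r₀) ≡ c r₀ + - + 1
          c₁ = trans (cong c (sym (ℕ.+-suc K′ (i ℕ.+ i)))) (trans (c-high (suc (i ℕ.+ i))) (trans (cong (λ z → + K′ + z) (alternate-odd i)) (cong (_+ - + 1) (sym c₀))))
          c₂ : c (suc (suc r₀)) ≡ c (suc r₀) + + 1
          c₂ = trans (trans (cong c r₀+2) (trans (c-high (suc i ℕ.+ suc i)) (trans (cong (λ z → + K′ + z) (alternate-even (suc i))) (ℤ.+-identityʳ (+ K′)))))
                 (trans (l (+ K′)) (cong (_+ + 1) (trans (cong (_+ - + 1) (sym c₀)) (sym c₁))))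
            where
            l : ∀ k → k ≡ k + - + 1 + + 1
            l = solve-∀
          x₁ : x (suc r₀) ≡ x r₀ ⊕ + a ⊕ - + b
          x₁ = trans (x-suc r₀ (- + 1) c₁) (cong (x r₀ ⊕ + a ⊕_) (ℤ.-1*i≡-i (+ b)))
          x₂ : x (suc (suc r₀)) ≡ x r₀ ⊕ + a ⊕ + a
          x₂ = trans (x-suc (suc r₀) (+ 1) c₂) (trans (cong (x (suc r₀) ⊕ + a ⊕_) (ℤ.*-identityˡ (+ b)))
                 (trans (cong (λ v → v ⊕ + a ⊕ + b) x₁) (trans (cong (_⊕ + b) (⊕-comm (x r₀ ⊕ + a) (- + b) (+ a))) (⊕-inverse (x r₀ ⊕ + a ⊕ + a) (+ b)))))
          bound : suc (suc (suc r₀)) ≤ g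
          bound = ℕ.≤-trans (s≤s (ℕ.≤-trans (ℕ.≤-reflexive (trans r₀+2 (l H (suc i)))) (ℕ.+-mono-≤ le le))) N≤g
            where
            l : ∀ H h → H ℕ.+ H ℕ.+ (h ℕ.+ h) ≡ H ℕ.+ h ℕ.+ (H ℕ.+ h)
            l H h = sym (trans (ℕ.+-assoc H h (H ℕ.+ h)) (trans (cong (H ℕ.+_) (trans (sym (ℕ.+-assoc h H h)) (trans (cong (ℕ._+ h) (ℕ.+-comm h H)) (ℕ.+-assoc H h h)))) (sym (ℕ.+-assoc H H (h ℕ.+ h)))))

        connected-a : Connected (+ a) (+ b) E
        connected-a = subst (λ m → Connected (+ a) (+ b) (Nodes (suc m) x)) (trans (l H h) (cong₂ ℕ._+_ H+h H+h)) (raise h (ℕ.≤-reflexive H+h))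
          where
          H+h : H ℕ.+ h ≡ J
          H+h = ℕ.m+[n∸m]≡n columns≤rows
          l : ∀ H h → H ℕ.+ H ℕ.+ (h ℕ.+ h) ≡ H ℕ.+ h ℕ.+ (H ℕ.+ h)
          l H h = sym (trans (ℕ.+-assoc H h (H ℕ.+ h)) (trans (cong (H ℕ.+_) (trans (sym (ℕ.+-assoc h H h)) (trans (cong (ℕ._+ h) (ℕ.+-comm h H)) (ℕ.+-assoc H h h)))) (sym (ℕ.+-assoc H H (h ℕ.+ h)))))

        module A = Orbit (+ a) (+ b) E E? E#a E#b a≢0 b≢0
        module B = Orbit (+ b) (+ a) E E? E#b E#a b≢0 a≢0

      exchanged : ∃₂ λ h₁ h₂ → ∀ v → (UArc h₁ v (v ⊕ + a) ⊎ UArc h₂ v (v ⊕ + a)) × (UArc h₁ v (v ⊕ + b) ⊎ UArc h₂ v (v ⊕ + b))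
      exchanged = A.ham connected-a , B.ham connected-b , λ v → a-edge v , b-edge v
        where
        a-edge : ∀ v → UArc (A.ham connected-a) v (v ⊕ + a) ⊎ UArc (B.ham connected-b) v (v ⊕ + a)
        a-edge v = go (E? v) (E? (v ⊕ - + b))
          where
          go : Dec (E v) → Dec (E (v ⊕ - + b)) → UArc (A.ham connected-a) v (v ⊕ + a) ⊎ UArc (B.ham connected-b) v (v ⊕ + a)
          go (yes e) _       = inj₂ (B.ham-edge connected-b (B.nearᵉ e))
          go (no _)  (yes e) = inj₂ (subst (λ u → UArc (B.ham connected-b) u (u ⊕ + a)) (⊕-inverse v (+ b)) (B.ham-edge connected-b (B.farᵉ e)))
          go (no ¬e) (no ¬f) = inj₁ (A.ham-edge connected-a (A.straightᵉ ¬e ¬f))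
        b-edge : ∀ v → UArc (A.ham connected-a) v (v ⊕ + b) ⊎ UArc (B.ham connected-b) v (v ⊕ + b)
        b-edge v = go (E? v) (E? (v ⊕ - + a))
          where
          go : Dec (E v) → Dec (E (v ⊕ - + a)) → UArc (A.ham connected-a) v (v ⊕ + b) ⊎ UArc (B.ham connected-b) v (v ⊕ + b)
          go (yes e) _       = inj₁ (A.ham-edge connected-a (A.nearᵉ e))
          go (no _)  (yes e) = inj₁ (subst (λ u → UArc (A.ham connected-a) u (u ⊕ + b)) (⊕-inverse v (+ a)) (A.ham-edge connected-a (A.farᵉ e)))
          go (no ¬e) (no ¬f) = inj₂ (B.ham-edge connected-b (B.straightᵉ ¬e ¬f))

    two-ham-cycles : ∀ a b → 0 < a → 0 < b → a ℕ.+ a < t → b ℕ.+ b < t → Coprime a b →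
                     ∃₂ λ h₁ h₂ → ∀ v → (UArc h₁ v (v ⊕ + a) ⊎ UArc h₂ v (v ⊕ + a)) × (UArc h₁ v (v ⊕ + b) ⊎ UArc h₂ v (v ⊕ + b))
    two-ham-cycles a b 0<a 0<b 2a<t 2b<t a⊥b with odd-below (gcd b t) (0<gcd b) | odd-below (gcd a t) (0<gcd a)
      where
      0<gcd : ∀ a → 0 < gcd a t
      0<gcd a = ℕ.n≢0⇒n>0 (λ eq → ℕ.≢-nonZero⁻¹ t (ℕ.0∣⇒≡0 (subst (_∣ t) eq (gcd[m,n]∣n a t))))
    ... | rows | columns with ℕ.≤-total (OddBelow.half columns) (OddBelow.half rows)
    ...   | inj₁ le = exchanged a b 0<a 0<b 2a<t 2b<t a⊥b rows columns le
    ...   | inj₂ le with exchanged b a 0<b 0<a 2b<t 2a<t (Coprimality.sym a⊥b) columns rows le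
    ...     | h₁ , h₂ , arcs = h₁ , h₂ , λ v → proj₂ (arcs v) , proj₁ (arcs v)

module Factors where
  open import Defs
  open import Data.Nat as ℕ using (ℕ; zero; suc; _+_; _≤_; _<_)
  import Data.Nat.Properties as ℕ
  open import Data.Nat.ListAction using (sum)
  open import Data.Fin as Fin using (Fin; zero; suc; toℕ; punchIn; punchOut)
  open import Data.Fin.Properties as Fin using (toℕ<n; toℕ-fromℕ<; toℕ-injective; injective⇒≤; any?)
  open import Data.List using (List; []; _∷_; _++_; map; concat; length; lookup; tabulate)
  open import Data.List.Properties using (length-map; length-++; tabulate-lookup; map-tabulate; length-tabulate; tabulate-cong; map-∘; map-cong)
  open import Data.List.Membership.Propositional using (_∈_)
  open import Data.List.Membership.Propositional.Properties using (∈-lookup; ∈-++⁺ˡ; ∈-++⁺ʳ; ∈-map⁺; ∈-concat⁺; ∈-tabulate⁺)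
  open import Data.List.Relation.Unary.Any as Any using (Any; here; there; index)
  open import Data.List.Relation.Unary.Any.Properties using (lookup-index; tabulate⁺; map⁺)
  open import Data.List.Relation.Unary.All as All using (All; []; _∷_)
  import Data.List.Relation.Unary.All.Properties as All
  open import Data.List.Relation.Unary.AllPairs using ([]; _∷_)
  open import Data.List.Relation.Unary.Unique.Propositional using (Unique)
  import Data.List.Relation.Unary.Unique.Propositional.Properties as Unique
  open import Data.Product using (Σ; ∃; ∃₂; _×_; _,_; proj₁; proj₂)
  open import Data.Sum using (inj₁; inj₂)
  open import Data.Empty using (⊥; ⊥-elim)
  open import Function using (_∘_)
  open import Relation.Nullary using (¬_; yes; no)
  open import Relation.Binary.PropositionalEquality using (_≡_; _≢_; refl; sym; trans; cong; subst)

  data At {A : Set} : List A → ℕ → A → Set where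
    here  : ∀ {x xs} → At (x ∷ xs) 0 x
    there : ∀ {x xs i y} → At xs i y → At (x ∷ xs) (suc i) y

  module _ {A : Set} where

    at-index : ∀ {xs : List A} {i x} → At xs i x → ∃ λ (j : Fin (length xs)) → toℕ j ≡ i × lookup xs j ≡ x
    at-index here = zero , refl , refl
    at-index (there p) with at-index p
    ... | j , eq , l = suc j , cong suc eq , l

    at-cong : ∀ {xs : List A} {i j x} → i ≡ j → At xs i x → At xs j x
    at-cong refl p = p

    at-++ˡ : ∀ {xs ys : List A} {i x} → At xs i x → At (xs ++ ys) i x
    at-++ˡ here      = here
    at-++ˡ (there p) = there (at-++ˡ p)

    at-++ʳ : ∀ (xs : List A) {ys i x} → At ys i x → At (xs ++ ys) (length xs + i) x
    at-++ʳ []       p = p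
    at-++ʳ (x ∷ xs) p = there (at-++ʳ xs p)

    at-tabulate : ∀ {n} (f : Fin n → A) j → At (tabulate f) (toℕ j) (f j)
    at-tabulate f zero    = here
    at-tabulate f (suc j) = there (at-tabulate (f ∘ suc) j)

  at-map : ∀ {A B : Set} (f : A → B) {xs i x} → At xs i x → At (map f xs) i (f x)
  at-map f here      = here
  at-map f (there p) = there (at-map f p)

  next-suc : ∀ {m} (i : Fin m) → suc (toℕ i) < m → toℕ (next i) ≡ suc (toℕ i)
  next-suc {suc k} i h with suc (toℕ i) ℕ.<? suc k
  ... | yes p = toℕ-fromℕ< p
  ... | no ¬p = ⊥-elim (¬p h)

  next-last : ∀ {m} (i : Fin m) → suc (toℕ i) ≡ m → toℕ (next i) ≡ 0
  next-last {suc k} i h with suc (toℕ i) ℕ.<? suc k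
  ... | yes p = ⊥-elim (ℕ.<⇒≢ p h)
  ... | no _  = refl

  next≢ : ∀ {m} → 2 ≤ m → (i : Fin m) → next i ≢ i
  next≢ {m} 2≤m i eq with ℕ.m≤n⇒m<n∨m≡n (toℕ<n i)
  ... | inj₁ lt = ℕ.1+n≢n (trans (sym (next-suc i lt)) (cong toℕ eq))
  ... | inj₂ last = ℕ.<⇒≢ 2≤m (trans (cong suc (trans (sym (next-last i last)) (cong toℕ eq))) last)

  data Follows {A : Set} (c : List A) (u v : A) : Set where
    step : ∀ {i} → At c i u → At c (suc i) v → Follows c u v
    wrap : ∀ {i} → At c i u → suc i ≡ length c → At c 0 v → Follows c u v

  module _ {A : Set} where

    follows-index : ∀ {c : List A} {u v} → Follows c u v → ∃ λ i → lookup c i ≡ u × lookup c (next i) ≡ v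
    follows-index {c} (step p q) with at-index p | at-index q
    ... | i , refl , l | j , j≡ , l′ = i , l , trans (cong (lookup c) (toℕ-injective
      (trans (next-suc i (subst (_< length c) j≡ (toℕ<n j))) (sym j≡)))) l′
    follows-index {c} (wrap p last q) with at-index p | at-index q
    ... | i , refl , l | j , j≡ , l′ = i , l , trans (cong (lookup c) (toℕ-injective (trans (next-last i last) (sym j≡)))) l′

    follows-next : ∀ {n} (f : Fin n → A) i → Follows (tabulate f) (f i) (f (next i))
    follows-next {n} f i with ℕ.m≤n⇒m<n∨m≡n (toℕ<n i)
    ... | inj₁ lt = step (at-tabulate f i) (subst (λ k → At (tabulate f) k (f (next i))) (next-suc i lt) (at-tabulate f (next i)))
    ... | inj₂ last = wrap (at-tabulate f i) (trans last (sym (length-tabulate f)))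
                            (subst (λ k → At (tabulate f) k (f (next i))) (next-last i last) (at-tabulate f (next i)))

  follows-map : ∀ {A B : Set} (f : A → B) {c u v} → Follows c u v → Follows (map f c) (f u) (f v)
  follows-map f (step p q)        = step (at-map f p) (at-map f q)
  follows-map f {c} (wrap p eq q) = wrap (at-map f p) (trans eq (sym (length-map f c))) (at-map f q)

  record LFactor (V : Set) (ns : List ℕ) : Set where
    field
      cycles   : List (List V)
      shape    : map length cycles ≡ ns
      complete : ∀ v → Any (v ∈_) cycles

  open LFactor public

  Arc : ∀ {V ns} → LFactor V ns → V → V → Set
  Arc F u v = Any (λ c → Follows c u v) (cycles F)

  map-factor : ∀ {V W ns} (f : V → W) → (∀ w → ∃ λ v → f v ≡ w) → LFactor V ns → LFactor W ns
  map-factor f onto F = record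
    { cycles   = map (map f) (cycles F)
    ; shape    = trans (sym (map-∘ (cycles F))) (trans (map-cong (length-map f) (cycles F)) (shape F))
    ; complete = λ w → subst (λ x → Any (x ∈_) (map (map f) (cycles F))) (proj₂ (onto w))
                         (map⁺ (Any.map (∈-map⁺ f) (complete F (proj₁ (onto w)))))
    }

  map-arc : ∀ {V W ns} (f : V → W) onto (F : LFactor V ns) {u v} → Arc F u v → Arc (map-factor f onto F) (f u) (f v)
  map-arc f onto F a = map⁺ (Any.map (follows-map f) a)

  injective⇒surjective : ∀ {m n} → m ≡ n → (f : Fin m → Fin n) → (∀ {i j} → f i ≡ f j → i ≡ j) → ∀ j → ∃ λ i → f i ≡ j
  injective⇒surjective {n} refl f inj j with any? (λ i → f i Fin.≟ j)
  ... | yes p = p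
  ... | no ¬p = ⊥-elim (ℕ.1+n≰n (injective⇒≤ {f = extend} extend-injective))
    where
    extend : Fin (suc n) → Fin n
    extend zero    = j
    extend (suc i) = f i
    extend-injective : ∀ {i k} → extend i ≡ extend k → i ≡ k
    extend-injective {zero}  {zero}  _  = refl
    extend-injective {zero}  {suc k} eq = ⊥-elim (¬p (k , sym eq))
    extend-injective {suc i} {zero}  eq = ⊥-elim (¬p (i , eq))
    extend-injective {suc i} {suc k} eq = cong suc (inj eq)

  surjective⇒injective : ∀ {m n} → m ≡ n → (f : Fin m → Fin n) → (∀ j → ∃ λ i → f i ≡ j) → ∀ {i j} → f i ≡ f j → i ≡ j
  surjective⇒injective {n = n} refl f sur {i} {j} eq with injective⇒surjective refl g g-injective i | injective⇒surjective refl g g-injective j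
    where
    g : Fin n → Fin n
    g k = proj₁ (sur k)
    g-injective : ∀ {k l} → g k ≡ g l → k ≡ l
    g-injective {k} {l} e = trans (sym (proj₂ (sur k))) (trans (cong f e) (proj₂ (sur l)))
  ... | k , refl | l , refl = cong (λ k → proj₁ (sur k)) (trans (sym (proj₂ (sur k))) (trans eq (proj₂ (sur l))))

  complete⇒unique : ∀ {n} (xs : List (Fin n)) → length xs ≡ n → (∀ v → v ∈ xs) → Unique xs
  complete⇒unique xs len mem = subst Unique (tabulate-lookup xs)
    (Unique.tabulate⁺ (surjective⇒injective len (lookup xs) (λ v → index (mem v) , sym (lookup-index (mem v)))))

  module _ {A : Set} where

    unique-++ : ∀ (xs : List A) {ys} → Unique (xs ++ ys) → Unique xs × Unique ys × (∀ {v} → v ∈ xs → v ∈ ys → ⊥)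
    unique-++ []       u = [] , u , λ ()
    unique-++ (x ∷ xs) (x∉ ∷ u) with unique-++ xs u
    ... | uxs , uys , disj = All.++⁻ˡ xs x∉ ∷ uxs , uys , disj′
      where
      disj′ : ∀ {v} → v ∈ x ∷ xs → v ∈ _ → ⊥
      disj′ (here refl) v∈ys = All.lookup (All.++⁻ʳ xs x∉) v∈ys refl
      disj′ (there v∈)  v∈ys = disj v∈ v∈ys

    lookup-unique : ∀ {xs : List A} → Unique xs → ∀ {i j} → lookup xs i ≡ lookup xs j → i ≡ j
    lookup-unique (x∉ ∷ u) {zero}  {zero}  eq = refl
    lookup-unique {x ∷ xs} (x∉ ∷ u) {zero}  {suc j} eq = ⊥-elim (All.lookup x∉ (∈-lookup j) eq)
    lookup-unique {x ∷ xs} (x∉ ∷ u) {suc i} {zero}  eq = ⊥-elim (All.lookup x∉ (∈-lookup i) (sym eq))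
    lookup-unique (x∉ ∷ u) {suc i} {suc j} eq = cong suc (lookup-unique u eq)

    vertex : ∀ (cs : List (List A)) (i : Fin (length (map length cs))) → Fin (lookup (map length cs) i) → A
    vertex (c ∷ cs) zero    a = lookup c a
    vertex (c ∷ cs) (suc i) a = vertex cs i a

    vertex∈ : ∀ cs i a → vertex cs i a ∈ concat cs
    vertex∈ (c ∷ cs) zero    a = ∈-++⁺ˡ (∈-lookup {xs = c} a)
    vertex∈ (c ∷ cs) (suc i) a = ∈-++⁺ʳ c (vertex∈ cs i a)

    vertex-injective : ∀ cs → Unique (concat cs) → ∀ i {a b} → vertex cs i a ≡ vertex cs i b → a ≡ b
    vertex-injective (c ∷ cs) u zero    eq = lookup-unique (proj₁ (unique-++ c u)) eq
    vertex-injective (c ∷ cs) u (suc i) eq = vertex-injective cs (proj₁ (proj₂ (unique-++ c u))) i eq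

    vertex-disjoint : ∀ cs → Unique (concat cs) → ∀ i j a b → vertex cs i a ≡ vertex cs j b → i ≡ j
    vertex-disjoint (c ∷ cs) u zero    zero    a b eq = refl
    vertex-disjoint (c ∷ cs) u zero    (suc j) a b eq = ⊥-elim (proj₂ (proj₂ (unique-++ c u)) (∈-lookup a) (subst (_∈ concat cs) (sym eq) (vertex∈ cs j b)))
    vertex-disjoint (c ∷ cs) u (suc i) zero    a b eq = ⊥-elim (proj₂ (proj₂ (unique-++ c u)) (∈-lookup b) (subst (_∈ concat cs) eq (vertex∈ cs i a)))
    vertex-disjoint (c ∷ cs) u (suc i) (suc j) a b eq = cong suc (vertex-disjoint cs (proj₁ (proj₂ (unique-++ c u))) i j a b eq)

    vertex-onto : ∀ cs {v} → Any (v ∈_) cs → ∃₂ λ i a → vertex cs i a ≡ v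
    vertex-onto (c ∷ cs) (here p)  = zero , index p , sym (lookup-index p)
    vertex-onto (c ∷ cs) (there p) with vertex-onto cs p
    ... | i , a , eq = suc i , a , eq

    vertex-next : ∀ cs {u v} → Any (λ c → Follows c u v) cs → ∃₂ λ i a → vertex cs i a ≡ u × vertex cs i (next a) ≡ v
    vertex-next (c ∷ cs) (here p) with follows-index p
    ... | a , eq , eq′ = zero , a , eq , eq′
    vertex-next (c ∷ cs) (there p) with vertex-next cs p
    ... | i , a , eqs = suc i , a , eqs

    length-concat : ∀ (cs : List (List A)) → length (concat cs) ≡ sum (map length cs)
    length-concat []       = refl
    length-concat (c ∷ cs) = trans (length-++ c) (cong (length c +_) (length-concat cs))

  toFactor : ∀ {n ns} → sum ns ≡ n → (F : LFactor (Fin n) ns) → Σ (Factor n ns) λ G → ∀ {u v} → Arc F u v → FactorArc G u v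
  toFactor {n} sum≡ F@record { cycles = cs ; shape = refl } = record
    { cyc      = λ i → record { vert = vertex cs i ; inj = vertex-injective cs unique i }
    ; disjoint = vertex-disjoint cs unique
    ; spanning = λ v → vertex-onto cs (complete F v)
    } , vertex-next cs
    where
    unique : Unique (concat cs)
    unique = complete⇒unique (concat cs) (trans (length-concat cs) sum≡) (λ v → ∈-concat⁺ (complete F v))

  fromFactor : ∀ {n ns} (G : Factor n ns) → Σ (LFactor (Fin n) ns) λ F → ∀ {u v} → FactorArc G u v → Arc F u v
  fromFactor {n} {ns} G = record
    { cycles   = tabulate (λ i → tabulate (vert (cyc G i)))
    ; shape    = trans (map-tabulate _ length) (trans (tabulate-cong (λ i → length-tabulate (vert (cyc G i)))) (tabulate-lookup ns))
    ; complete = λ v → let i , a , eq = spanning G v in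
        tabulate⁺ i (subst (_∈ tabulate (vert (cyc G i))) eq (∈-tabulate⁺ a))
    } , λ where (i , a , refl , refl) → tabulate⁺ i (follows-next (vert (cyc G i)) a)

  factor-functional : ∀ {n ns} (G : Factor n ns) {u v w} → FactorArc G u v → FactorArc G u w → v ≡ w
  factor-functional G (i , a , eu , ev) (j , b , eu′ , ew) with disjoint G i j a b (trans eu (sym eu′))
  ... | refl with inj (cyc G i) (trans eu (sym eu′))
  ...   | refl = trans (sym ev) ew

  factor-loopless : ∀ {n ns} (G : Factor n ns) → All (2 ≤_) ns → ∀ {u} → ¬ FactorArc G u u
  factor-loopless {ns = ns} G long (i , a , eu , ev) =
    next≢ (All.lookup long (∈-lookup i)) a (inj (cyc G i) (trans ev (sym eu)))

  Solvable : ℕ → List ℕ → Set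
  Solvable n ns =
    Σ ℕ λ r → Σ (Fin r → Factor n ns) λ F →
      ∀ (u v : Fin n) → u ≢ v →
        Σ (Fin r) λ j → FactorArc (F j) u v × (∀ j′ → FactorArc (F j′) u v → j′ ≡ j)

  -- A family of n - 1 factors covering all arcs covers each of them once, since every
  -- factor has just one arc out of each vertex.
  covering⇒solvable : ∀ {n ns} → sum ns ≡ suc n → (Fs : List (LFactor (Fin (suc n)) ns)) → length Fs ≡ n →
                      (∀ u v → u ≢ v → Any (λ F → Arc F u v) Fs) → Solvable (suc n) ns
  covering⇒solvable {n} {ns} sum≡ Fs len covers = length Fs , G , λ u v u≢v →
      let j , a = covered u v u≢v in j , a , λ j′ a′ → unique u v u≢v a a′
    where
    G : Fin (length Fs) → Factor (suc n) ns
    G j = proj₁ (toFactor sum≡ (lookup Fs j))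
    covered : ∀ u v → u ≢ v → ∃ λ j → FactorArc (G j) u v
    covered u v u≢v = let p = covers u v u≢v in index p , proj₂ (toFactor sum≡ (lookup Fs (index p))) (lookup-index p)
    module _ (u : Fin (suc n)) where
      other : Fin n → Fin (length Fs)
      other k = proj₁ (covered u (punchIn u k) (Fin.punchInᵢ≢i u k ∘ sym))
      other-arc : ∀ k → FactorArc (G (other k)) u (punchIn u k)
      other-arc k = proj₂ (covered u (punchIn u k) (Fin.punchInᵢ≢i u k ∘ sym))
      other-injective : ∀ {k l} → other k ≡ other l → k ≡ l
      other-injective {k} {l} eq = Fin.punchIn-injective u k l
        (factor-functional (G (other k)) (other-arc k) (subst (λ j → FactorArc (G j) u (punchIn u l)) (sym eq) (other-arc l)))
    unique : ∀ u v → u ≢ v → ∀ {j j′} → FactorArc (G j) u v → FactorArc (G j′) u v → j′ ≡ j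
    unique u v _ {j} {j′} a a′ with injective⇒surjective (sym len) (other u) (other-injective u) j | injective⇒surjective (sym len) (other u) (other-injective u) j′
    ... | k , refl | l , refl = cong (other u) (Fin.punchIn-injective u l k
      (trans (factor-functional (G (other u l)) (other-arc u l) a′) (factor-functional (G (other u k)) a (other-arc u k))))

  solvable⇒covering : ∀ {n ns} → All (2 ≤_) ns → Solvable (suc n) ns →
                      Σ (List (LFactor (Fin (suc n)) ns)) λ Fs → length Fs ≡ n × (∀ u v → u ≢ v → Any (λ F → Arc F u v) Fs)
  solvable⇒covering {n} {ns} long (r , G , decomposes) = Fs , trans (length-tabulate _) (ℕ.≤-antisym r≤n n≤r) , covers
    where
    Fs : List (LFactor (Fin (suc n)) ns)
    Fs = tabulate (λ j → proj₁ (fromFactor (G j)))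
    covers : ∀ u v → u ≢ v → Any (λ F → Arc F u v) Fs
    covers u v u≢v = let j , a , _ = decomposes u v u≢v in tabulate⁺ j (proj₂ (fromFactor (G j)) a)
    out : Fin n → Fin r
    out k = proj₁ (decomposes zero (suc k) λ ())
    n≤r : n ≤ r
    n≤r = injective⇒≤ {f = out} λ {k} {l} eq → Fin.suc-injective
      (factor-functional (G (out k)) (proj₁ (proj₂ (decomposes zero (suc k) λ ())))
        (subst (λ j → FactorArc (G j) zero (suc l)) (sym eq) (proj₁ (proj₂ (decomposes zero (suc l) λ ())))))
    successor : ∀ j → ∃ λ v → FactorArc (G j) zero v
    successor j = let i , a , eq = spanning (G j) zero in vert (cyc (G j) i) (next a) , i , a , eq , refl
    0≢successor : ∀ j → zero ≢ proj₁ (successor j)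
    0≢successor j eq = factor-loopless (G j) long (subst (FactorArc (G j) zero) (sym eq) (proj₂ (successor j)))
    r≤n : r ≤ n
    r≤n = injective⇒≤ {f = λ j → punchOut (0≢successor j)} λ {j} {k} eq →
      let v≡ = Fin.punchOut-injective (0≢successor j) (0≢successor k) eq
          _ , _ , once = decomposes zero (proj₁ (successor j)) (0≢successor j)
      in trans (once j (proj₂ (successor j))) (sym (once k (subst (FactorArc (G k) zero) (sym v≡) (proj₂ (successor k)))))

module CycleFamilies where
  open import Defs
  open Factors
  open ResidueClasses
  open Orbits
  open Exchanges
  open CosetIndices using (bezout)
  open import Data.Nat as ℕ using (ℕ; zero; suc; NonZero; _<_; s≤s)
  import Data.Nat.Properties as ℕ
  import Data.Nat.DivMod as ℕ
  open import Data.Nat.Coprimality using (Coprime; coprime⇒gcd≡1)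
  import Data.Nat.Tactic.RingSolver as ℕ-Solver
  open import Data.Integer as ℤ using (ℤ; +_; -_; _+_; _*_; _-_; _%ℕ_; _/ℕ_)
  import Data.Integer.Properties as ℤ
  open import Data.Integer.DivMod using (a≡a%ℕn+[a/ℕn]*n)
  open import Data.Integer.Tactic.RingSolver using (solve-∀)
  open import Data.Fin using (Fin; toℕ)
  open import Data.List using (List; []; _∷_; _++_; [_]; map; length; applyUpTo; replicate)
  open import Data.List.Properties using (length-applyUpTo; length-++)
  open import Data.List.Membership.Propositional using (_∈_)
  open import Data.List.Membership.Propositional.Properties using (∈-applyUpTo⁺)
  open import Data.List.Relation.Unary.Any using (Any; here; there)
  open import Data.List.Relation.Unary.Any.Properties using (++⁺ˡ; ++⁺ʳ; applyUpTo⁺)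
  open import Data.List.Relation.Unary.All as All using (All; []; _∷_)
  import Data.List.Relation.Unary.All.Properties as All
  open import Data.List.Relation.Unary.Linked using (Linked; []; [-]; _∷_)
  open import Data.Product using (Σ; ∃; ∃₂; _×_; _,_; proj₁; proj₂)
  open import Data.Sum using (_⊎_; inj₁; inj₂; [_,_]′)
  open import Relation.Binary.PropositionalEquality using (_≡_; refl; sym; trans; cong; cong₂; subst; module ≡-Reasoning)

  at-applyUpTo : ∀ {A : Set} (f : ℕ → A) {n i} → i < n → At (applyUpTo f n) i (f i)
  at-applyUpTo f {suc n} {zero}  _         = here
  at-applyUpTo f {suc n} {suc i} (s≤s i<n) = there (at-applyUpTo (λ k → f (suc k)) i<n)

  map-applyUpTo-const : ∀ {A : Set} (f : ℕ → List A) c n → (∀ i → length (f i) ≡ c) → map length (applyUpTo f n) ≡ replicate n c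
  map-applyUpTo-const f c zero    _ = refl
  map-applyUpTo-const f c (suc n) h = cong₂ _∷_ (h 0) (map-applyUpTo-const (λ i → f (suc i)) c n (λ i → h (suc i)))

  module Families (t : ℕ) .{{_ : NonZero t}} where
    open Residues t
    open Square t using (UArc)
    open Exchanges.Exchange t using (two-ham-cycles)

    DArc : Ham → Fin t → Fin t → Set
    DArc h u v = ∃ λ i → walk h i ≡ u × walk h (suc i) ≡ v

    walk-*t : ∀ h i k → walk h (i ℕ.+ k ℕ.* t) ≡ walk h i
    walk-*t h i zero    = cong (walk h) (ℕ.+-identityʳ i)
    walk-*t h i (suc k) = trans (cong (walk h) (l i k t)) (trans (period h (i ℕ.+ k ℕ.* t)) (walk-*t h i k))
      where
      l : ∀ i k t → i ℕ.+ suc k ℕ.* t ≡ t ℕ.+ (i ℕ.+ k ℕ.* t)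
      l = ℕ-Solver.solve-∀

    walk-cong : ∀ h {i j} k l → i ℕ.+ k ℕ.* t ≡ j ℕ.+ l ℕ.* t → walk h i ≡ walk h j
    walk-cong h {i} {j} k l eq = trans (sym (walk-*t h i k)) (trans (cong (walk h) eq) (walk-*t h j l))

    walk-% : ∀ h i → walk h (i ℕ.% t) ≡ walk h i
    walk-% h i = walk-cong h (i ℕ./ t) 0 (trans (sym (ℕ.m≡m%n+[m/n]*n i t)) (sym (ℕ.+-identityʳ i)))

    reverse : Ham → Ham
    reverse h = record
      { walk   = λ i → walk h (i ℕ.* τ)
      ; period = λ i → walk-cong h 0 τ (trans (l₁ t i τ) refl)
      ; onto   = λ v → let i , eq = onto h v in i ℕ.* τ , trans (back i) eq
      }
      where
      τ : ℕ
      τ = ℕ.pred t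
      l₁ : ∀ t i τ → (t ℕ.+ i) ℕ.* τ ℕ.+ 0 ≡ i ℕ.* τ ℕ.+ τ ℕ.* t
      l₁ = ℕ-Solver.solve-∀
      back : ∀ i → walk h (i ℕ.* τ ℕ.* τ) ≡ walk h i
      back i = walk-cong h i (i ℕ.* τ) (subst (λ t → i ℕ.* τ ℕ.* τ ℕ.+ i ℕ.* t ≡ i ℕ.+ i ℕ.* τ ℕ.* t) (ℕ.suc-pred t) (l₂ i τ))
        where
        l₂ : ∀ i τ → i ℕ.* τ ℕ.* τ ℕ.+ i ℕ.* suc τ ≡ i ℕ.+ i ℕ.* τ ℕ.* suc τ
        l₂ = ℕ-Solver.solve-∀

    reverse-arc : ∀ h {u v} → DArc h u v → DArc (reverse h) v u
    reverse-arc h (i , eq , eq′) = suc i ℕ.* τ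
      , trans (walk-cong h (suc i) (suc i ℕ.* τ) (on-t (λ t → suc i ℕ.* τ ℕ.* τ ℕ.+ suc i ℕ.* t ≡ suc i ℕ.+ suc i ℕ.* τ ℕ.* t) (l₁ i τ))) eq′
      , trans (walk-cong h (suc i) (suc i ℕ.* τ ℕ.+ 1) (on-t (λ t → suc (suc i ℕ.* τ) ℕ.* τ ℕ.+ suc i ℕ.* t ≡ i ℕ.+ (suc i ℕ.* τ ℕ.+ 1) ℕ.* t) (l₂ i τ))) eq
      where
      τ : ℕ
      τ = ℕ.pred t
      on-t : (P : ℕ → Set) → P (suc τ) → P t
      on-t P = subst P (ℕ.suc-pred t)
      l₁ : ∀ i τ → suc i ℕ.* τ ℕ.* τ ℕ.+ suc i ℕ.* suc τ ≡ suc i ℕ.+ suc i ℕ.* τ ℕ.* suc τ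
      l₁ = ℕ-Solver.solve-∀
      l₂ : ∀ i τ → suc (suc i ℕ.* τ) ℕ.* τ ℕ.+ suc i ℕ.* suc τ ≡ i ℕ.+ (suc i ℕ.* τ ℕ.+ 1) ℕ.* suc τ
      l₂ = ℕ-Solver.solve-∀

    cycle : Ham → LFactor (Fin t) [ t ]
    cycle h = record
      { cycles   = [ applyUpTo (walk h) t ]
      ; shape    = cong [_] (length-applyUpTo (walk h) t)
      ; complete = λ v → let i , eq = onto h v in
          here (subst (_∈ applyUpTo (walk h) t) (trans (walk-% h i) eq) (∈-applyUpTo⁺ (walk h) (ℕ.m%n<n i t)))
      }

    cycle-arc : ∀ h {u v} → DArc h u v → Arc (cycle h) u v
    cycle-arc h (i , refl , refl) = here (subst (λ x → Follows (applyUpTo (walk h) t) x (walk h (suc i))) (walk-% h i)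
        ([ inside , outside ]′ (ℕ.m≤n⇒m<n∨m≡n (ℕ.m%n<n i t))))
      where
      c = applyUpTo (walk h) t
      r = i ℕ.% t
      next-walk : walk h (suc r) ≡ walk h (suc i)
      next-walk = walk-cong h (i ℕ./ t) 0 (trans (cong suc (sym (ℕ.m≡m%n+[m/n]*n i t))) (sym (ℕ.+-identityʳ (suc i))))
      inside : suc r < t → Follows c (walk h r) (walk h (suc i))
      inside lt = step (at-applyUpTo (walk h) (ℕ.m%n<n i t)) (subst (At c (suc r)) next-walk (at-applyUpTo (walk h) lt))
      outside : suc r ≡ t → Follows c (walk h r) (walk h (suc i))
      outside eq = wrap (at-applyUpTo (walk h) (ℕ.m%n<n i t)) (trans eq (sym (length-applyUpTo (walk h) t)))
        (subst (At c 0) (trans (walk-cong h 1 0 (trans (ℕ.+-identityʳ t) (trans (sym eq) (sym (ℕ.+-identityʳ (suc r)))))) next-walk)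
          (at-applyUpTo (walk h) (ℕ.>-nonZero⁻¹ t)))

    Covers : ∀ {ys} → List (LFactor (Fin t) ys) → ℤ → Set
    Covers Fs z = ∀ v → Any (λ F → Arc F v (v ⊕ z)) Fs

    record Family (ys : List ℕ) (zs : List ℤ) : Set where
      field
        members : List (LFactor (Fin t) ys)
        size    : length members ≡ length zs
        covers  : All (Covers members) zs

    open Family public

    empty : ∀ {ys} → Family ys []
    empty = record { members = [] ; size = refl ; covers = [] }

    infixr 5 _⊹_
    _⊹_ : ∀ {ys zs zs′} → Family ys zs → Family ys zs′ → Family ys (zs ++ zs′)
    _⊹_ {zs = zs} A B = record
      { members = members A ++ members B
      ; size    = trans (length-++ (members A)) (trans (cong₂ ℕ._+_ (size A) (size B)) (sym (length-++ zs)))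
      ; covers  = All.++⁺ (All.map (λ c v → ++⁺ˡ (c v)) (covers A)) (All.map (λ c v → ++⁺ʳ (members A) (c v)) (covers B))
      }

    directed : ∀ h z → (∀ v → DArc h v (v ⊕ z)) → Family [ t ] [ z ]
    directed h z arc = record { members = [ cycle h ] ; size = refl ; covers = (λ v → here (cycle-arc h (arc v))) ∷ [] }

    Split : List ℕ → Set
    Split ys = ∀ h → ∃₂ λ (F G : LFactor (Fin t) ys) → ∀ {u v} → UArc h u v → Arc F u v ⊎ Arc G u v

    split-cycle : Split [ t ]
    split-cycle h = cycle h , cycle (reverse h) , λ where
      (i , inj₁ (eq , eq′)) → inj₁ (cycle-arc h (i , eq , eq′))
      (i , inj₂ (eq , eq′)) → inj₂ (cycle-arc (reverse h) (reverse-arc h (i , eq , eq′)))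

    module _ (m : ℕ) (t≡2m : t ≡ m ℕ.+ m) where

      private
        instance
          m≢0 : NonZero m
          m≢0 = ℕ.≢-nonZero λ m≡0 → ℕ.≢-nonZero⁻¹ t (trans t≡2m (cong (λ k → k ℕ.+ k) m≡0))

        rung : Ham → ℕ → ℕ → List (Fin t)
        rung h o i = walk h (o ℕ.+ (i ℕ.+ i)) ∷ walk h (suc (o ℕ.+ (i ℕ.+ i))) ∷ []

        rung-% : ∀ h o i j → walk h (j ℕ.+ (o ℕ.+ (i ℕ.% m ℕ.+ i ℕ.% m))) ≡ walk h (j ℕ.+ (o ℕ.+ (i ℕ.+ i)))
        rung-% h o i j = walk-cong h (i ℕ./ m) 0 (begin
            j ℕ.+ (o ℕ.+ (i ℕ.% m ℕ.+ i ℕ.% m)) ℕ.+ i ℕ./ m ℕ.* t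
              ≡⟨ cong (λ t → j ℕ.+ (o ℕ.+ (i ℕ.% m ℕ.+ i ℕ.% m)) ℕ.+ i ℕ./ m ℕ.* t) t≡2m ⟩
            j ℕ.+ (o ℕ.+ (i ℕ.% m ℕ.+ i ℕ.% m)) ℕ.+ i ℕ./ m ℕ.* (m ℕ.+ m)
              ≡⟨ l j o (i ℕ.% m) (i ℕ./ m) m ⟩
            j ℕ.+ (o ℕ.+ (i ℕ.% m ℕ.+ i ℕ./ m ℕ.* m ℕ.+ (i ℕ.% m ℕ.+ i ℕ./ m ℕ.* m))) ℕ.+ 0
              ≡⟨ cong (λ i → j ℕ.+ (o ℕ.+ (i ℕ.+ i)) ℕ.+ 0) (ℕ.m≡m%n+[m/n]*n i m) ⟨
            j ℕ.+ (o ℕ.+ (i ℕ.+ i)) ℕ.+ 0 ∎)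
          where
          open ≡-Reasoning
          l : ∀ j o r q m → j ℕ.+ (o ℕ.+ (r ℕ.+ r)) ℕ.+ q ℕ.* (m ℕ.+ m) ≡ j ℕ.+ (o ℕ.+ (r ℕ.+ q ℕ.* m ℕ.+ (r ℕ.+ q ℕ.* m))) ℕ.+ 0
          l = ℕ-Solver.solve-∀

        rung-any : ∀ h o i {P : List (Fin t) → Set} → (∀ {u v} → u ≡ walk h (o ℕ.+ (i ℕ.+ i)) → v ≡ walk h (suc (o ℕ.+ (i ℕ.+ i))) → P (u ∷ v ∷ [])) →
                   Any P (applyUpTo (rung h o) m)
        rung-any h o i p = applyUpTo⁺ (rung h o) (p (rung-% h o i 0) (rung-% h o i 1)) (ℕ.m%n<n i m)

        position : ∀ h o i → (∃ λ k → walk h i ≡ walk h (o ℕ.+ (k ℕ.+ k))) ⊎ (∃ λ k → walk h i ≡ walk h (suc (o ℕ.+ (k ℕ.+ k))))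
        position h o i with parity (i ℕ.+ o ℕ.* ℕ.pred t) | l o i (ℕ.pred t)
          where
          l : ∀ o i τ → i ℕ.+ o ℕ.* suc τ ≡ o ℕ.+ (i ℕ.+ o ℕ.* τ) ℕ.+ 0
          l = ℕ-Solver.solve-∀
        ... | p | eq with i ℕ.+ o ℕ.* ℕ.pred t | subst (λ t → i ℕ.+ o ℕ.* t ≡ o ℕ.+ (i ℕ.+ o ℕ.* ℕ.pred t) ℕ.+ 0) (ℕ.suc-pred t) eq
        position h o i | even k | _ | _ | eq′ = inj₁ (k , walk-cong h o 0 eq′)
        position h o i | odd k  | _ | _ | eq′ = inj₂ (k , walk-cong h o 0 (trans eq′ (cong (ℕ._+ 0) (ℕ.+-suc o (k ℕ.+ k)))))

      matching : Ham → ℕ → LFactor (Fin t) (replicate m 2)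
      matching h o = record
        { cycles   = applyUpTo (rung h o) m
        ; shape    = map-applyUpTo-const (rung h o) 2 m (λ _ → refl)
        ; complete = λ v → member v (onto h v)
        }
        where
        member : ∀ v → (∃ λ i → walk h i ≡ v) → Any (v ∈_) (applyUpTo (rung h o) m)
        member v (i , eq) with position h o i
        ... | inj₁ (k , eq′) = rung-any h o k (λ u≡ _ → here (trans (sym eq) (trans eq′ (sym u≡))))
        ... | inj₂ (k , eq′) = rung-any h o k (λ _ v≡ → there (here (trans (sym eq) (trans eq′ (sym v≡)))))

      split-matching : Split (replicate m 2)
      split-matching h = matching h 0 , matching h 1 , arc
        where
        digon : ∀ {u v x y : Fin t} → (u ≡ x × v ≡ y) ⊎ (u ≡ y × v ≡ x) → Follows (x ∷ y ∷ []) u v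
        digon (inj₁ (refl , refl)) = step here (there here)
        digon (inj₂ (refl , refl)) = wrap (there here) refl here

        arc : ∀ {u v} → UArc h u v → Arc (matching h 0) u v ⊎ Arc (matching h 1) u v
        arc {u} {v} (i , ends) with parity i
        ... | even k = inj₁ (rung-any h 0 k (λ x≡ y≡ → digon (orient x≡ y≡ ends)))
          where
          orient : ∀ {x y} → x ≡ walk h (k ℕ.+ k) → y ≡ walk h (suc (k ℕ.+ k)) → _ → (u ≡ x × v ≡ y) ⊎ (u ≡ y × v ≡ x)
          orient x≡ y≡ (inj₁ (p , q)) = inj₁ (trans (sym p) (sym x≡) , trans (sym q) (sym y≡))
          orient x≡ y≡ (inj₂ (p , q)) = inj₂ (trans (sym q) (sym y≡) , trans (sym p) (sym x≡))
        ... | odd k = inj₂ (rung-any h 1 k (λ x≡ y≡ → digon (orient x≡ y≡ ends)))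
          where
          orient : ∀ {x y} → x ≡ walk h (suc (k ℕ.+ k)) → y ≡ walk h (suc (suc (k ℕ.+ k))) → _ → (u ≡ x × v ≡ y) ⊎ (u ≡ y × v ≡ x)
          orient x≡ y≡ (inj₁ (p , q)) = inj₁ (trans (sym p) (sym x≡) , trans (sym q) (sym y≡))
          orient x≡ y≡ (inj₂ (p , q)) = inj₂ (trans (sym q) (sym y≡) , trans (sym p) (sym x≡))

    flip-uarc : ∀ {h u v} → UArc h u v → UArc h v u
    flip-uarc (i , inj₁ p) = i , inj₂ p
    flip-uarc (i , inj₂ p) = i , inj₁ p

    signed : List ℕ → List ℤ
    signed []       = []
    signed (d ∷ ds) = + d ∷ - + d ∷ signed ds

    module _ {ys : List ℕ} (split : Split ys) where

      private
        both : ∀ (h : Ham) → List (LFactor (Fin t) ys)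
        both h = let F , G , _ = split h in F ∷ G ∷ []

        both-covers : ∀ h {u v} → UArc h u v → Any (λ F → Arc F u v) (both h)
        both-covers h a = [ here , (λ b → there (here b)) ]′ (proj₂ (proj₂ (split h)) a)

      backwards : ∀ {Fs : List (LFactor (Fin t) ys)} d → (∀ v → Any (λ F → Arc F (v ⊕ d) v) Fs) → Covers Fs (- d)
      backwards {Fs} d c v = subst (λ u → Any (λ F → Arc F u (v ⊕ - d)) Fs) (⊕-inverse v d) (c (v ⊕ - d))

      single : ∀ d → (Σ Ham λ h → ∀ v → UArc h v (v ⊕ + d)) → Family ys (signed [ d ])
      single d (h , arc) = record
        { members = both h
        ; size    = refl
        ; covers  = (λ v → both-covers h (arc v)) ∷ backwards (+ d) (λ v → both-covers h (flip-uarc {h} (arc v))) ∷ []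
        }

      double : ∀ d e → (∃₂ λ h₁ h₂ → ∀ v → (UArc h₁ v (v ⊕ + d) ⊎ UArc h₂ v (v ⊕ + d)) × (UArc h₁ v (v ⊕ + e) ⊎ UArc h₂ v (v ⊕ + e))) →
               Family ys (signed (d ∷ e ∷ []))
      double d e (h₁ , h₂ , arcs) = record
        { members = both h₁ ++ both h₂
        ; size    = refl
        ; covers  = (λ v → cover (proj₁ (arcs v))) ∷ backwards (+ d) (λ v → cover (flip (proj₁ (arcs v))))
                  ∷ (λ v → cover (proj₂ (arcs v))) ∷ backwards (+ e) (λ v → cover (flip (proj₂ (arcs v)))) ∷ []
        }
        where
        cover : ∀ {u v} → UArc h₁ u v ⊎ UArc h₂ u v → Any (λ F → Arc F u v) (both h₁ ++ both h₂)
        cover = [ (λ a → ++⁺ˡ (both-covers h₁ a)) , (λ a → ++⁺ʳ (both h₁) (both-covers h₂ a)) ]′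
        flip : ∀ {u v} → UArc h₁ u v ⊎ UArc h₂ u v → UArc h₁ v u ⊎ UArc h₂ v u
        flip = [ (λ a → inj₁ (flip-uarc {h₁} a)) , (λ a → inj₂ (flip-uarc {h₂} a)) ]′

      Small : ℕ → Set
      Small d = 0 < d × d ℕ.+ d < t

      even-chain : ∀ j ds → length ds ≡ j ℕ.+ j → Linked Coprime ds → All Small ds → Family ys (signed ds)
      even-chain j       []           _   _ _ = empty
      even-chain (suc j) (d ∷ [])     len _ _ with trans len (cong suc (ℕ.+-suc j j))
      ... | ()
      even-chain (suc j) (d ∷ e ∷ ds) len (d⊥e ∷ link) ((0<d , 2d<t) ∷ (0<e , 2e<t) ∷ small) =
        double d e (two-ham-cycles d e 0<d 0<e 2d<t 2e<t d⊥e)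
          ⊹ even-chain j ds (ℕ.suc-injective (ℕ.suc-injective (trans len (cong suc (ℕ.+-suc j j))))) (unlink link) small
        where
        unlink : ∀ {e ds} → Linked Coprime (e ∷ ds) → Linked Coprime ds
        unlink [-]      = []
        unlink (_ ∷ lk) = lk

    module Unit (u : ℕ) (u⊥t : Coprime u t) where

      private
        bz : ∃₂ λ x y → + 1 ≡ x * + u + y * + t
        bz = subst (λ g → ∃₂ λ x y → + g ≡ x * + u + y * + t) (coprime⇒gcd≡1 u⊥t) (bezout u t)

      ham : Ham
      ham = record
        { walk   = λ i → ⟦ + i * + u ⟧
        ; period = λ i → ⟦⟧-cong (+ u) (trans (cong (_* + u) (ℤ.pos-+ t i)) (l₁ (+ t) (+ i) (+ u)))
        ; onto   = λ v → let x , y , eq = bz ; k = + toℕ v * x in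
            k %ℕ t , trans (⟦⟧-cong (- (+ toℕ v * y + k /ℕ t * + u)) (begin
              + (k %ℕ t) * + u                                             ≡⟨ l₂ (+ (k %ℕ t)) (k /ℕ t) (+ t) (+ u) ⟩
              (+ (k %ℕ t) + k /ℕ t * + t) * + u - k /ℕ t * + t * + u       ≡⟨ cong (λ z → z * + u - k /ℕ t * + t * + u) (a≡a%ℕn+[a/ℕn]*n k t) ⟨
              k * + u - k /ℕ t * + t * + u                                 ≡⟨ l₃ (+ toℕ v) x y (+ t) (+ u) (k /ℕ t) ⟩
              + toℕ v * (x * + u + y * + t) + - (+ toℕ v * y + k /ℕ t * + u) * + t
                ≡⟨ cong (λ z → + toℕ v * z + - (+ toℕ v * y + k /ℕ t * + u) * + t) eq ⟨
              + toℕ v * + 1 + - (+ toℕ v * y + k /ℕ t * + u) * + t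
                ≡⟨ cong (_+ - (+ toℕ v * y + k /ℕ t * + u) * + t) (ℤ.*-identityʳ (+ toℕ v)) ⟩
              + toℕ v + - (+ toℕ v * y + k /ℕ t * + u) * + t               ∎)) (⟦toℕ⟧ v)
        }
        where
        open ≡-Reasoning
        l₁ : ∀ t i u → (t + i) * u ≡ i * u + u * t
        l₁ = solve-∀
        l₂ : ∀ r q t u → r * u ≡ (r + q * t) * u - q * t * u
        l₂ = solve-∀
        l₃ : ∀ v x y t u q → v * x * u - q * t * u ≡ v * (x * u + y * t) + - (v * y + q * u) * t
        l₃ = solve-∀

      arc : ∀ v → DArc ham v (v ⊕ + u)
      arc v = let i , eq = onto ham v in i , eq , trans (cong ⟦_⟧ (l (+ i) (+ u))) (trans (sym (⟦⟧-⊕ (+ i * + u) (+ u))) (cong (_⊕ + u) eq))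
        where
        l : ∀ i u → (+ 1 + i) * u ≡ i * u + u
        l = solve-∀

      uarc : Σ Ham λ h → ∀ v → UArc h v (v ⊕ + u)
      uarc = ham , λ v → let i , eq , eq′ = arc v in i , inj₁ (eq , eq′)

      forward : Family [ t ] [ + u ]
      forward = directed ham (+ u) arc

      backward : Family [ t ] [ - + u ]
      backward = directed (reverse ham) (- + u) λ v → reverse-arc ham
        (subst (DArc ham (v ⊕ - + u)) (⊕-inverse v (+ u)) (arc (v ⊕ - + u)))

    -- For odd m, walking alternately by m and 1 traverses a Hamilton cycle of the residues
    -- modulo 2m; the even residues are left by the step c and the odd ones by the other step.
    module Alternating (j : ℕ) (t≡ : t ≡ suc (j ℕ.+ j) ℕ.+ suc (j ℕ.+ j)) where

      private
        m : ℕ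
        m = suc (j ℕ.+ j)

      module _ (c : ℕ) (i₀ : ℕ) (c-odd : c ≡ suc (i₀ ℕ.+ i₀)) where

        private
          go : ℕ → ℕ → ℕ
          go k zero          = k ℕ.* suc m
          go k (suc zero)    = k ℕ.* suc m ℕ.+ c
          go k (suc (suc i)) = go (suc k) i

          go-+ : ∀ k l i → go (k ℕ.+ l) i ≡ go l i ℕ.+ k ℕ.* suc m
          go-+ k l zero          = r₁ k l m
            where
            r₁ : ∀ k l m → (k ℕ.+ l) ℕ.* suc m ≡ l ℕ.* suc m ℕ.+ k ℕ.* suc m
            r₁ = ℕ-Solver.solve-∀
          go-+ k l (suc zero)    = r₁ k l m c
            where
            r₁ : ∀ k l m c → (k ℕ.+ l) ℕ.* suc m ℕ.+ c ≡ l ℕ.* suc m ℕ.+ c ℕ.+ k ℕ.* suc m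
            r₁ = ℕ-Solver.solve-∀
          go-+ k l (suc (suc i)) = trans (cong (λ n → go n i) (sym (ℕ.+-suc k l))) (go-+ k (suc l) i)

          go-even : ∀ k l i → go k (l ℕ.+ l ℕ.+ i) ≡ go (k ℕ.+ l) i
          go-even k zero    i = cong (λ n → go n i) (sym (ℕ.+-identityʳ k))
          go-even k (suc l) i = trans (cong (λ n → go k (suc n ℕ.+ i)) (ℕ.+-suc l l)) (trans (go-even (suc k) l i) (cong (λ n → go n i) (sym (ℕ.+-suc k l))))

          go-even₀ : ∀ l → go 0 (l ℕ.+ l) ≡ l ℕ.* suc m
          go-even₀ l = trans (cong (go 0) (sym (ℕ.+-identityʳ (l ℕ.+ l)))) (go-even 0 l 0)

          go-odd₀ : ∀ l → go 0 (suc (l ℕ.+ l)) ≡ l ℕ.* suc m ℕ.+ c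
          go-odd₀ l = trans (cong (go 0) (ℕ.+-comm 1 (l ℕ.+ l))) (go-even 0 l 1)

          congᵗ : ∀ {x y} k l → x ℕ.+ k ℕ.* t ≡ y ℕ.+ l ℕ.* t → ⟦ + x ⟧ ≡ ⟦ + y ⟧
          congᵗ {x} {y} k l eq = trans (⟦⟧-cong (- + k) (r (+ x) (+ k) (+ t))) (trans (cong ⟦_⟧ (trans (sym (push x k)) (trans (cong +_ eq) (push y l)))) (sym (⟦⟧-cong (- + l) (r (+ y) (+ l) (+ t)))))
            where
            r : ∀ x k t → x ≡ x + k * t + - k * t
            r = solve-∀
            push : ∀ x k → + (x ℕ.+ k ℕ.* t) ≡ + x + + k * + t
            push x k = cong (λ z → + x + z) (ℤ.pos-* k t)

          at-even : ∀ y → ∃ λ i → ⟦ + go 0 i ⟧ ≡ ⟦ + (y ℕ.+ y) ⟧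
          at-even y = (y ℕ.+ y) ℕ.+ (y ℕ.+ y) , trans (cong (λ n → ⟦ + n ⟧) (go-even₀ (y ℕ.+ y)))
              (congᵗ 0 y (trans (r y m) (cong (λ t → y ℕ.+ y ℕ.+ y ℕ.* t) (sym t≡))))
            where
            r : ∀ y m → (y ℕ.+ y) ℕ.* suc m ℕ.+ 0 ≡ y ℕ.+ y ℕ.+ y ℕ.* (m ℕ.+ m)
            r = ℕ-Solver.solve-∀

          at-odd : ∀ y → ∃ λ i → ⟦ + go 0 i ⟧ ≡ ⟦ + suc (y ℕ.+ y) ⟧
          at-odd y = suc (e ℕ.+ e ℕ.+ (e ℕ.+ e)) , trans (cong (λ n → ⟦ + n ⟧) (go-odd₀ (e ℕ.+ e)))
              (congᵗ 0 (e ℕ.+ i₀) (trans (cong (λ c → (e ℕ.+ e) ℕ.* suc m ℕ.+ c ℕ.+ 0) c-odd) (trans (r y i₀ j) (cong (λ t → suc (y ℕ.+ y) ℕ.+ (e ℕ.+ i₀) ℕ.* t) (sym t≡)))))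
            where
            e : ℕ
            e = y ℕ.+ i₀ ℕ.* (j ℕ.+ j)
            r : ∀ y i₀ j → (y ℕ.+ i₀ ℕ.* (j ℕ.+ j) ℕ.+ (y ℕ.+ i₀ ℕ.* (j ℕ.+ j))) ℕ.* suc (suc (j ℕ.+ j)) ℕ.+ suc (i₀ ℕ.+ i₀) ℕ.+ 0
                ≡ suc (y ℕ.+ y) ℕ.+ (y ℕ.+ i₀ ℕ.* (j ℕ.+ j) ℕ.+ i₀) ℕ.* (suc (j ℕ.+ j) ℕ.+ suc (j ℕ.+ j))
            r = ℕ-Solver.solve-∀

        alternating : Ham
        alternating = record
          { walk   = λ i → ⟦ + go 0 i ⟧
          ; period = λ i → trans (cong (λ n → ⟦ + n ⟧) (trans (cong (λ t → go 0 (t ℕ.+ i)) t≡) (trans (go-even 0 m i) (trans (cong (λ n → go n i) (sym (ℕ.+-identityʳ m))) (go-+ m 0 i)))))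
                       (congᵗ 0 (suc j) (trans (r₁ (go 0 i) j) (cong (λ t → go 0 i ℕ.+ suc j ℕ.* t) (sym t≡))))
          ; onto   = λ v → let i , eq = find (toℕ v) (parity (toℕ v)) in i , trans eq (⟦toℕ⟧ v)
          }
          where
          r₁ : ∀ x j → x ℕ.+ suc (j ℕ.+ j) ℕ.* suc (suc (j ℕ.+ j)) ℕ.+ 0 ≡ x ℕ.+ suc j ℕ.* (suc (j ℕ.+ j) ℕ.+ suc (j ℕ.+ j))
          r₁ = ℕ-Solver.solve-∀
          find : ∀ n → Parity n → ∃ λ i → ⟦ + go 0 i ⟧ ≡ ⟦ + n ⟧
          find _ (even y) = at-even y
          find _ (odd y)  = at-odd y

        even-arc : ∀ y → let v = ⟦ + (y ℕ.+ y) ⟧ in DArc alternating v (v ⊕ + c)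
        even-arc y = let i , eq = at-even y ; k = y ℕ.+ y in i , eq ,
          trans (cong (λ n → ⟦ + n ⟧) (trans (go-odd₀ k) (cong (ℕ._+ c) (sym (go-even₀ k)))))
            (trans (sym (⟦⟧-⊕ (+ go 0 i) (+ c))) (cong (_⊕ + c) eq))

        odd-arc : ∀ c′ → c ℕ.+ c′ ≡ suc m → ∀ y → let v = ⟦ + suc (y ℕ.+ y) ⟧ in DArc alternating v (v ⊕ + c′)
        odd-arc c′ c+c′ y = let i , eq = at-odd y in i , eq ,
          trans (cong (λ n → ⟦ + n ⟧) (step-odd (e ℕ.+ e))) (trans (sym (⟦⟧-⊕ (+ go 0 i) (+ c′))) (cong (_⊕ + c′) eq))
          where
          e : ℕ
          e = y ℕ.+ i₀ ℕ.* (j ℕ.+ j)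
          step-odd : ∀ k → go 0 (suc (suc (k ℕ.+ k))) ≡ go 0 (suc (k ℕ.+ k)) ℕ.+ c′
          step-odd k = begin
            go 0 (suc (suc (k ℕ.+ k)))    ≡⟨ cong (λ n → go 0 (suc n)) (ℕ.+-suc k k) ⟨
            go 0 (suc k ℕ.+ suc k)        ≡⟨ go-even₀ (suc k) ⟩
            suc m ℕ.+ k ℕ.* suc m         ≡⟨ cong (ℕ._+ k ℕ.* suc m) c+c′ ⟨
            c ℕ.+ c′ ℕ.+ k ℕ.* suc m      ≡⟨ r c c′ (k ℕ.* suc m) ⟩
            k ℕ.* suc m ℕ.+ c ℕ.+ c′      ≡⟨ cong (ℕ._+ c′) (go-odd₀ k) ⟨
            go 0 (suc (k ℕ.+ k)) ℕ.+ c′   ∎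
            where
            open ≡-Reasoning
            r : ∀ c c′ x → c ℕ.+ c′ ℕ.+ x ≡ x ℕ.+ c ℕ.+ c′
            r = ℕ-Solver.solve-∀

      one-and-half : Family [ t ] (+ 1 ∷ + m ∷ [])
      one-and-half = record
        { members = cycle h₁ ∷ cycle h₂ ∷ []
        ; size    = refl
        ; covers  = (λ v → subst (λ v → Any (λ F → Arc F v (v ⊕ + 1)) Fs) (⟦toℕ⟧ v) (by-one (toℕ v) (parity (toℕ v))))
                  ∷ (λ v → subst (λ v → Any (λ F → Arc F v (v ⊕ + m)) Fs) (⟦toℕ⟧ v) (by-m (toℕ v) (parity (toℕ v)))) ∷ []
        }
        where
        h₁ h₂ : Ham
        h₁ = alternating m j refl
        h₂ = alternating 1 0 refl
        Fs : List (LFactor (Fin t) [ t ])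
        Fs = cycle h₁ ∷ cycle h₂ ∷ []
        by-one : ∀ n → Parity n → Any (λ F → Arc F ⟦ + n ⟧ (⟦ + n ⟧ ⊕ + 1)) Fs
        by-one _ (even y) = there (here (cycle-arc h₂ (even-arc 1 0 refl y)))
        by-one _ (odd y)  = here (cycle-arc h₁ (odd-arc m j refl 1 (ℕ.+-comm m 1) y))
        by-m : ∀ n → Parity n → Any (λ F → Arc F ⟦ + n ⟧ (⟦ + n ⟧ ⊕ + m)) Fs
        by-m _ (even y) = here (cycle-arc h₁ (even-arc m j refl y))
        by-m _ (odd y)  = there (here (cycle-arc h₂ (odd-arc 1 0 refl m refl y)))

module Dealing where
  open import Defs
  open Factors
  open ResidueClasses
  open Exchanges using (even; odd; parity)
  open import Data.Nat as ℕ using (ℕ; zero; suc; _+_; _*_; _≤_; _%_; s≤s; z≤n; _≟_)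
  import Data.Nat.Properties as ℕ
  import Data.Nat.DivMod as ℕ
  open import Data.Nat.ListAction using (sum)
  import Data.Nat.Tactic.RingSolver as ℕ-Solver
  open import Data.List using (List; []; _∷_; _++_; [_]; map; length; take; drop; filter)
  open import Data.List.Properties using (length-map; length-++; length-take; take++drop≡id; filter-accept; filter-reject)
  open import Data.List.Membership.Propositional using (_∈_)
  open import Data.List.Membership.Propositional.Properties using (∈-++⁻)
  open import Data.List.Relation.Unary.Any using (Any; here; there)
  open import Data.List.Relation.Unary.All as All using (All; []; _∷_)
  import Data.List.Relation.Unary.All.Properties as All
  open import Data.Product using (Σ; ∃; _×_; _,_)
  open import Data.Sum using (_⊎_; inj₁; inj₂; [_,_]′; map₁)
  open import Data.Empty using (⊥-elim)
  open import Function using (_∘_)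
  open import Relation.Nullary using (Dec)
  open import Relation.Binary.PropositionalEquality using (_≡_; _≢_; refl; sym; trans; cong; cong₂; subst; module ≡-Reasoning)

  odd? : (m : ℕ) → Dec (m % 2 ≡ 1)
  odd? m = m % 2 ≟ 1

  abstract
    oddCount : List ℕ → ℕ
    oddCount = numOdd

    oddCount≡numOdd : ∀ ms → oddCount ms ≡ numOdd ms
    oddCount≡numOdd ms = refl

    oddCount-[] : oddCount [] ≡ 0
    oddCount-[] = refl

    oddCount-even : ∀ r ms → oddCount (r + r ∷ ms) ≡ oddCount ms
    oddCount-even r ms = cong length reject
      where
      l : ∀ r → r + r ≡ r * 2
      l = ℕ-Solver.solve-∀
      is-even : (r + r) % 2 ≢ 1
      is-even p = ℕ.0≢1+n (trans (sym (trans (cong (_% 2) (l r)) (ℕ.m*n%n≡0 r 2))) p)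
      reject : filter odd? (r + r ∷ ms) ≡ filter odd? ms
      reject = filter-reject odd? {x = r + r} is-even

    oddCount-odd : ∀ r ms → oddCount (suc (r + r) ∷ ms) ≡ suc (oddCount ms)
    oddCount-odd r ms = cong length accept
      where
      l : ∀ r → suc (r + r) ≡ 1 + r * 2
      l = ℕ-Solver.solve-∀
      is-odd : suc (r + r) % 2 ≡ 1
      is-odd = trans (cong (_% 2) (l r)) (ℕ.[m+kn]%n≡m%n 1 r 2)
      accept : filter odd? (suc (r + r) ∷ ms) ≡ suc (r + r) ∷ filter odd? ms
      accept = filter-accept odd? {x = suc (r + r)} is-odd

  -- A table with at least two seats is made up of r blocks of length 2, and of one
  -- block of length 3 if its size is odd.
  data Table : ℕ → Set where
    even : ∀ r → Table (r + r)
    odd  : ∀ r → Table (suc (suc r + suc r))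

  table : ∀ {m} → 2 ≤ m → Table m
  table {m} 2≤m with parity m
  ... | even r = even r
  table (s≤s ()) | odd zero
  ... | odd (suc r) = odd r

  3oddCount≤sum : ∀ {ms} → All (2 ≤_) ms → 3 * oddCount ms ≤ sum ms
  3oddCount≤sum [] = ℕ.≤-reflexive (trans (cong (3 *_) oddCount-[]) refl)
  3oddCount≤sum {m ∷ ms} (2≤m ∷ long) with table 2≤m
  ... | even r = subst (λ k → 3 * k ≤ r + r + sum ms) (sym (oddCount-even r ms)) (ℕ.≤-trans (3oddCount≤sum long) (ℕ.m≤n+m (sum ms) (r + r)))
  ... | odd r = subst (λ k → 3 * k ≤ suc (suc r + suc r) + sum ms) (sym (oddCount-odd (suc r) ms))
      (ℕ.≤-trans (ℕ.≤-reflexive (ℕ.*-suc 3 (oddCount ms))) (ℕ.+-mono-≤ (s≤s (s≤s (subst (1 ≤_) (sym (ℕ.+-suc r r)) (s≤s z≤n)))) (3oddCount≤sum long)))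

  oddCount≡sum-mod-2 : ∀ {ms} → All (2 ≤_) ms → ∃ λ k → sum ms ≡ oddCount ms + (k + k)
  oddCount≡sum-mod-2 [] = 0 , sym (trans (ℕ.+-identityʳ _) oddCount-[])
  oddCount≡sum-mod-2 {m ∷ ms} (2≤m ∷ long) with table 2≤m | oddCount≡sum-mod-2 long
  ... | even r | k , eq = r + k , trans (cong (λ k → r + r + k) eq) (trans (l r (oddCount ms) k) (cong (_+ (r + k + (r + k))) (sym (oddCount-even r ms))))
    where
    l : ∀ r o k → r + r + (o + (k + k)) ≡ o + (r + k + (r + k))
    l = ℕ-Solver.solve-∀
  ... | odd r | k , eq = suc r + k , trans (cong (λ k → suc (suc r + suc r) + k) eq) (trans (l r (oddCount ms) k) (cong (_+ (suc r + k + (suc r + k))) (sym (oddCount-odd (suc r) ms))))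
    where
    l : ∀ r o k → suc (suc r + suc r) + (o + (k + k)) ≡ suc o + (suc r + k + (suc r + k))
    l = ℕ-Solver.solve-∀

  ∈-take-drop : ∀ {A : Set} r (xs : List A) {x} → x ∈ xs → x ∈ take r xs ⊎ x ∈ drop r xs
  ∈-take-drop r xs x∈ = ∈-++⁻ (take r xs) (subst (_ ∈_) (sym (take++drop≡id r xs)) x∈)

  module Blocks (X Y : Set) where

    -- A component of the second part, followed by a vertex of the first part.
    record Block : Set where
      constructor block
      field
        first  : Y
        others : List Y
        mark   : X

    open Block public

    verts : Block → List (X ⊎ Y)
    verts b = map inj₂ (first b ∷ others b) ++ [ inj₁ (mark b) ]

    flat : List Block → List (X ⊎ Y)
    flat []       = []
    flat (b ∷ bs) = verts b ++ flat bs

    length-verts : ∀ b → length (verts b) ≡ suc (suc (length (others b)))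
    length-verts b = cong suc (trans (length-++ (map inj₂ (others b))) (trans (cong (_+ 1) (length-map inj₂ (others b))) (ℕ.+-comm _ 1)))

    Placed : List Block → Block → Set
    Placed bs b = ∃ λ n → (∀ {i u} → At (verts b) i u → At (flat bs) (n + i) u)
                  × ((∃ λ y → At (flat bs) (n + length (verts b)) (inj₂ y)) ⊎ n + length (verts b) ≡ length (flat bs))

    placed : ∀ {bs b} → b ∈ bs → Placed bs b
    placed {b ∷ []} (here refl) = 0 , at-++ˡ , inj₂ (sym (trans (length-++ (verts b)) (ℕ.+-identityʳ _)))
    placed {b ∷ b′ ∷ bs} (here refl) = 0 , at-++ˡ , inj₁ (first b′ , at-cong (ℕ.+-identityʳ _) (at-++ʳ (verts b) here))
    placed {b₀ ∷ bs} {b} (there b∈) with placed b∈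
    ... | n , at , after = length (verts b₀) + n , (λ {i} p → at-cong (sym (ℕ.+-assoc (length (verts b₀)) n i)) (at-++ʳ (verts b₀) (at p))) , after′ after
      where
      after′ : _ → _
      after′ (inj₁ (y , p)) = inj₁ (y , at-cong (sym (ℕ.+-assoc (length (verts b₀)) n _)) (at-++ʳ (verts b₀) p))
      after′ (inj₂ eq) = inj₂ (trans (ℕ.+-assoc (length (verts b₀)) n _) (trans (cong (length (verts b₀) +_) eq) (sym (length-++ (verts b₀)))))

    at-component : ∀ b {i y} → At (first b ∷ others b) i y → At (verts b) i (inj₂ y)
    at-component b p = at-++ˡ (at-map inj₂ p)

    at-mark : ∀ b → At (verts b) (suc (length (others b))) (inj₁ (mark b))
    at-mark b = subst (λ k → At (verts b) k (inj₁ (mark b))) (trans (ℕ.+-identityʳ _) (length-map inj₂ (first b ∷ others b))) (at-++ʳ (map inj₂ (first b ∷ others b)) here)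

    at-last : ∀ y (ys : List Y) → ∃ λ z → At (y ∷ ys) (length ys) z
    at-last y []       = y , here
    at-last y (z ∷ ys) = let w , p = at-last z ys in w , there p

    follows-inner : ∀ {bs b i u v} → b ∈ bs → At (first b ∷ others b) i u → At (first b ∷ others b) (suc i) v → Follows (flat bs) (inj₂ u) (inj₂ v)
    follows-inner {bs} {b} {i} b∈ p q with placed b∈
    ... | n , at , _ = step (at (at-component b p)) (at-cong (ℕ.+-suc n i) (at (at-component b q)))

    follows-in : ∀ {bs b} → b ∈ bs → ∃ λ y → Follows (flat bs) (inj₂ y) (inj₁ (mark b))
    follows-in {bs} {b} b∈ with placed b∈ | at-last (first b) (others b)
    ... | n , at , _ | y , p = y , step (at (at-component b p)) (at-cong (ℕ.+-suc n _) (at (at-mark b)))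

    follows-out : ∀ {bs b} → b ∈ bs → ∃ λ y → Follows (flat bs) (inj₁ (mark b)) (inj₂ y)
    follows-out {bs} {b} b∈ with placed b∈ | at-first b∈
      where
      at-first : ∀ {bs} → b ∈ bs → ∃ λ y → At (flat bs) 0 (inj₂ y)
      at-first {b ∷ _} _ = first b , here
    ... | n , at , inj₁ (y , p) | _ = y , step (at (at-mark b)) (at-cong (trans (cong (n +_) (length-verts b)) (ℕ.+-suc n _)) p)
    ... | n , at , inj₂ eq | y , p = y , wrap (at (at-mark b)) (trans (sym (ℕ.+-suc n _)) (trans (cong (n +_) (sym (length-verts b))) eq)) p

    size : List Block → ℕ
    size bs = length (flat bs)

    size-++ : ∀ as bs → size (as ++ bs) ≡ size as + size bs
    size-++ []       bs = refl
    size-++ (a ∷ as) bs = trans (length-++ (verts a)) (trans (cong (length (verts a) +_) (size-++ as bs))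
      (trans (sym (ℕ.+-assoc (length (verts a)) (size as) (size bs))) (cong (_+ size bs) (sym (length-++ (verts a))))))

    Single Pair : Block → Set
    Single b = length (others b) ≡ 0
    Pair b   = length (others b) ≡ 1

    size-singles : ∀ {bs} → All Single bs → size bs ≡ length bs + length bs
    size-singles [] = refl
    size-singles {b ∷ bs} (s ∷ ss) = trans (length-++ (verts b)) (trans (cong₂ _+_ (trans (length-verts b) (cong (λ k → suc (suc k)) s)) (size-singles ss)) (cong suc (sym (ℕ.+-suc (length bs) (length bs)))))

    record Dealt (ms : List ℕ) (Q S : List Block) : Set where
      field
        tables  : List (List Block)
        shape   : map size tables ≡ ms
        pairs   : List Block
        singles : List Block
        kept    : ∀ {b} → b ∈ Q ⊎ b ∈ S → Any (b ∈_) tables ⊎ (b ∈ pairs ⊎ b ∈ singles)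
        #pairs  : oddCount ms + length pairs ≡ length Q
        is-single : All Single singles
        sizes   : sum ms + (size pairs + size singles) ≡ size Q + size S

    private
      halve : ∀ {m n} → m + m ≤ n + n → m ≤ n
      halve {m} {n} le with ℕ.≤-total m n
      ... | inj₁ m≤n = m≤n
      ... | inj₂ n≤m with ℕ.m≤n⇒m<n∨m≡n n≤m
      ...   | inj₁ n<m = ⊥-elim (ℕ.<⇒≱ (ℕ.+-mono-< n<m n<m) le)
      ...   | inj₂ refl = ℕ.≤-refl

      enough-now : ∀ r Σ o k → r + r + Σ ≤ k + k + 3 * o → 3 * o ≤ Σ → r ≤ k
      enough-now r Σ o k le le′ = halve (ℕ.+-cancelʳ-≤ (3 * o) (r + r) (k + k) (ℕ.≤-trans (ℕ.+-monoʳ-≤ (r + r) le′) le))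

      enough-later : ∀ r Σ o k k′ → k ≡ r + k′ → r + r + Σ ≤ k + k + 3 * o → Σ ≤ k′ + k′ + 3 * o
      enough-later r Σ o _ k′ refl le = ℕ.+-cancelˡ-≤ (r + r) Σ _ (ℕ.≤-trans le (ℕ.≤-reflexive (l r k′ (3 * o))))
        where
        l : ∀ r k x → r + k + (r + k) + x ≡ r + r + (k + k + x)
        l = ℕ-Solver.solve-∀

      length-take-drop : ∀ {A : Set} r (xs : List A) → r ≤ length xs → length xs ≡ r + length (drop r xs)
      length-take-drop r xs le = trans (cong length (sym (take++drop≡id r xs))) (trans (length-++ (take r xs)) (cong (_+ length (drop r xs)) (trans (length-take r xs) (ℕ.m≤n⇒m⊓n≡m le))))

      size-take : ∀ r {S} → All Single S → r ≤ length S → size (take r S) ≡ r + r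
      size-take r {S} single le = trans (size-singles (All.take⁺ r single)) (cong₂ _+_ eq eq)
        where
        eq : length (take r S) ≡ r
        eq = trans (length-take r S) (ℕ.m≤n⇒m⊓n≡m le)

      size-take-drop : ∀ r S → size S ≡ size (take r S) + size (drop r S)
      size-take-drop r S = trans (cong size (sym (take++drop≡id r S))) (size-++ (take r S) (drop r S))

    Dealing : List ℕ → Set
    Dealing ms = ∀ Q S → All Pair Q → All Single S → oddCount ms ≤ length Q →
                 sum ms ≤ length S + length S + 3 * oddCount ms → Dealt ms Q S

    keep : ∀ {ms Q} r S (D : Dealt ms Q (drop r S)) T → (∀ {b} → b ∈ take r S → b ∈ T) →
           ∀ {b} → b ∈ Q ⊎ b ∈ S → Any (b ∈_) (T ∷ Dealt.tables D) ⊎ (b ∈ Dealt.pairs D ⊎ b ∈ Dealt.singles D)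
    keep {Q = Q} r S D T into = [ later ∘ inj₁ , [ inj₁ ∘ here ∘ into , later ∘ inj₂ ]′ ∘ ∈-take-drop r S ]′
      where
      later : ∀ {b} → b ∈ Q ⊎ b ∈ drop r S → Any (b ∈_) (T ∷ Dealt.tables D) ⊎ (b ∈ Dealt.pairs D ⊎ b ∈ Dealt.singles D)
      later h = map₁ there (Dealt.kept D h)

    deal-even : ∀ r {ms} → All (2 ≤_) ms → Dealing ms → Dealing (r + r ∷ ms)
    deal-even r {ms} long rec Q S pair single leQ leS = record
      { tables    = take r S ∷ D.tables
      ; shape     = cong₂ _∷_ (size-take r single r≤S) D.shape
      ; pairs     = D.pairs
      ; singles   = D.singles
      ; kept      = keep r S D (take r S) (λ b∈ → b∈)
      ; #pairs    = trans (cong (_+ length D.pairs) (oddCount-even r ms)) D.#pairs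
      ; is-single = D.is-single
      ; sizes     = begin
          r + r + sum ms + (size D.pairs + size D.singles)     ≡⟨ ℕ.+-assoc (r + r) (sum ms) _ ⟩
          r + r + (sum ms + (size D.pairs + size D.singles))   ≡⟨ cong (λ k → r + r + k) D.sizes ⟩
          r + r + (size Q + size (drop r S))                   ≡⟨ l (r + r) (size Q) (size (drop r S)) ⟩
          size Q + (r + r + size (drop r S))                   ≡⟨ cong (λ k → size Q + (k + size (drop r S))) (size-take r single r≤S) ⟨
          size Q + (size (take r S) + size (drop r S))         ≡⟨ cong (size Q +_) (size-take-drop r S) ⟨
          size Q + size S                                      ∎
      }
      where
      open ≡-Reasoning
      l : ∀ a b c → a + (b + c) ≡ b + (a + c)
      l = ℕ-Solver.solve-∀
      le : r + r + sum ms ≤ length S + length S + 3 * oddCount ms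
      le = subst (λ k → r + r + sum ms ≤ length S + length S + 3 * k) (oddCount-even r ms) leS
      r≤S : r ≤ length S
      r≤S = enough-now r (sum ms) (oddCount ms) (length S) le (3oddCount≤sum long)
      D : Dealt ms Q (drop r S)
      D = rec Q (drop r S) pair (All.drop⁺ r single) (subst (_≤ length Q) (oddCount-even r ms) leQ)
            (enough-later r (sum ms) (oddCount ms) (length S) (length (drop r S)) (length-take-drop r S r≤S) le)
      module D = Dealt D

    deal-odd : ∀ r {ms} → All (2 ≤_) ms → Dealing ms → Dealing (suc (suc r + suc r) ∷ ms)
    deal-odd r {ms} long rec [] S pair single leQ leS with subst (_≤ 0) (oddCount-odd (suc r) ms) leQ
    ... | ()
    deal-odd r {ms} long rec (q ∷ Q) S (pr ∷ pair) single leQ leS = record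
      { tables    = (q ∷ take r S) ∷ D.tables
      ; shape     = cong₂ _∷_ (trans (trans (length-++ (verts q)) (cong₂ _+_ size-q (size-take r single r≤S))) (cong (λ k → suc (suc k)) (sym (ℕ.+-suc r r)))) D.shape
      ; pairs     = D.pairs
      ; singles   = D.singles
      ; kept      = kept′
      ; #pairs    = trans (cong (_+ length D.pairs) (oddCount-odd (suc r) ms)) (cong suc D.#pairs)
      ; is-single = D.is-single
      ; sizes     = begin
          suc (suc r + suc r) + sum ms + (size D.pairs + size D.singles)  ≡⟨ l₁ r (sum ms) (size D.pairs + size D.singles) ⟩
          3 + (r + r) + (sum ms + (size D.pairs + size D.singles))       ≡⟨ cong (λ k → 3 + (r + r) + k) D.sizes ⟩
          3 + (r + r) + (size Q + size (drop r S))                       ≡⟨ l₂ (r + r) (size Q) (size (drop r S)) ⟩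
          3 + size Q + (r + r + size (drop r S))                         ≡⟨ cong₂ (λ j k → j + size Q + (k + size (drop r S))) size-q (size-take r single r≤S) ⟨
          length (verts q) + size Q + (size (take r S) + size (drop r S)) ≡⟨ cong₂ _+_ (length-++ (verts q)) (size-take-drop r S) ⟨
          size (q ∷ Q) + size S                                          ∎
      }
      where
      open ≡-Reasoning
      l₁ : ∀ r a b → suc (suc r + suc r) + a + b ≡ 3 + (r + r) + (a + b)
      l₁ = ℕ-Solver.solve-∀
      l₂ : ∀ r a b → 3 + r + (a + b) ≡ 3 + a + (r + b)
      l₂ = ℕ-Solver.solve-∀
      size-q : length (verts q) ≡ 3
      size-q = trans (length-verts q) (cong (λ k → suc (suc k)) pr)
      le : r + r + sum ms ≤ length S + length S + 3 * oddCount ms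
      le = ℕ.+-cancelˡ-≤ 3 _ _ (ℕ.≤-trans (ℕ.≤-reflexive (l₃ r (sum ms))) (ℕ.≤-trans leS
             (ℕ.≤-reflexive (trans (cong (λ k → length S + length S + 3 * k) (oddCount-odd (suc r) ms)) (l₄ (length S + length S) (oddCount ms))))))
        where
        l₃ : ∀ r a → 3 + (r + r + a) ≡ suc (suc r + suc r) + a
        l₃ = ℕ-Solver.solve-∀
        l₄ : ∀ a o → a + 3 * suc o ≡ 3 + (a + 3 * o)
        l₄ = ℕ-Solver.solve-∀
      r≤S : r ≤ length S
      r≤S = enough-now r (sum ms) (oddCount ms) (length S) le (3oddCount≤sum long)
      D : Dealt ms Q (drop r S)
      D = rec Q (drop r S) pair (All.drop⁺ r single) (ℕ.≤-pred (subst (_≤ suc (length Q)) (oddCount-odd (suc r) ms) leQ))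
            (enough-later r (sum ms) (oddCount ms) (length S) (length (drop r S)) (length-take-drop r S r≤S) le)
      module D = Dealt D
      kept′ : ∀ {b} → b ∈ q ∷ Q ⊎ b ∈ S → Any (b ∈_) ((q ∷ take r S) ∷ D.tables) ⊎ (b ∈ D.pairs ⊎ b ∈ D.singles)
      kept′ (inj₁ (here eq)) = inj₁ (here (here eq))
      kept′ (inj₁ (there h)) = keep r S D (q ∷ take r S) there (inj₁ h)
      kept′ (inj₂ h)         = keep r S D (q ∷ take r S) there (inj₂ h)

    deal : ∀ {ms} → All (2 ≤_) ms → Dealing ms
    deal [] Q S pair single _ _ = record
      { tables = [] ; shape = refl ; pairs = Q ; singles = S ; kept = inj₂ ; #pairs = cong (_+ length Q) oddCount-[] ; is-single = single ; sizes = refl }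
    deal (2≤m ∷ long) with table 2≤m
    ... | even r = deal-even r long (deal long)
    ... | odd r  = deal-odd r long (deal long)

module Assembly where
  open import Defs
  open Factors
  open ResidueClasses
  open CycleFamilies
  open Dealing
  open import Data.Nat as ℕ using (ℕ; zero; suc; NonZero; _+_; _<_; s≤s)
  import Data.Nat.Properties as ℕ
  open import Data.Nat.ListAction using (sum)
  open import Data.Nat.ListAction.Properties using (sum-++)
  import Data.Nat.Tactic.RingSolver as ℕ-Solver
  open import Data.Integer as ℤ using (ℤ)
  import Data.Integer.Properties as ℤ
  open import Data.Integer.Tactic.RingSolver using (solve-∀)
  open import Data.Fin as Fin using (Fin; toℕ)
  open import Data.Fin.Properties as Fin using (toℕ<n; join-splitAt)
  open import Data.List using (List; []; _∷_; _++_; map; length; applyUpTo; zipWith; replicate)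
  open import Data.List.Properties using (length-map; length-++; map-++; map-∘; map-cong; length-applyUpTo; length-zipWith)
  open import Data.List.Membership.Propositional using (_∈_)
  open import Data.List.Membership.Propositional.Properties using (∈-++⁺ˡ; ∈-++⁺ʳ; ∈-map⁺)
  open import Data.List.Relation.Unary.Any as Any using (Any; here; there)
  open import Data.List.Relation.Unary.Any.Properties as Any using (++⁺ˡ; ++⁺ʳ; map⁺; applyUpTo⁺)
  open import Data.List.Relation.Unary.All using (All; []; _∷_)
  open import Data.Product using (∃; ∃₂; _×_; _,_; proj₁; proj₂)
  open import Data.Sum as Sum using (_⊎_; inj₁; inj₂)
  open import Function using (_∘_)
  open import Relation.Nullary using (yes; no)
  open import Relation.Binary.PropositionalEquality using (_≡_; _≢_; refl; sym; trans; cong; cong₂; subst; subst₂; module ≡-Reasoning)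

  Component : Set
  Component = ℕ × List ℕ

  points : Component → List ℕ
  points (y , ys) = y ∷ ys

  pair : ℕ × ℕ → Component
  pair (x , y) = x , y ∷ []

  single : ℕ → Component
  single x = x , []

  total : List Component → ℕ
  total []       = 0
  total (c ∷ cs) = length (points c) + total cs

  total-++ : ∀ as bs → total (as ++ bs) ≡ total as + total bs
  total-++ []       bs = refl
  total-++ (a ∷ as) bs = trans (cong (length (points a) +_) (total-++ as bs)) (sym (ℕ.+-assoc (length (points a)) (total as) (total bs)))

  total-pairs : ∀ ps → total (map pair ps) ≡ length ps + length ps
  total-pairs []       = refl
  total-pairs (p ∷ ps) = cong suc (trans (cong suc (total-pairs ps)) (sym (ℕ.+-suc (length ps) (length ps))))

  total-singles : ∀ xs → total (map single xs) ≡ length xs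
  total-singles []       = refl
  total-singles (x ∷ xs) = cong suc (total-singles xs)

  any-zipWithˡ : ∀ {A B C : Set} {P : A → Set} {Q : C → Set} (f : A → B → C) → (∀ {a} b → P a → Q (f a b)) →
                 ∀ {as bs} → length as ≡ length bs → Any P as → Any Q (zipWith f as bs)
  any-zipWithˡ f h {_ ∷ _} {b ∷ _} eq (here p)  = here (h b p)
  any-zipWithˡ f h {_ ∷ _} {b ∷ _} eq (there p) = there (any-zipWithˡ f h (ℕ.suc-injective eq) p)

  any-zipWithʳ : ∀ {A B C : Set} {P : B → Set} {Q : C → Set} (f : A → B → C) → (∀ a {b} → P b → Q (f a b)) →
                 ∀ {as bs} → length as ≡ length bs → Any P bs → Any Q (zipWith f as bs)
  any-zipWithʳ f h {a ∷ _} {_ ∷ _} eq (here p)  = here (h a p)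
  any-zipWithʳ f h {a ∷ _} {_ ∷ _} eq (there p) = there (any-zipWithʳ f h (ℕ.suc-injective eq) p)

  glue : ∀ {X Y ms ys} → LFactor X ms → LFactor Y ys → LFactor (X ⊎ Y) (ms ++ ys)
  glue F G = record
    { cycles   = map (map inj₁) (cycles F) ++ map (map inj₂) (cycles G)
    ; shape    = trans (map-++ length (map (map inj₁) (cycles F)) (map (map inj₂) (cycles G)))
                   (cong₂ _++_ (lengths inj₁ (cycles F) (shape F)) (lengths inj₂ (cycles G) (shape G)))
    ; complete = λ where
        (inj₁ x) → ++⁺ˡ (map⁺ (Any.map (∈-map⁺ inj₁) (complete F x)))
        (inj₂ y) → ++⁺ʳ (map (map inj₁) (cycles F)) (map⁺ (Any.map (∈-map⁺ inj₂) (complete G y)))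
    }
    where
    lengths : ∀ {A B : Set} (f : A → B) cs {ns} → map length cs ≡ ns → map length (map (map f) cs) ≡ ns
    lengths f cs eq = trans (sym (map-∘ cs)) (trans (map-cong (length-map f) cs) eq)

  module Assemble (s t : ℕ) .{{_ : NonZero s}} .{{_ : NonZero t}} where
    private
      module S = Residues s
      module T = Residues t
    open CycleFamilies.Families t using (Covers)

    X Y V : Set
    X = Fin s
    Y = Fin t
    V = X ⊎ Y

    open Blocks X Y

    record Base (ns : List ℕ) (Step : ℤ → Set) : Set where
      field
        factor : LFactor V ns
        into   : ∀ x → ∃ λ y → Arc factor (inj₂ y) (inj₁ x)
        out    : ∀ x → ∃ λ y → Arc factor (inj₁ x) (inj₂ y)
        jump   : ∀ {z} → Step z → ∃ λ y → Arc factor (inj₂ y) (inj₂ (y T.⊕ z))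

    difference : ∀ (u v : Y) → u ≢ v → ∃ λ d → 0 < d × d < t × v ≡ u T.⊕ (ℤ.+ d)
    difference u v u≢v = toℕ w , 0<d , toℕ<n w , sym u+w
      where
      w : Y
      w = T.⟦ ℤ.+ toℕ v ℤ.- ℤ.+ toℕ u ⟧
      u+w : u T.⊕ (ℤ.+ toℕ w) ≡ v
      u+w = begin
        u T.⊕ (ℤ.+ toℕ w)                                   ≡⟨ cong (T._⊕ (ℤ.+ toℕ w)) (T.⟦toℕ⟧ u) ⟨
        T.⟦ ℤ.+ toℕ u ⟧ T.⊕ (ℤ.+ toℕ w)                     ≡⟨ T.⟦⟧-⊕ (ℤ.+ toℕ u) (ℤ.+ toℕ w) ⟩
        T.⟦ ℤ.+ toℕ u ℤ.+ ℤ.+ toℕ w ⟧                       ≡⟨ cong T.⟦_⟧ (ℤ.+-comm (ℤ.+ toℕ u) (ℤ.+ toℕ w)) ⟩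
        T.⟦ ℤ.+ toℕ w ℤ.+ ℤ.+ toℕ u ⟧                       ≡⟨ T.⟦⟧-⊕ (ℤ.+ toℕ w) (ℤ.+ toℕ u) ⟨
        T.⟦ ℤ.+ toℕ w ⟧ T.⊕ (ℤ.+ toℕ u)                     ≡⟨ cong (T._⊕ (ℤ.+ toℕ u)) (T.⟦toℕ⟧ w) ⟩
        w T.⊕ (ℤ.+ toℕ u)                                   ≡⟨ T.⟦⟧-⊕ (ℤ.+ toℕ v ℤ.- ℤ.+ toℕ u) (ℤ.+ toℕ u) ⟩
        T.⟦ ℤ.+ toℕ v ℤ.- ℤ.+ toℕ u ℤ.+ ℤ.+ toℕ u ⟧         ≡⟨ cong T.⟦_⟧ (l (ℤ.+ toℕ v) (ℤ.+ toℕ u)) ⟩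
        T.⟦ ℤ.+ toℕ v ⟧                                     ≡⟨ T.⟦toℕ⟧ v ⟩
        v                                                   ∎
        where
        open ≡-Reasoning
        l : ∀ v u → v ℤ.- u ℤ.+ u ≡ v
        l = solve-∀
      0<d : 0 < toℕ w
      0<d = ℕ.n≢0⇒n>0 λ w≡0 → u≢v (trans (sym (T.⊕-identityʳ u)) (trans (cong (λ d → u T.⊕ (ℤ.+ d)) (sym w≡0)) u+w))

    shift : ∀ (u v : Y) → ∃ λ (j : Fin t) → u T.⊕ (ℤ.+ toℕ j) ≡ v
    shift u v with u Fin.≟ v
    ... | yes refl = T.⟦ ℤ.+ 0 ⟧ , trans (cong (λ d → u T.⊕ (ℤ.+ d)) toℕ-0) (T.⊕-identityʳ u)
      where
      toℕ-0 : toℕ T.⟦ ℤ.+ 0 ⟧ ≡ 0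
      toℕ-0 = T.⟦⟧-injective-< (toℕ<n T.⟦ ℤ.+ 0 ⟧) (ℕ.>-nonZero⁻¹ t) (T.⟦toℕ⟧ T.⟦ ℤ.+ 0 ⟧)
    ... | no u≢v with difference u v u≢v
    ...   | d , _ , d<t , eq = Fin.fromℕ< d<t , trans (cong (λ k → u T.⊕ (ℤ.+ k)) (Fin.toℕ-fromℕ< d<t)) (sym eq)

    rotate : ℕ → V → V
    rotate j = Sum.map₂ (T._⊕ (ℤ.+ j))

    rotate-onto : ∀ j v → ∃ λ u → rotate j u ≡ v
    rotate-onto j (inj₁ x) = inj₁ x , refl
    rotate-onto j (inj₂ y) = inj₂ (y T.⊕ (ℤ.- ℤ.+ j)) , cong inj₂ (T.⊕-inverse y (ℤ.+ j))

    join-onto : ∀ i → ∃ λ v → Fin.join s t v ≡ i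
    join-onto i = Fin.splitAt s i , join-splitAt s t i

    -- The given factors of the first part are completed by factors of the second part;
    -- the rotations of the base contain the arcs between the parts and the remaining
    -- differences.
    module _ {ms ys : List ℕ} (sum-ms : sum ms ≡ s) (sum-ys : sum ys ≡ t)
             (As : List (LFactor X ms)) (covers-X : ∀ u v → u ≢ v → Any (λ F → Arc F u v) As)
             (Bs : List (LFactor Y ys)) (As≡s : suc (length As) ≡ s) (As≡Bs : length As ≡ length Bs)
             {Step : ℤ → Set} (base : Base (ms ++ ys) Step)
             (differences : ∀ d → 0 < d → d < t → Covers Bs (ℤ.+ d) ⊎ Step (ℤ.+ d)) where
      open Base base

      private
        rotations : List (LFactor V (ms ++ ys))
        rotations = applyUpTo (λ j → map-factor (rotate j) (rotate-onto j) factor) t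

        factors : List (LFactor V (ms ++ ys))
        factors = zipWith glue As Bs ++ rotations

        rotated : ∀ (j : Fin t) {u v} → Arc factor u v → Any (λ F → Arc F (rotate (toℕ j) u) (rotate (toℕ j) v)) factors
        rotated j a = ++⁺ʳ (zipWith glue As Bs) (applyUpTo⁺ _ (map-arc (rotate (toℕ j)) (rotate-onto (toℕ j)) factor a) (toℕ<n j))

        covers : ∀ u v → u ≢ v → Any (λ F → Arc F u v) factors
        covers (inj₁ u) (inj₁ v) u≢v = ++⁺ˡ (any-zipWithˡ glue (λ G a → ++⁺ˡ (map⁺ (Any.map (follows-map inj₁) a))) {As} {Bs} As≡Bs (covers-X u v (u≢v ∘ cong inj₁)))
        covers (inj₁ u) (inj₂ v) _ = let y , a = out u ; j , eq = shift y v in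
          subst (λ w → Any (λ F → Arc F (inj₁ u) (inj₂ w)) factors) eq (rotated j a)
        covers (inj₂ u) (inj₁ v) _ = let y , a = into v ; j , eq = shift y u in
          subst (λ w → Any (λ F → Arc F (inj₂ w) (inj₁ v)) factors) eq (rotated j a)
        covers (inj₂ u) (inj₂ v) u≢v with difference u v (u≢v ∘ cong inj₂)
        ... | d , 0<d , d<t , refl with differences d 0<d d<t
        ...   | inj₁ c = ++⁺ˡ (any-zipWithʳ glue (λ F a → ++⁺ʳ (map (map inj₁) (cycles F)) (map⁺ (Any.map (follows-map inj₂) a))) {As} {Bs} As≡Bs (c u))
        ...   | inj₂ z = let y , a = jump z ; j , eq = shift y u in
          subst₂ (λ w w′ → Any (λ F → Arc F (inj₂ w) (inj₂ w′)) factors) eq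
            (trans (T.⊕-comm y (ℤ.+ d) (ℤ.+ toℕ j)) (cong (T._⊕ (ℤ.+ d)) eq)) (rotated j a)

        sum≡ : sum (ms ++ ys) ≡ s + t
        sum≡ = trans (sum-++ ms ys) (cong₂ _+_ sum-ms sum-ys)

        onto-Fin : LFactor V (ms ++ ys) → LFactor (Fin (s + t)) (ms ++ ys)
        onto-Fin = map-factor (Fin.join s t) join-onto

        covers-Fin : ∀ u v → u ≢ v → Any (λ F → Arc F u v) (map onto-Fin factors)
        covers-Fin u v u≢v = map⁺ (Any.map (λ {F} a → subst₂ (Arc (onto-Fin F)) (join-splitAt s t u) (join-splitAt s t v) (map-arc (Fin.join s t) join-onto F a))
          (covers (Fin.splitAt s u) (Fin.splitAt s v) λ eq → u≢v (trans (sym (join-splitAt s t u)) (trans (cong (Fin.join s t) eq) (join-splitAt s t v)))))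

        #factors : suc (length (map onto-Fin factors)) ≡ s + t
        #factors = begin
          suc (length (map onto-Fin factors))                             ≡⟨ cong suc (length-map onto-Fin factors) ⟩
          suc (length (zipWith glue As Bs ++ rotations))                  ≡⟨ cong suc (length-++ (zipWith glue As Bs)) ⟩
          suc (length (zipWith glue As Bs) + length rotations)            ≡⟨ cong₂ (λ i j → suc (i + j)) (length-zipWith glue As Bs) (length-applyUpTo _ t) ⟩
          suc (length As ℕ.⊓ length Bs + t)                               ≡⟨ cong (λ i → suc (length As ℕ.⊓ i + t)) (sym As≡Bs) ⟩
          suc (length As ℕ.⊓ length As + t)                               ≡⟨ cong (λ i → suc (i + t)) (ℕ.⊓-idem (length As)) ⟩
          suc (length As) + t                                             ≡⟨ cong (_+ t) As≡s ⟩
          s + t                                                           ∎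
          where open ≡-Reasoning

        solve : ∀ N → N ≡ s + t → (Fs : List (LFactor (Fin N) (ms ++ ys))) → suc (length Fs) ≡ N →
                (∀ u v → u ≢ v → Any (λ F → Arc F u v) Fs) → Solvable N (ms ++ ys)
        solve (suc n) N≡ Fs len c = covering⇒solvable (trans sum≡ (sym N≡)) Fs (ℕ.suc-injective len) c

      assemble : OPSolvable (ms ++ ys)
      assemble = subst (λ N → Solvable N (ms ++ ys)) (sym sum≡) (solve (s + t) refl (map onto-Fin factors) #factors covers-Fin)

    attach : ℕ → List Component → List Block
    attach k []              = []
    attach k ((y , ys) ∷ cs) = block T.⟦ ℤ.+ y ⟧ (map (λ x → T.⟦ ℤ.+ x ⟧) ys) S.⟦ ℤ.+ k ⟧ ∷ attach (suc k) cs

    length-attach : ∀ k cs → length (attach k cs) ≡ length cs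
    length-attach k []       = refl
    length-attach k (c ∷ cs) = cong suc (length-attach (suc k) cs)

    attach-++ : ∀ k as bs → attach k (as ++ bs) ≡ attach k as ++ attach (k + length as) bs
    attach-++ k []       bs = cong (λ k → attach k bs) (sym (ℕ.+-identityʳ k))
    attach-++ k (a ∷ as) bs = cong (_ ∷_) (trans (attach-++ (suc k) as bs) (cong (λ j → attach (suc k) as ++ attach j bs) (sym (ℕ.+-suc k (length as)))))

    size-attach : ∀ k cs → size (attach k cs) ≡ total cs + length cs
    size-attach k [] = refl
    size-attach k ((y , ys) ∷ cs) = begin
      size (attach k ((y , ys) ∷ cs))                        ≡⟨ length-++ (verts b) ⟩
      length (verts b) + size (attach (suc k) cs)            ≡⟨ cong₂ _+_ (trans (length-verts b) (cong (λ n → suc (suc n)) (length-map _ ys))) (size-attach (suc k) cs) ⟩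
      suc (suc (length ys)) + (total cs + length cs)         ≡⟨ l (length ys) (total cs) (length cs) ⟩
      suc (length ys) + total cs + suc (length cs)           ∎
      where
      open ≡-Reasoning
      b : Block
      b = block T.⟦ ℤ.+ y ⟧ (map (λ x → T.⟦ ℤ.+ x ⟧) ys) S.⟦ ℤ.+ k ⟧
      l : ∀ a b c → suc (suc a) + (b + c) ≡ suc a + b + suc c
      l = ℕ-Solver.solve-∀

    attached : ∀ k {cs c} → c ∈ cs → ∃ λ b → b ∈ attach k cs × first b ∷ others b ≡ map (λ x → T.⟦ ℤ.+ x ⟧) (points c)
    attached k (here refl) = _ , here refl , refl
    attached k (there c∈)  = let b , b∈ , eq = attached (suc k) c∈ in b , there b∈ , eq

    marked : ∀ k cs i → i < length cs → ∃ λ b → b ∈ attach k cs × mark b ≡ S.⟦ ℤ.+ (k + i) ⟧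
    marked k (c ∷ cs) zero    _         = _ , here refl , cong (λ j → S.⟦ ℤ.+ j ⟧) (sym (ℕ.+-identityʳ k))
    marked k (c ∷ cs) (suc i) (s≤s i<n) = let b , b∈ , eq = marked (suc k) cs i i<n in
      b , there b∈ , trans eq (cong (λ j → S.⟦ ℤ.+ j ⟧) (sym (ℕ.+-suc k i)))

    attach-pairs : ∀ k ps → All Pair (attach k (map pair ps))
    attach-pairs k []       = []
    attach-pairs k (p ∷ ps) = refl ∷ attach-pairs (suc k) ps

    attach-singles : ∀ k xs → All Single (attach k (map single xs))
    attach-singles k []       = []
    attach-singles k (x ∷ xs) = refl ∷ attach-singles (suc k) xs

    Jump : List ℕ → ℤ → Set
    Jump ps z = ∃ λ i → ∃₂ λ u v → At ps i u × At ps (suc i) v × T.⟦ ℤ.+ v ⟧ ≡ T.⟦ ℤ.+ u ℤ.+ z ⟧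

    module _ {ns : List ℕ} (components : List Component) (extra : List (ℕ × ℕ)) (tables : List (List Block))
             (table-shape : map size tables ++ replicate (length extra) 2 ≡ ns)
             (#components : length components ≡ s)
             (seated : ∀ {b} → b ∈ attach 0 components → Any (b ∈_) tables)
             (covered : ∀ v → v < t → Any (λ c → v ∈ points c) components ⊎ Any (λ (x , y) → v ≡ x ⊎ v ≡ y) extra) where

      private
        digon : ℕ × ℕ → List V
        digon (x , y) = inj₂ T.⟦ ℤ.+ x ⟧ ∷ inj₂ T.⟦ ℤ.+ y ⟧ ∷ []

        digons : ∀ ps → map length (map digon ps) ≡ replicate (length ps) 2
        digons []       = refl
        digons (p ∷ ps) = cong (2 ∷_) (digons ps)

        all : List (List V)
        all = map flat tables ++ map digon extra

        block∈ : ∀ {b} → b ∈ attach 0 components → ∀ {P : List V → Set} → (∀ {bs} → b ∈ bs → P (flat bs)) → Any P all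
        block∈ b∈ p = ++⁺ˡ (map⁺ (Any.map p (seated b∈)))

        vertex∈flat : ∀ {b bs v} → b ∈ bs → v ∈ verts b → v ∈ flat bs
        vertex∈flat (here refl) v∈ = ∈-++⁺ˡ v∈
        vertex∈flat {bs = b ∷ _} (there b∈) v∈ = ∈-++⁺ʳ (verts b) (vertex∈flat b∈ v∈)

        mark-of : ∀ x → ∃ λ b → b ∈ attach 0 components × mark b ≡ x
        mark-of x = let b , b∈ , eq = marked 0 components (toℕ x) (subst (toℕ x <_) (sym #components) (toℕ<n x)) in
          b , b∈ , trans eq (S.⟦toℕ⟧ x)

        complete′ : ∀ v → Any (v ∈_) all
        complete′ (inj₁ x) = let b , b∈ , eq = mark-of x in
          block∈ b∈ (λ b∈bs → vertex∈flat b∈bs (∈-++⁺ʳ (map inj₂ (first b ∷ others b)) (here (cong inj₁ (sym eq)))))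
        complete′ (inj₂ y) with covered (toℕ y) (toℕ<n y)
        ... | inj₂ e = ++⁺ʳ (map flat tables) (map⁺ (Any.map on-digon e))
          where
          on-digon : ∀ {p} → toℕ y ≡ proj₁ p ⊎ toℕ y ≡ proj₂ p → inj₂ y ∈ digon p
          on-digon (inj₁ eq) = here (cong inj₂ (trans (sym (T.⟦toℕ⟧ y)) (cong (λ k → T.⟦ ℤ.+ k ⟧) eq)))
          on-digon (inj₂ eq) = there (here (cong inj₂ (trans (sym (T.⟦toℕ⟧ y)) (cong (λ k → T.⟦ ℤ.+ k ⟧) eq))))
        ... | inj₁ c with Any.lookup c | ∈-lookup-any c | Any.lookup-result c
          where
          ∈-lookup-any : ∀ {A : Set} {P : A → Set} {xs} (p : Any P xs) → Any.lookup p ∈ xs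
          ∈-lookup-any (here _)  = here refl
          ∈-lookup-any (there p) = there (∈-lookup-any p)
        ...   | comp | comp∈ | v∈ with attached 0 comp∈
        ...     | b , b∈ , eq = block∈ b∈ (λ b∈bs → vertex∈flat b∈bs (∈-++⁺ˡ (∈-map⁺ inj₂
                    (subst (y ∈_) (sym eq) (subst (_∈ map _ (points comp)) (T.⟦toℕ⟧ y) (∈-map⁺ (λ x → T.⟦ ℤ.+ x ⟧) v∈))))))

        jump-ends : ∀ {u v z} → T.⟦ ℤ.+ v ⟧ ≡ T.⟦ ℤ.+ u ℤ.+ z ⟧ → T.⟦ ℤ.+ v ⟧ ≡ T.⟦ ℤ.+ u ⟧ T.⊕ z
        jump-ends {u} {z = z} eq = trans eq (sym (T.⟦⟧-⊕ (ℤ.+ u) z))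

      base : Base ns (λ z → (∃ λ c → c ∈ components × Jump (points c) z) ⊎ (∃₂ λ x y → (x , y) ∈ extra × (Jump (x ∷ y ∷ []) z ⊎ Jump (y ∷ x ∷ []) z)))
      base = record
        { factor = record
            { cycles   = all
            ; shape    = trans (map-++ length (map flat tables) (map digon extra)) (trans (cong₂ _++_ (sym (map-∘ tables)) (digons extra)) table-shape)
            ; complete = complete′
            }
        ; into = λ x → into′ x (mark-of x)
        ; out  = λ x → out′ x (mark-of x)
        ; jump = jump′
        }
        where
        into′ : ∀ x → (∃ λ b → b ∈ attach 0 components × mark b ≡ x) → ∃ λ y → Any (λ c → Follows c (inj₂ y) (inj₁ x)) all
        into′ x (b , b∈ , refl) = let y , a = pick (seated b∈) in y , ++⁺ˡ (map⁺ a)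
          where
          pick : ∀ {tbs} → Any (b ∈_) tbs → ∃ λ y → Any (λ bs → Follows (flat bs) (inj₂ y) (inj₁ (mark b))) tbs
          pick (here b∈bs) = let y , a = follows-in b∈bs in y , here a
          pick (there p)   = let y , a = pick p in y , there a
        out′ : ∀ x → (∃ λ b → b ∈ attach 0 components × mark b ≡ x) → ∃ λ y → Any (λ c → Follows c (inj₁ x) (inj₂ y)) all
        out′ x (b , b∈ , refl) = let y , a = pick (seated b∈) in y , ++⁺ˡ (map⁺ a)
          where
          pick : ∀ {tbs} → Any (b ∈_) tbs → ∃ λ y → Any (λ bs → Follows (flat bs) (inj₁ (mark b)) (inj₂ y)) tbs
          pick (here b∈bs) = let y , a = follows-out b∈bs in y , here a
          pick (there p)   = let y , a = pick p in y , there a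
        jump′ : ∀ {z} → _ → ∃ λ y → Any (λ c → Follows c (inj₂ y) (inj₂ (y T.⊕ z))) all
        jump′ {z} (inj₁ (c , c∈ , i , u , v , p , q , eq)) = let b , b∈ , eq′ = attached 0 c∈ in
          T.⟦ ℤ.+ u ⟧ , block∈ b∈ (λ b∈bs → subst (λ w → Follows _ (inj₂ T.⟦ ℤ.+ u ⟧) (inj₂ w)) (jump-ends eq)
            (follows-inner b∈bs (subst (λ l → At l i T.⟦ ℤ.+ u ⟧) (sym eq′) (at-map _ p)) (subst (λ l → At l (suc i) T.⟦ ℤ.+ v ⟧) (sym eq′) (at-map _ q))))
        jump′ {z} (inj₂ (x , y , e∈ , inj₁ (zero , _ , _ , here , there here , eq))) = T.⟦ ℤ.+ x ⟧ ,
          ++⁺ʳ (map flat tables) (map⁺ (Any.map (λ { refl → subst (λ w → Follows (digon (x , y)) (inj₂ T.⟦ ℤ.+ x ⟧) (inj₂ w)) (jump-ends eq) (step here (there here)) }) e∈))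
        jump′ {z} (inj₂ (x , y , e∈ , inj₂ (zero , _ , _ , here , there here , eq))) = T.⟦ ℤ.+ y ⟧ ,
          ++⁺ʳ (map flat tables) (map⁺ (Any.map (λ { refl → subst (λ w → Follows (digon (x , y)) (inj₂ T.⟦ ℤ.+ y ⟧) (inj₂ w)) (jump-ends eq) (wrap (there here) refl here) }) e∈))
        jump′ (inj₂ (x , y , e∈ , inj₁ (suc zero , _ , _ , there here , there (there ()) , _)))
        jump′ (inj₂ (x , y , e∈ , inj₁ (suc (suc _) , _ , _ , there (there ()) , _)))
        jump′ (inj₂ (x , y , e∈ , inj₂ (suc zero , _ , _ , there here , there (there ()) , _)))
        jump′ (inj₂ (x , y , e∈ , inj₂ (suc (suc _) , _ , _ , there (there ()) , _)))

module Seating where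
  open import Defs
  open Factors
  open Dealing
  open Assembly
  open import Data.Nat as ℕ using (ℕ; zero; suc; NonZero; _+_; _*_; _<_; _≤_)
  import Data.Nat.Properties as ℕ
  open import Data.Nat.ListAction using (sum)
  import Data.Nat.Tactic.RingSolver as ℕ-Solver
  open import Data.List using (List; []; _∷_; _++_; [_]; map; length; replicate)
  open import Data.List.Properties using (length-map; length-++; map-++; ++-assoc; ++-identityʳ)
  open import Data.List.Membership.Propositional using (_∈_)
  open import Data.List.Membership.Propositional.Properties using (∈-++⁺ˡ; ∈-++⁺ʳ; ∈-++⁻)
  open import Data.List.Relation.Unary.Any as Any using (Any; here)
  open import Data.List.Relation.Unary.Any.Properties as Any using (++⁺ˡ; ++⁺ʳ; map⁺)
  open import Data.List.Relation.Unary.All using (All; []; _∷_)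
  open import Data.Product using (_×_; _,_)
  open import Data.Sum using (_⊎_; inj₁; inj₂; [_,_]′)
  open import Function using (_∘_)
  open import Relation.Binary.PropositionalEquality using (_≡_; refl; sym; trans; cong; cong₂; subst; module ≡-Reasoning)

  -- Components on t points which, with s marks, can be arranged into tables of total
  -- size s, a of them odd, and one further table.
  record Layout (s t a : ℕ) : Set where
    field
      pairs   : List (ℕ × ℕ)
      singles : List ℕ
      paths   : List Component

    components : List Component
    components = map pair pairs ++ map single singles ++ paths

    field
      enough-pairs   : a ≤ length pairs
      enough-singles : s ≤ length singles + length singles + 3 * a
      count          : length components ≡ s
      weight         : total components ≡ t
      covering       : ∀ v → v < t → Any (λ c → v ∈ points c) components

  record Layout₂ (s t a : ℕ) : Set where
    field
      pairs   : List (ℕ × ℕ)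
      singles : List ℕ
      digons  : List (ℕ × ℕ)

    components : List Component
    components = map pair pairs ++ map single singles

    field
      exact-pairs    : length pairs ≡ a
      count          : length components ≡ s
      weight         : total components + (length digons + length digons) ≡ t
      covering       : ∀ v → v < t → Any (λ c → v ∈ points c) components ⊎ Any (λ (x , y) → v ≡ x ⊎ v ≡ y) digons

  replicate-++ : ∀ {A : Set} m n (x : A) → replicate m x ++ replicate n x ≡ replicate (m + n) x
  replicate-++ zero    n x = refl
  replicate-++ (suc m) n x = cong (x ∷_) (replicate-++ m n x)

  double-injective : ∀ {m n} → m + m ≡ n + n → m ≡ n
  double-injective {m} {n} eq = ℕ.*-cancelˡ-≡ m n 2 (trans (l m) (trans eq (sym (l n))))
    where
    l : ∀ m → 2 * m ≡ m + m
    l = ℕ-Solver.solve-∀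

  module Seat (s t : ℕ) .{{_ : NonZero s}} .{{_ : NonZero t}} where
    open Assembly.Assemble s t
    open Blocks X Y

    module _ {ms : List ℕ} (long : All (2 ≤_) ms) (sum-ms : sum ms ≡ s) where

      module _ (L : Layout s t (oddCount ms)) where
        open Layout L

        private
          p q : ℕ
          p = length (map pair pairs)
          q = length (map single singles)

          Q S R : List Block
          Q = attach 0 (map pair pairs)
          S = attach p (map single singles)
          R = attach (p + q) paths

          attach-split : attach 0 components ≡ Q ++ S ++ R
          attach-split = trans (attach-++ 0 (map pair pairs) (map single singles ++ paths)) (cong (Q ++_) (attach-++ p (map single singles) paths))

          dealt : Dealt ms Q S
          dealt = deal long Q S (attach-pairs 0 pairs) (attach-singles p singles)
            (subst (oddCount ms ≤_) (sym (trans (length-attach 0 (map pair pairs)) (length-map pair pairs))) enough-pairs)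
            (subst (λ k → sum ms ≤ k + k + 3 * oddCount ms) (sym (trans (length-attach p (map single singles)) (length-map single singles)))
              (subst (_≤ _) (sym sum-ms) enough-singles))
          module D = Dealt dealt

          last : List Block
          last = D.pairs ++ D.singles ++ R

          size-last : size last ≡ t
          size-last = ℕ.+-cancelˡ-≡ s _ _ (begin
            s + size last                                                  ≡⟨ cong (s +_) (trans (size-++ D.pairs (D.singles ++ R)) (cong (size D.pairs +_) (size-++ D.singles R))) ⟩
            s + (size D.pairs + (size D.singles + size R))                 ≡⟨ cong (_+ (size D.pairs + (size D.singles + size R))) sum-ms ⟨
            sum ms + (size D.pairs + (size D.singles + size R))            ≡⟨ l (sum ms) (size D.pairs) (size D.singles) (size R) ⟩
            sum ms + (size D.pairs + size D.singles) + size R              ≡⟨ cong (_+ size R) D.sizes ⟩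
            size Q + size S + size R                                       ≡⟨ ℕ.+-assoc (size Q) (size S) (size R) ⟩
            size Q + (size S + size R)                                     ≡⟨ trans (size-++ Q (S ++ R)) (cong (size Q +_) (size-++ S R)) ⟨
            size (Q ++ S ++ R)                                             ≡⟨ cong size attach-split ⟨
            size (attach 0 components)                                     ≡⟨ size-attach 0 components ⟩
            total components + length components                           ≡⟨ cong₂ _+_ weight count ⟩
            t + s                                                          ≡⟨ ℕ.+-comm t s ⟩
            s + t                                                          ∎)
            where
            open ≡-Reasoning
            l : ∀ a b c d → a + (b + (c + d)) ≡ a + (b + c) + d
            l = ℕ-Solver.solve-∀

          tables : List (List Block)
          tables = D.tables ++ [ last ]

          table-shape : map size tables ++ [] ≡ ms ++ [ t ]
          table-shape = trans (++-identityʳ (map size tables)) (trans (map-++ size D.tables [ last ]) (cong₂ (λ as n → as ++ [ n ]) D.shape size-last))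

          seated : ∀ {b} → b ∈ attach 0 components → Any (b ∈_) tables
          seated {b} b∈ = [ dealt-in ∘ inj₁ , (λ h → [ dealt-in ∘ inj₂ , (λ r → in-last (∈-++⁺ʳ D.pairs (∈-++⁺ʳ D.singles r))) ]′ (∈-++⁻ S h)) ]′
                            (∈-++⁻ Q (subst (b ∈_) attach-split b∈))
            where
            in-last : b ∈ last → Any (b ∈_) tables
            in-last h = ++⁺ʳ D.tables (here h)
            dealt-in : b ∈ Q ⊎ b ∈ S → Any (b ∈_) tables
            dealt-in h with D.kept h
            ... | inj₁ a        = ++⁺ˡ a
            ... | inj₂ (inj₁ r) = in-last (∈-++⁺ˡ r)
            ... | inj₂ (inj₂ r) = in-last (∈-++⁺ʳ D.pairs (∈-++⁺ˡ r))

        layout-base : Base (ms ++ [ t ]) _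
        layout-base = base components [] tables table-shape count seated (λ v v<t → inj₁ (covering v v<t))

      module _ (m : ℕ) (t≡2m : t ≡ m + m) (L : Layout₂ s t (oddCount ms)) where
        open Layout₂ L

        private
          p : ℕ
          p = length (map pair pairs)

          Q S : List Block
          Q = attach 0 (map pair pairs)
          S = attach p (map single singles)

          attach-split : attach 0 components ≡ Q ++ S
          attach-split = attach-++ 0 (map pair pairs) (map single singles)

          length-Q : length Q ≡ oddCount ms
          length-Q = trans (length-attach 0 (map pair pairs)) (trans (length-map pair pairs) exact-pairs)

          length-S : length S ≡ length singles
          length-S = trans (length-attach p (map single singles)) (length-map single singles)

          s≡ : s ≡ oddCount ms + length singles
          s≡ = trans (sym count) (trans (length-++ (map pair pairs)) (cong₂ _+_ (trans (length-map pair pairs) exact-pairs) (length-map single singles)))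

          dealt : Dealt ms Q S
          dealt = deal long Q S (attach-pairs 0 pairs) (attach-singles p singles) (ℕ.≤-reflexive (sym length-Q))
            (subst (λ k → sum ms ≤ k + k + 3 * oddCount ms) (sym length-S) (subst (_≤ length singles + length singles + 3 * oddCount ms) (sym (trans sum-ms s≡)) enough))
            where
            enough : oddCount ms + length singles ≤ length singles + length singles + 3 * oddCount ms
            enough = ℕ.≤-trans (ℕ.m≤m+n _ (length singles + 2 * oddCount ms)) (ℕ.≤-reflexive (l (oddCount ms) (length singles)))
              where
              l : ∀ a b → a + b + (b + 2 * a) ≡ b + b + 3 * a
              l = ℕ-Solver.solve-∀
          module D = Dealt dealt

          pairs-dealt : D.pairs ≡ []
          pairs-dealt with D.pairs | ℕ.+-cancelˡ-≡ (oddCount ms) _ 0 (trans D.#pairs (trans length-Q (sym (ℕ.+-identityʳ _))))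
          ... | [] | _ = refl

          tables : List (List Block)
          tables = D.tables ++ map [_] D.singles

          size-each : ∀ {bs} → All Single bs → map size (map [_] bs) ≡ replicate (length bs) 2
          size-each [] = refl
          size-each {b ∷ bs} (e ∷ es) = cong₂ _∷_ (size-singles {b ∷ []} (e ∷ [])) (size-each es)

          #tables : length D.singles + length digons ≡ m
          #tables = double-injective (begin
            length D.singles + length digons + (length D.singles + length digons)       ≡⟨ l₁ (length D.singles) (length digons) ⟩
            (length D.singles + length D.singles) + (length digons + length digons)     ≡⟨ cong (_+ (length digons + length digons)) left-over ⟩
            total components + (length digons + length digons)                          ≡⟨ weight ⟩
            t                                                                           ≡⟨ t≡2m ⟩
            m + m                                                                       ∎)
            where
            open ≡-Reasoning
            l₁ : ∀ a b → a + b + (a + b) ≡ (a + a) + (b + b)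
            l₁ = ℕ-Solver.solve-∀
            left-over : length D.singles + length D.singles ≡ total components
            left-over = ℕ.+-cancelˡ-≡ s _ _ (begin
              s + (length D.singles + length D.singles)       ≡⟨ cong₂ _+_ sum-ms (size-singles D.is-single) ⟨
              sum ms + size D.singles                         ≡⟨ cong (λ P → sum ms + (size P + size D.singles)) pairs-dealt ⟨
              sum ms + (size D.pairs + size D.singles)        ≡⟨ D.sizes ⟩
              size Q + size S                                 ≡⟨ size-++ Q S ⟨
              size (Q ++ S)                                   ≡⟨ cong size attach-split ⟨
              size (attach 0 components)                      ≡⟨ size-attach 0 components ⟩
              total components + length components            ≡⟨ cong (total components +_) count ⟩
              total components + s                            ≡⟨ ℕ.+-comm (total components) s ⟩
              s + total components                            ∎)

          table-shape : map size tables ++ replicate (length digons) 2 ≡ ms ++ replicate m 2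
          table-shape = begin
            map size tables ++ replicate (length digons) 2
              ≡⟨ cong (_++ replicate (length digons) 2) (trans (map-++ size D.tables (map [_] D.singles)) (cong₂ _++_ D.shape (size-each D.is-single))) ⟩
            (ms ++ replicate (length D.singles) 2) ++ replicate (length digons) 2
              ≡⟨ ++-assoc ms _ _ ⟩
            ms ++ (replicate (length D.singles) 2 ++ replicate (length digons) 2)
              ≡⟨ cong (ms ++_) (trans (replicate-++ (length D.singles) (length digons) 2) (cong (λ k → replicate k 2) #tables)) ⟩
            ms ++ replicate m 2 ∎
            where open ≡-Reasoning

          seated : ∀ {b} → b ∈ attach 0 components → Any (b ∈_) tables
          seated {b} b∈ with D.kept (∈-++⁻ Q (subst (b ∈_) attach-split b∈))
          ... | inj₁ a        = ++⁺ˡ a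
          ... | inj₂ (inj₂ r) = ++⁺ʳ D.tables (map⁺ (Any.map here r))
          ... | inj₂ (inj₁ r) with subst (b ∈_) pairs-dealt r
          ...   | ()

        layout-base₂ : Base (ms ++ replicate m 2) _
        layout-base₂ = base components digons tables table-shape count seated covering

module ZigzagPaths where
  open Factors using (At; here; there)
  open import Data.Nat as ℕ using (ℕ; zero; suc; _+_; _<_; _≤_; s≤s)
  import Data.Nat.Properties as ℕ
  import Data.Nat.Tactic.RingSolver as ℕ-Solver
  open import Data.List using (List; []; _∷_; _++_; [_]; map; length; reverse; applyUpTo)
  open import Data.List.Properties using (unfold-reverse; length-applyUpTo)
  open import Data.List.Membership.Propositional using (_∈_)
  open import Data.List.Membership.Propositional.Properties using (∈-applyUpTo⁺)
  open import Data.List.Relation.Unary.Any using (here; there)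
  open import Data.Product using (∃; ∃₂; _×_; _,_)
  open import Data.Sum as Sum using (_⊎_; inj₁; inj₂; [_,_]′)
  open import Data.Empty using (⊥-elim)
  open import Relation.Binary.PropositionalEquality using (_≡_; refl; sym; trans; cong; subst)

  data Step {A : Set} : List A → A → A → Set where
    first : ∀ {u v xs} → Step (u ∷ v ∷ xs) u v
    later : ∀ {x xs u v} → Step xs u v → Step (x ∷ xs) u v

  module _ {A : Set} where

    step-at : ∀ {xs : List A} {u v} → Step xs u v → ∃ λ i → At xs i u × At xs (suc i) v
    step-at first     = 0 , At.here , At.there At.here
    step-at (later s) = let i , p , q = step-at s in suc i , At.there p , At.there q

    step-++ˡ : ∀ {xs ys : List A} {u v} → Step xs u v → Step (xs ++ ys) u v
    step-++ˡ first     = first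
    step-++ˡ (later s) = later (step-++ˡ s)

    step-++ʳ : ∀ (xs : List A) {ys u v} → Step ys u v → Step (xs ++ ys) u v
    step-++ʳ []       s = s
    step-++ʳ (x ∷ xs) s = later (step-++ʳ xs s)

    step-last : ∀ (xs : List A) {u v} → Step ((xs ++ [ u ]) ++ [ v ]) u v
    step-last []       = first
    step-last (x ∷ xs) = later (step-last xs)

    step-reverse : ∀ {xs : List A} {u v} → Step xs u v → Step (reverse xs) v u
    step-reverse {u ∷ v ∷ xs} first = subst (λ l → Step l v u)
      (sym (trans (unfold-reverse u (v ∷ xs)) (cong (_++ [ u ]) (unfold-reverse v xs)))) (step-last (reverse xs))
    step-reverse {x ∷ xs} (later s) = subst (λ l → Step l _ _) (sym (unfold-reverse x xs)) (step-++ˡ (step-reverse s))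

  step-map : ∀ {A B : Set} (f : A → B) {xs u v} → Step xs u v → Step (map f xs) (f u) (f v)
  step-map f first     = first
  step-map f (later s) = later (step-map f s)

  -- The first k points of the zigzag through an interval of k + r points that starts in
  -- lo, beginning at the lower or at the upper end; the remaining r points again form an
  -- interval, with first point floor or floor′.
  up down : ℕ → ℕ → ℕ → List ℕ
  up zero    lo r = []
  up (suc k) lo r = lo ∷ down k (suc lo) r
  down zero    lo r = []
  down (suc k) lo r = (lo + (k + r)) ∷ up k lo r

  floor floor′ : ℕ → ℕ → ℕ
  floor zero    lo = lo
  floor (suc k) lo = floor′ k (suc lo)
  floor′ zero    lo = lo
  floor′ (suc k) lo = floor k lo

  length-up : ∀ k lo r → length (up k lo r) ≡ k
  length-down : ∀ k lo r → length (down k lo r) ≡ k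
  length-up zero    lo r = refl
  length-up (suc k) lo r = cong suc (length-down k (suc lo) r)
  length-down zero    lo r = refl
  length-down (suc k) lo r = cong suc (length-up k lo r)

  Rises Falls Moves : List ℕ → ℕ → Set
  Rises xs d = ∃ λ u → Step xs u (u + d)
  Falls xs d = ∃ λ u → Step xs (u + d) u
  Moves xs d = Rises xs d ⊎ Falls xs d

  moves-later : ∀ {x xs d} → Moves xs d → Moves (x ∷ xs) d
  moves-later = Sum.map (λ (u , s) → u , later s) (λ (u , s) → u , later s)

  up-moves : ∀ k lo r d → r < d → d < k + r → Moves (up k lo r) d
  down-moves : ∀ k lo r d → r < d → d < k + r → Moves (down k lo r) d
  up-moves zero lo r d r<d d<r = ⊥-elim (ℕ.<-asym r<d d<r)
  up-moves (suc zero) lo r d r<d d<r = ⊥-elim (ℕ.<⇒≱ r<d (ℕ.≤-pred d<r))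
  up-moves (suc k@(suc k′)) lo r d r<d (s≤s d≤) =
    [ (λ d< → moves-later (down-moves k (suc lo) r d r<d d<))
    , (λ d≡ → inj₁ (lo , subst (λ v → Step (up (suc k) lo r) lo v) (trans (sym (ℕ.+-suc lo (k′ + r))) (cong (lo +_) (sym d≡))) first)) ]′ (ℕ.m≤n⇒m<n∨m≡n d≤)
  down-moves zero lo r d r<d d<r = ⊥-elim (ℕ.<-asym r<d d<r)
  down-moves (suc zero) lo r d r<d d<r = ⊥-elim (ℕ.<⇒≱ r<d (ℕ.≤-pred d<r))
  down-moves (suc k@(suc _)) lo r d r<d (s≤s d≤) =
    [ (λ d< → moves-later (up-moves k lo r d r<d d<))
    , (λ d≡ → inj₂ (lo , subst (λ e → Step (down (suc k) lo r) (lo + e) lo) (sym d≡) first)) ]′ (ℕ.m≤n⇒m<n∨m≡n d≤)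

  up-cover : ∀ k lo r v → lo ≤ v → v < lo + (k + r) → v ∈ up k lo r ⊎ (floor k lo ≤ v × v < floor k lo + r)
  down-cover : ∀ k lo r v → lo ≤ v → v < lo + (k + r) → v ∈ down k lo r ⊎ (floor′ k lo ≤ v × v < floor′ k lo + r)
  up-cover zero    lo r v lo≤v v< = inj₂ (lo≤v , v<)
  up-cover (suc k) lo r v lo≤v v< with ℕ.m≤n⇒m<n∨m≡n lo≤v
  ... | inj₂ refl = inj₁ (here refl)
  ... | inj₁ lo<v = Sum.map₁ there (down-cover k (suc lo) r v lo<v (subst (v <_) (ℕ.+-suc lo (k + r)) v<))
  down-cover zero    lo r v lo≤v v< = inj₂ (lo≤v , v<)
  down-cover (suc k) lo r v lo≤v v< with ℕ.m≤n⇒m<n∨m≡n (ℕ.≤-pred (subst (v <_) (ℕ.+-suc lo (k + r)) v<))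
  ... | inj₂ refl = inj₁ (here refl)
  ... | inj₁ v<′ = Sum.map₁ there (up-cover k lo r v lo≤v v<′)

  range : ℕ → ℕ → List ℕ
  range lo k = applyUpTo (lo +_) k

  length-range : ∀ lo k → length (range lo k) ≡ k
  length-range lo k = length-applyUpTo (lo +_) k

  ∈-range : ∀ {lo k v} → lo ≤ v → v < lo + k → v ∈ range lo k
  ∈-range {lo} {k} lo≤v v< with ℕ.m≤n⇒∃[o]m+o≡n lo≤v
  ... | i , refl = ∈-applyUpTo⁺ (lo +_) (ℕ.+-cancelˡ-< lo i k v<)

  nest : ℕ → ℕ → List (ℕ × ℕ)
  nest w zero    = []
  nest w (suc n) = (w , w + (suc n + suc n)) ∷ nest (suc w) n

  length-nest : ∀ w n → length (nest w n) ≡ n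
  length-nest w zero    = refl
  length-nest w (suc n) = cong suc (length-nest (suc w) n)

  nest-rises : ∀ w n j → 0 < j → j ≤ n → ∃ λ u → (u , u + (j + j)) ∈ nest w n
  nest-rises w zero    j 0<j j≤0 = ⊥-elim (ℕ.<⇒≱ 0<j j≤0)
  nest-rises w (suc n) j 0<j j≤n with ℕ.m≤n⇒m<n∨m≡n j≤n
  ... | inj₂ refl      = w , here refl
  ... | inj₁ (s≤s j≤n′) = let u , u∈ = nest-rises (suc w) n j 0<j j≤n′ in u , there u∈

  nest-cover : ∀ w n v → w ≤ v → v ≤ w + (n + n) → v ≡ w + n ⊎ (∃₂ λ x y → (x , y) ∈ nest w n × (v ≡ x ⊎ v ≡ y))
  nest-cover w zero v w≤v v≤ = inj₁ (ℕ.≤-antisym v≤ (subst (_≤ v) (sym (ℕ.+-identityʳ w)) w≤v))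
  nest-cover w (suc n) v w≤v v≤ with ℕ.m≤n⇒m<n∨m≡n w≤v | ℕ.m≤n⇒m<n∨m≡n v≤
  ... | inj₂ refl | _         = inj₂ (_ , _ , here refl , inj₁ refl)
  ... | inj₁ _    | inj₂ refl = inj₂ (_ , _ , here refl , inj₂ refl)
  ... | inj₁ w<v  | inj₁ v<   with nest-cover (suc w) n v w<v (ℕ.≤-pred (ℕ.≤-trans v< (ℕ.≤-reflexive (l w n))))
    where
    l : ∀ w n → w + (suc n + suc n) ≡ suc (suc w + (n + n))
    l = ℕ-Solver.solve-∀
  ...   | inj₁ eq = inj₁ (trans eq (sym (ℕ.+-suc w n)))
  ...   | inj₂ (x , y , xy∈ , h) = inj₂ (x , y , there xy∈ , h)

  chunks : List ℕ → List (ℕ × ℕ)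
  chunks (x ∷ y ∷ xs) = (x , y) ∷ chunks xs
  chunks _            = []

  remainder : List ℕ → List ℕ
  remainder (x ∷ y ∷ xs) = remainder xs
  remainder xs           = xs

  step-chunk : ∀ {x xs u v} → Step (x ∷ xs) u v → (u , v) ∈ chunks (x ∷ xs) ⊎ (u , v) ∈ chunks xs
  step-chunk {x} {y ∷ xs} first = inj₁ (here refl)
  step-chunk {x} {y ∷ xs} (later s) = [ inj₂ , (λ h → inj₁ (there h)) ]′ (step-chunk s)

  chunk-cover : ∀ {v} xs → v ∈ xs → v ∈ remainder xs ⊎ (∃₂ λ x y → (x , y) ∈ chunks xs × (v ≡ x ⊎ v ≡ y))
  chunk-cover (x ∷ [])     v∈                  = inj₁ v∈
  chunk-cover (x ∷ y ∷ xs) (here refl)         = inj₂ (_ , _ , here refl , inj₁ refl)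
  chunk-cover (x ∷ y ∷ xs) (there (here refl)) = inj₂ (_ , _ , here refl , inj₂ refl)
  chunk-cover (x ∷ y ∷ xs) (there (there v∈)) with chunk-cover xs v∈
  ... | inj₁ h                    = inj₁ h
  ... | inj₂ (p , q , pq∈ , h) = inj₂ (p , q , there pq∈ , h)

  length-chunks : ∀ x xs → length (chunks (x ∷ xs)) + length (chunks xs) ≡ length xs
  length-chunks x []       = refl
  length-chunks x (y ∷ xs) = cong suc (trans (ℕ.+-comm (length (chunks xs)) _) (length-chunks y xs))

  length-remainders : ∀ x xs → length (remainder (x ∷ xs)) + length (remainder xs) ≡ 1
  length-remainders x []       = refl
  length-remainders x (y ∷ xs) = trans (ℕ.+-comm (length (remainder xs)) _) (length-remainders y xs)

module Scheduling where
  open import Defs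
  open Factors
  open ResidueClasses
  open Exchanges using (Parity; even; odd; parity)
  open CycleFamilies
  open import Data.Nat as ℕ using (ℕ; zero; suc; NonZero; _+_; _*_; _<_; _≤_; s≤s; z≤n)
  import Data.Nat.Properties as ℕ
  import Data.Nat.Tactic.RingSolver as ℕ-Solver
  open import Data.Nat.Divisibility as ℕ using (_∣_; ∣m+n∣m⇒∣n; ∣1⇒≡1)
  open import Data.Nat.Coprimality using (Coprime; 1-coprimeTo)
  open import Data.Integer as ℤ using (ℤ)
  import Data.Integer.Properties as ℤ
  open import Data.Integer.Tactic.RingSolver using (solve-∀)
  open import Data.Fin using (Fin; toℕ)
  open import Relation.Binary using (tri<; tri≈; tri>)
  open import Data.List using (List; []; _∷_; [_]; map; length)
  open import Data.List.Membership.Propositional using (_∈_)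
  open import Data.List.Relation.Unary.Any using (Any; here; there)
  open import Data.List.Relation.Unary.All as All using (All; []; _∷_)
  open import Data.List.Relation.Unary.Linked using (Linked; []; [-]; _∷_)
  open import Data.Product using (∃; _×_; _,_; proj₁; proj₂)
  open import Data.Sum using (_⊎_; inj₁; inj₂)
  open import Data.Empty using (⊥-elim)
  open import Relation.Binary.PropositionalEquality using (_≡_; refl; sym; trans; cong; subst; subst₂; module ≡-Reasoning)

  -- A window of consecutive points that is either empty or contains n concentric pairs,
  -- their centre, and ρ further points.
  data Window : ℕ → Set where
    void : Window 0
    full : ∀ n ρ → Window (suc (n + n + ρ))

  consecutive : ℕ → ℕ → List ℕ
  consecutive i zero    = []
  consecutive i (suc k) = i ∷ consecutive (suc i) k

  skipping : ℕ → ℕ → ℕ → List ℕ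
  skipping i zero    ρ = consecutive i (suc ρ)
  skipping i (suc n) ρ = i ∷ skipping (suc (suc i)) n ρ

  lengths : ∀ {α} → Window α → List ℕ
  lengths void       = []
  lengths (full n ρ) = skipping 1 n ρ

  length-consecutive : ∀ i k → length (consecutive i k) ≡ k
  length-consecutive i zero    = refl
  length-consecutive i (suc k) = cong suc (length-consecutive (suc i) k)

  length-skipping : ∀ i n ρ → length (skipping i n ρ) ≡ suc (n + ρ)
  length-skipping i zero    ρ = length-consecutive i (suc ρ)
  length-skipping i (suc n) ρ = cong suc (length-skipping (suc (suc i)) n ρ)

  coprime-suc : ∀ i → Coprime i (suc i)
  coprime-suc i {d} (d∣i , d∣si) = ∣1⇒≡1 (∣m+n∣m⇒∣n (subst (d ∣_) (ℕ.+-comm 1 i) d∣si) d∣i)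

  coprime-odd : ∀ j → let i = suc (j + j) in Coprime i (suc (suc i))
  coprime-odd j {d} (d∣i , d∣i+2) = ∣1⇒≡1 (∣m+n∣m⇒∣n (subst (d ∣_) (ℕ.+-comm 1 (j + j)) d∣i) (ℕ.∣-trans d∣2 2∣2j))
    where
    d∣2 : d ∣ 2
    d∣2 = ∣m+n∣m⇒∣n (subst (d ∣_) (ℕ.+-comm 2 (suc (j + j))) d∣i+2) d∣i
    2∣2j : 2 ∣ j + j
    2∣2j = ℕ.divides j (l j)
      where
      l : ∀ j → j + j ≡ j * 2
      l = ℕ-Solver.solve-∀

  linked-consecutive : ∀ i k → Linked Coprime (consecutive i k)
  linked-consecutive i zero          = []
  linked-consecutive i (suc zero)    = [-]
  linked-consecutive i (suc (suc k)) = coprime-suc i ∷ linked-consecutive (suc i) (suc k)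

  linked-skipping : ∀ j n ρ → Linked Coprime (skipping (suc (j + j)) n ρ)
  linked-skipping j zero          ρ = linked-consecutive (suc (j + j)) (suc ρ)
  linked-skipping j (suc zero)    ρ = coprime-odd j ∷ linked-consecutive (suc (suc (suc (j + j)))) (suc ρ)
  linked-skipping j (suc (suc n)) ρ = coprime-odd j ∷ subst (λ k → Linked Coprime (skipping (suc (suc k)) (suc n) ρ)) (ℕ.+-suc j j) (linked-skipping (suc j) (suc n) ρ)

  Within : ℕ → ℕ → ℕ → Set
  Within lo hi d = lo ≤ d × d < hi

  consecutive-within : ∀ {lo hi} i k → lo ≤ i → i + k ≤ hi → All (Within lo hi) (consecutive i k)
  consecutive-within i zero    _    _  = []
  consecutive-within i (suc k) lo≤i le = (lo≤i , ℕ.<-≤-trans (ℕ.m<m+n i (s≤s z≤n)) le)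
    ∷ consecutive-within (suc i) k (ℕ.m≤n⇒m≤1+n lo≤i) (ℕ.≤-trans (ℕ.≤-reflexive (sym (ℕ.+-suc i k))) le)

  skipping-within : ∀ {lo hi} i n ρ → lo ≤ i → i + (n + n) + suc ρ ≤ hi → All (Within lo hi) (skipping i n ρ)
  skipping-within i zero    ρ lo≤i le = consecutive-within i (suc ρ) lo≤i (ℕ.≤-trans (ℕ.≤-reflexive (cong (_+ suc ρ) (sym (ℕ.+-identityʳ i)))) le)
  skipping-within i (suc n) ρ lo≤i le = (lo≤i , ℕ.<-≤-trans (ℕ.<-≤-trans (ℕ.m<m+n i (s≤s z≤n)) (ℕ.m≤m+n _ (suc ρ))) le)
    ∷ skipping-within (suc (suc i)) n ρ (ℕ.m≤n⇒m≤1+n (ℕ.m≤n⇒m≤1+n lo≤i)) (ℕ.≤-trans (ℕ.≤-reflexive (l i n ρ)) le)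
    where
    l : ∀ i n ρ → suc (suc i) + (n + n) + suc ρ ≡ i + (suc n + suc n) + suc ρ
    l = ℕ-Solver.solve-∀

  lengths-within : ∀ {α} (W : Window α) → All (Within 1 (suc α)) (lengths W)
  lengths-within void       = []
  lengths-within (full n ρ) = skipping-within 1 n ρ (s≤s z≤n) (ℕ.≤-reflexive (cong suc (ℕ.+-suc (n + n) ρ)))

  ∈-consecutive : ∀ i k d → i ≤ d → d < i + k → d ∈ consecutive i k
  ∈-consecutive i zero    d i≤d d< = ⊥-elim (ℕ.<⇒≱ d< (subst (_≤ d) (sym (ℕ.+-identityʳ i)) i≤d))
  ∈-consecutive i (suc k) d i≤d d< with ℕ.m≤n⇒m<n∨m≡n i≤d
  ... | inj₂ refl = here refl
  ... | inj₁ i<d  = there (∈-consecutive (suc i) k d i<d (subst (d <_) (ℕ.+-suc i k) d<))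

  ∈-skipping : ∀ i n ρ d → i ≤ d → d < i + (n + n) + suc ρ → d ∈ skipping i n ρ ⊎ (∃ λ j → 0 < j × j ≤ n × suc d ≡ i + (j + j))
  ∈-skipping i zero    ρ d i≤d d< = inj₁ (∈-consecutive i (suc ρ) d i≤d (subst (λ k → d < k + suc ρ) (ℕ.+-identityʳ i) d<))
  ∈-skipping i (suc n) ρ d i≤d d< with ℕ.m≤n⇒m<n∨m≡n i≤d
  ... | inj₂ refl = inj₁ (here refl)
  ... | inj₁ i<d with ℕ.m≤n⇒m<n∨m≡n i<d
  ...   | inj₂ refl = inj₂ (1 , s≤s z≤n , s≤s z≤n , ℕ.+-comm 2 i)
  ...   | inj₁ i+1<d with ∈-skipping (suc (suc i)) n ρ d i+1<d (subst (d <_) (l i n ρ) d<)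
    where
    l : ∀ i n ρ → i + (suc n + suc n) + suc ρ ≡ suc (suc i) + (n + n) + suc ρ
    l = ℕ-Solver.solve-∀
  ...     | inj₁ h                    = inj₁ (there h)
  ...     | inj₂ (j , 0<j , j≤n , eq) = inj₂ (suc j , s≤s z≤n , s≤s j≤n , trans eq (l i j))
    where
    l : ∀ i j → suc (suc i) + (j + j) ≡ i + (suc j + suc j)
    l = ℕ-Solver.solve-∀

  radius : ∀ {α} → Window α → ℕ
  radius void       = 0
  radius (full n ρ) = n

  ∈-lengths : ∀ {α} (W : Window α) d → 0 < d → d ≤ α → d ∈ lengths W ⊎ (∃ λ j → 0 < j × j ≤ radius W × d ≡ j + j)
  ∈-lengths void       d 0<d d≤0 = ⊥-elim (ℕ.<⇒≱ 0<d d≤0)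
  ∈-lengths (full n ρ) d 0<d d≤α with ∈-skipping 1 n ρ d 0<d (ℕ.≤-trans (s≤s d≤α) (ℕ.≤-reflexive (cong suc (sym (ℕ.+-suc (n + n) ρ)))))
  ... | inj₁ h                    = inj₁ h
  ... | inj₂ (j , 0<j , j≤n , eq) = inj₂ (j , 0<j , j≤n , ℕ.suc-injective eq)

  module Schedule (t : ℕ) .{{_ : NonZero t}} where
    open Residues t
    open CycleFamilies.Families t public

    small : ∀ {α ds} → α + α < t → All (Within 1 (suc α)) ds → All (λ d → 0 < d × d + d < t) ds
    small {α} 2α<t = All.map (λ (1≤d , d<sα) → 1≤d , ℕ.≤-<-trans (ℕ.+-mono-≤ (ℕ.≤-pred d<sα) (ℕ.≤-pred d<sα)) 2α<t)

    module _ {ys : List ℕ} (split : Split ys) where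

      unit-family : ∀ u → Coprime u t → Family ys (signed [ u ])
      unit-family u u⊥t = single split u (Unit.uarc u u⊥t)

      chain-from-1 : ∀ ds → Linked Coprime (1 ∷ ds) → All (λ d → 0 < d × d + d < t) (1 ∷ ds) → Family ys (signed (1 ∷ ds))
      chain-from-1 ds link sm with parity (length ds)
                                 | even-chain split
      ... | p | chain = go (length ds) refl p
        where
        unlink : ∀ {e ds} → Linked Coprime (e ∷ ds) → Linked Coprime ds
        unlink [-]      = []
        unlink (_ ∷ lk) = lk
        go : ∀ k → length ds ≡ k → Parity k → Family ys (signed (1 ∷ ds))
        go _ len (even j) = unit-family 1 (1-coprimeTo t) ⊹ chain j ds len (unlink link) (All.tail sm)
        go _ len (odd j)  = chain (suc j) (1 ∷ ds) (trans (cong suc len) (cong suc (sym (ℕ.+-suc j j)))) link sm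

      lengths-family : ∀ {α} (W : Window α) → α + α < t → Family ys (signed (lengths W))
      lengths-family void                2α<t = empty
      lengths-family (full zero ρ)       2α<t = chain-from-1 (consecutive 2 ρ) (linked-consecutive 1 (suc ρ)) (small 2α<t (lengths-within (full zero ρ)))
      lengths-family (full (suc n) ρ)    2α<t = chain-from-1 (skipping 3 n ρ) (linked-skipping 0 (suc n) ρ) (small 2α<t (lengths-within (full (suc n) ρ)))

    length-signed : ∀ ds → length (signed ds) ≡ length ds + length ds
    length-signed []       = refl
    length-signed (d ∷ ds) = cong suc (trans (cong suc (length-signed ds)) (sym (ℕ.+-suc (length ds) (length ds))))

    signed-covers : ∀ {ys} {Fs : List (LFactor (Fin t) ys)} {ds} → All (Covers Fs) (signed ds) → ∀ {d} → d ∈ ds → Covers Fs (ℤ.+ d) × Covers Fs (ℤ.- ℤ.+ d)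
    signed-covers (p ∷ q ∷ _)  (here refl) = p , q
    signed-covers (_ ∷ _ ∷ ps) (there d∈)  = signed-covers ps d∈

    covers-cong : ∀ {ys} {Fs : List (LFactor (Fin t) ys)} {z z′} k → z ≡ z′ ℤ.+ k ℤ.* ℤ.+ t → Covers Fs z → Covers Fs z′
    covers-cong {Fs = Fs} {z} {z′} k eq c v = subst (λ w → Any (λ F → Arc F v w) Fs) (begin
        v ⊕ z                          ≡⟨ ⟦⟧≡ z ⟩
        ⟦ ℤ.+ toℕ v ℤ.+ z ⟧            ≡⟨ ⟦⟧-cong k (trans (cong (λ y → ℤ.+ toℕ v ℤ.+ y) eq) (sym (ℤ.+-assoc (ℤ.+ toℕ v) z′ (k ℤ.* ℤ.+ t)))) ⟩
        ⟦ ℤ.+ toℕ v ℤ.+ z′ ⟧           ≡⟨ ⟦⟧≡ z′ ⟨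
        v ⊕ z′                         ∎) (c v)
      where
      open ≡-Reasoning
      ⟦⟧≡ : ∀ z → v ⊕ z ≡ ⟦ ℤ.+ toℕ v ℤ.+ z ⟧
      ⟦⟧≡ z = trans (cong (_⊕ z) (sym (⟦toℕ⟧ v))) (⟦⟧-⊕ (ℤ.+ toℕ v) z)

    module _ (P : ℤ → Set) (P-cong : ∀ {z z′} k → z ≡ z′ ℤ.+ k ℤ.* ℤ.+ t → P z → P z′) where

      complement : ∀ {d e} → d + e ≡ t → P (ℤ.- ℤ.+ e) → P (ℤ.+ d)
      complement {d} {e} eq = P-cong (ℤ.- ℤ.+ 1) (trans (l (ℤ.+ d) (ℤ.+ e)) (cong (λ k → ℤ.+ d ℤ.+ ℤ.- ℤ.+ 1 ℤ.* ℤ.+ k) eq))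
        where
        l : ∀ d e → ℤ.- e ≡ d ℤ.+ ℤ.- ℤ.+ 1 ℤ.* (d ℤ.+ e)
        l = solve-∀

      all-differences : ∀ m → (∀ d → 0 < d → d < m → P (ℤ.+ d) × P (ℤ.- ℤ.+ d)) → P (ℤ.+ m) →
                        t ≡ m + m ⊎ (t ≡ suc (m + m) × P (ℤ.- ℤ.+ m)) → ∀ d → 0 < d → d < t → P (ℤ.+ d)
      all-differences m below at-m t≡ d 0<d d<t with ℕ.<-cmp d m
      ... | tri< d<m _ _ = proj₁ (below d 0<d d<m)
      ... | tri≈ _ refl _ = at-m
      ... | tri> _ _ m<d with ℕ.m≤n⇒∃[o]m+o≡n (ℕ.<⇒≤ d<t)
      ...   | e , d+e≡t = complement d+e≡t (lower t≡)
        where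
        0<e : 0 < e
        0<e = ℕ.+-cancelˡ-< d 0 e (subst₂ _<_ (sym (ℕ.+-identityʳ d)) (sym d+e≡t) d<t)
        lower : t ≡ m + m ⊎ (t ≡ suc (m + m) × P (ℤ.- ℤ.+ m)) → P (ℤ.- ℤ.+ e)
        lower (inj₁ eq) = proj₂ (below e 0<e (ℕ.+-cancelˡ-< m e m (ℕ.<-≤-trans (ℕ.+-monoˡ-< e m<d) (ℕ.≤-reflexive (trans d+e≡t eq)))))
        lower (inj₂ (eq , p)) with ℕ.m≤n⇒m<n∨m≡n (ℕ.+-cancelˡ-≤ m e m (ℕ.≤-pred (ℕ.<-≤-trans (ℕ.+-monoˡ-< e m<d) (ℕ.≤-reflexive (trans d+e≡t eq)))))
        ... | inj₁ e<m  = proj₂ (below e 0<e e<m)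
        ... | inj₂ refl = p

module ComponentLayouts where
  open Assembly
  open Seating
  open ZigzagPaths
  open Scheduling
  open import Data.Nat as ℕ using (ℕ; zero; suc; _+_; _*_; _<_; _≤_; z≤n)
  import Data.Nat.Properties as ℕ
  import Data.Nat.Tactic.RingSolver as ℕ-Solver
  open import Data.List using (List; []; _∷_; _++_; [_]; map; length; reverse; applyUpTo)
  open import Data.List.Properties using (length-map; length-++; length-reverse; unfold-reverse; ++-assoc)
  open import Data.List.Membership.Propositional using (_∈_)
  open import Data.List.Membership.Propositional.Properties using (∈-++⁺ˡ; ∈-++⁺ʳ; ∈-map⁺)
  open import Data.List.Relation.Unary.Any as Any using (Any; here; there)
  open import Data.List.Relation.Unary.Any.Properties as Any using (reverse⁺)
  open import Data.Product using (∃; ∃₂; _×_; _,_; proj₁; proj₂)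
  open import Data.Sum using (_⊎_; inj₁; inj₂)
  open import Data.Empty using (⊥; ⊥-elim)
  open import Function using (_∘_)
  open import Relation.Binary.PropositionalEquality using (_≡_; refl; sym; trans; cong; cong₂; subst; module ≡-Reasoning)

  On : List Component → ℕ → Set
  On cs v = Any (λ c → v ∈ points c) cs

  Stepped : List Component → ℕ → ℕ → Set
  Stepped cs u v = ∃ λ c → c ∈ cs × Step (points c) u v

  snoc : List ℕ → ℕ → Component
  snoc []       x = x , []
  snoc (y ∷ ys) x = y , ys ++ [ x ]

  points-snoc : ∀ xs x → points (snoc xs x) ≡ xs ++ [ x ]
  points-snoc []       x = refl
  points-snoc (y ∷ ys) x = refl

  infixl 4 _⋈_
  _⋈_ : Component → List ℕ → Component
  (y , ys) ⋈ zs = y , ys ++ zs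

  module Parts (pairs : List (ℕ × ℕ)) (singles : List ℕ) (paths : List Component) where

    parts : List Component
    parts = map pair pairs ++ map single singles ++ paths

    on-pair : ∀ {x y} → (x , y) ∈ pairs → On parts x × On parts y
    on-pair xy∈ = Any.map (λ { refl → here refl }) c∈ , Any.map (λ { refl → there (here refl) }) c∈
      where c∈ = ∈-++⁺ˡ (∈-map⁺ pair xy∈)

    on-single : ∀ {v} → v ∈ singles → On parts v
    on-single v∈ = Any.map (λ { refl → here refl }) (∈-++⁺ʳ (map pair pairs) (∈-++⁺ˡ (∈-map⁺ single v∈)))

    on-path : ∀ {v} → On paths v → On parts v
    on-path o = Any.++⁺ʳ (map pair pairs) (Any.++⁺ʳ (map single singles) o)

    step-pair : ∀ {x y} → (x , y) ∈ pairs → Stepped parts x y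
    step-pair {x} {y} xy∈ = pair (x , y) , ∈-++⁺ˡ (∈-map⁺ pair xy∈) , first

    step-path : ∀ {u v} → Stepped paths u v → Stepped parts u v
    step-path (c , c∈ , s) = c , ∈-++⁺ʳ (map pair pairs) (∈-++⁺ʳ (map single singles) c∈) , s

    count-parts : length parts ≡ length pairs + (length singles + length paths)
    count-parts = trans (length-++ (map pair pairs)) (cong₂ _+_ (length-map pair pairs)
      (trans (length-++ (map single singles)) (cong (_+ length paths) (length-map single singles))))

    weight-parts : total parts ≡ length pairs + length pairs + (length singles + total paths)
    weight-parts = trans (total-++ (map pair pairs) _) (cong₂ _+_ (total-pairs pairs)
      (trans (total-++ (map single singles) paths) (cong (_+ total paths) (total-singles singles))))

  centres others : ∀ {α} → Window α → ℕ → List ℕ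
  centres void       w = []
  centres (full n ρ) w = [ w + n ]
  others void       w = []
  others (full n ρ) w = range (w + suc (n + n)) ρ

  window-cover : ∀ {α} (W : Window α) w v → w ≤ v → v < w + α →
                 v ∈ centres W w ⊎ v ∈ others W w ⊎ (∃₂ λ x y → (x , y) ∈ nest w (radius W) × (v ≡ x ⊎ v ≡ y))
  window-cover void w v w≤v v< = ⊥-elim (ℕ.<⇒≱ v< (subst (_≤ v) (sym (ℕ.+-identityʳ w)) w≤v))
  window-cover (full n ρ) w v w≤v v< with ℕ.<-≤-connex v (w + suc (n + n))
  ... | inj₂ ≤v = inj₂ (inj₁ (∈-range ≤v (subst (v <_) (sym (ℕ.+-assoc w (suc (n + n)) ρ)) v<)))
  ... | inj₁ v<′ with nest-cover w n v w≤v (ℕ.≤-pred (subst (v <_) (ℕ.+-suc w (n + n)) v<′))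
  ...   | inj₁ v≡ = inj₁ (here v≡)
  ...   | inj₂ p  = inj₂ (inj₂ p)

  window-size : ∀ {α} (W : Window α) w → radius W + radius W + length (centres W w ++ others W w) ≡ α
  window-size void       w = refl
  window-size (full n ρ) w = trans (cong (λ k → n + n + suc k) (length-range (w + suc (n + n)) ρ)) (ℕ.+-suc (n + n) ρ)

  -- One half of the points is {0, ..., m - 1}; it carries a zigzag path and a window. The
  -- other half is its translate by m, with all paths reversed, so that it contains the
  -- opposite differences.
  module Halves (κ : ℕ) {α : ℕ} (W : Window α) where

    m : ℕ
    m = suc κ + α

    path : List ℕ
    path = up (suc κ) 0 α

    w : ℕ
    w = floor (suc κ) 0

    pairs₁ : List (ℕ × ℕ)
    pairs₁ = nest w (radius W)

    flip : ℕ × ℕ → ℕ × ℕ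
    flip (x , y) = m + y , m + x

    pairs₂ : List (ℕ × ℕ)
    pairs₂ = map flip pairs₁

    centre rest : List ℕ
    centre = centres W w
    rest   = others W w

    length-pairs₁ : length pairs₁ ≡ radius W
    length-pairs₁ = length-nest w (radius W)

    length-pairs₂ : length pairs₂ ≡ radius W
    length-pairs₂ = trans (length-map flip pairs₁) length-pairs₁

    locate : (Q : ℕ → Set) → (∀ {v} → v ∈ path → Q v) → (∀ {v} → v ∈ centre → Q v) → (∀ {v} → v ∈ rest → Q v) →
             (∀ {x y} → (x , y) ∈ pairs₁ → Q x × Q y) → ∀ v → v < m → Q v
    locate Q on-path on-centre on-rest on-pair v v<m with up-cover (suc κ) 0 α v z≤n v<m
    ... | inj₁ v∈ = on-path v∈
    ... | inj₂ (w≤v , v<) with window-cover W w v w≤v v<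
    ...   | inj₁ v∈                                  = on-centre v∈
    ...   | inj₂ (inj₁ v∈)                           = on-rest v∈
    ...   | inj₂ (inj₂ (x , y , xy∈ , inj₁ refl)) = proj₁ (on-pair xy∈)
    ...   | inj₂ (inj₂ (x , y , xy∈ , inj₂ refl)) = proj₂ (on-pair xy∈)

    record Track : Set₁ where
      field
        paths  : List Component
        on₁    : ∀ {v} → v ∈ path → On paths v
        on₂    : ∀ {v} → v ∈ path → On paths (m + v)
        weight : total paths ≡ suc κ + suc κ
        Cut    : ℕ → ℕ → Set
        step₁  : ∀ {u v} → Step path u v → Stepped paths u v ⊎ Cut u v
        step₂  : ∀ {u v} → Step path u v → Stepped paths (m + v) (m + u)

    back : Component
    back = snoc (reverse (map (m +_) (down κ 1 α))) (m + 0)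

    points-back : points back ≡ reverse (map (m +_) path)
    points-back = trans (points-snoc _ (m + 0)) (sym (unfold-reverse (m + 0) (map (m +_) (down κ 1 α))))

    length-back : length (points back) ≡ suc κ
    length-back = trans (cong length points-back) (trans (length-reverse (map (m +_) path)) (trans (length-map (m +_) path) (length-up (suc κ) 0 α)))

    ∈-back : ∀ {v} → v ∈ path → m + v ∈ points back
    ∈-back {v} v∈ = subst (m + v ∈_) (sym points-back) (reverse⁺ (∈-map⁺ (m +_) v∈))

    step-back : ∀ {u v} → Step path u v → Step (points back) (m + v) (m + u)
    step-back {u} {v} s = subst (λ l → Step l (m + v) (m + u)) (sym points-back) (step-reverse (step-map (m +_) s))

    ∈-join : ∀ {zs v} → v ∈ points back → v ∈ points (back ⋈ zs)
    ∈-join = ∈-++⁺ˡ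

    step-turn : ∀ z zs → Step (points (back ⋈ (z ∷ zs))) (m + 0) z
    step-turn z zs = subst (λ l → Step (l ++ z ∷ zs) (m + 0) z) (sym (points-snoc xs (m + 0)))
        (subst (λ l → Step l (m + 0) z) (sym (++-split xs)) (step-++ˡ (step-last xs)))
      where
      xs : List ℕ
      xs = reverse (map (m +_) (down κ 1 α))
      ++-split : ∀ xs → (xs ++ [ m + 0 ]) ++ z ∷ zs ≡ ((xs ++ [ m + 0 ]) ++ [ z ]) ++ zs
      ++-split xs = sym (++-assoc (xs ++ [ m + 0 ]) [ z ] zs)

    length-join : ∀ zs → length (points (back ⋈ zs)) ≡ suc κ + length zs
    length-join zs = trans (length-++ (points back)) (cong (_+ length zs) length-back)

    separate : Track
    separate = record
      { paths  = back ∷ (0 , down κ 1 α) ∷ []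
      ; on₁    = λ v∈ → there (here v∈)
      ; on₂    = λ v∈ → here (∈-back v∈)
      ; weight = cong₂ _+_ length-back (trans (ℕ.+-identityʳ _) (length-up (suc κ) 0 α))
      ; Cut    = λ _ _ → ⊥
      ; step₁  = λ s → inj₁ (_ , there (here refl) , s)
      ; step₂  = λ s → _ , here refl , step-back s
      }

    joined : Track
    joined = record
      { paths  = [ back ⋈ path ]
      ; on₁    = λ v∈ → here (∈-++⁺ʳ (points back) v∈)
      ; on₂    = λ v∈ → here (∈-join (∈-back v∈))
      ; weight = trans (ℕ.+-identityʳ _) (trans (length-join path) (cong (suc κ +_) (length-up (suc κ) 0 α)))
      ; Cut    = λ _ _ → ⊥
      ; step₁  = λ s → inj₁ (_ , here refl , step-++ʳ (points back) s)
      ; step₂  = λ s → _ , here refl , step-++ˡ (step-back s)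
      }

    joined-turn : Stepped (Track.paths joined) (m + 0) 0
    joined-turn = _ , here refl , step-turn 0 (down κ 1 α)

    module Uncrossed (T : Track) (extra : List ℕ) where
      open Track T

      inner : List ℕ
      inner = centre ++ rest

      open Parts (pairs₁ ++ pairs₂) (inner ++ map (m +_) inner ++ extra) paths public

      ι : ℕ
      ι = length inner

      window : radius W + radius W + ι ≡ α
      window = window-size W w

      covers : ∀ v → v < m + m + length extra → (∀ {v} → m + m ≤ v → v < m + m + length extra → v ∈ extra) → On parts v
      covers v v< in-extra with ℕ.<-≤-connex v m
      ... | inj₁ v<m = locate (On parts) (on-path ∘ on₁) (λ h → on-single (∈-++⁺ˡ (∈-++⁺ˡ h))) (λ h → on-single (∈-++⁺ˡ (∈-++⁺ʳ centre h)))
                         (λ h → on-pair (∈-++⁺ˡ h)) v v<m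
      ... | inj₂ m≤v with ℕ.m≤n⇒∃[o]m+o≡n m≤v
      ...   | u , refl with ℕ.<-≤-connex u m
      ...     | inj₁ u<m = locate (λ v → On parts (m + v)) (on-path ∘ on₂)
                  (λ h → on-single (∈-++⁺ʳ inner (∈-++⁺ˡ (∈-map⁺ (m +_) (∈-++⁺ˡ h))))) (λ h → on-single (∈-++⁺ʳ inner (∈-++⁺ˡ (∈-map⁺ (m +_) (∈-++⁺ʳ centre h)))))
                  (λ h → let p , q = on-pair (∈-++⁺ʳ pairs₁ (∈-map⁺ flip h)) in q , p) u u<m
      ...     | inj₂ m≤u = on-single (∈-++⁺ʳ inner (∈-++⁺ʳ (map (m +_) inner) (in-extra (ℕ.+-monoʳ-≤ m m≤u) v<)))

      #pairs : length (pairs₁ ++ pairs₂) ≡ radius W + radius W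
      #pairs = trans (length-++ pairs₁) (cong₂ _+_ length-pairs₁ length-pairs₂)

      #singles : length (inner ++ map (m +_) inner ++ extra) ≡ ι + (ι + length extra)
      #singles = trans (length-++ inner) (cong (ι +_) (trans (length-++ (map (m +_) inner)) (cong (_+ length extra) (length-map (m +_) inner))))

      layout : ∀ {s t a} → s ≡ radius W + radius W + (ι + (ι + length extra) + length paths) → t ≡ m + m + length extra → a ≡ radius W + radius W →
               (∀ {v} → m + m ≤ v → v < m + m + length extra → v ∈ extra) → length paths ≤ ι + ι + length extra → Layout s t a
      layout refl refl refl in-extra enough = record
        { pairs   = pairs₁ ++ pairs₂
        ; singles = inner ++ map (m +_) inner ++ extra
        ; paths   = paths
        ; enough-pairs = ℕ.≤-reflexive (sym #pairs)
        ; enough-singles = subst (λ k → r + r + (ι + (ι + e) + length paths) ≤ k + k + 3 * (r + r)) (sym #singles)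
            (ℕ.≤-trans (ℕ.+-monoʳ-≤ (r + r) (ℕ.+-monoʳ-≤ (ι + (ι + e)) enough)) (ℕ.≤-trans (ℕ.m≤m+n _ (2 * (r + r))) (ℕ.≤-reflexive (l r ι e))))
        ; count   = trans count-parts (cong₂ (λ i j → i + (j + length paths)) #pairs #singles)
        ; weight  = begin
            total parts                                                ≡⟨ weight-parts ⟩
            _                                                          ≡⟨ cong₂ (λ i j → i + i + (j + total paths)) #pairs #singles ⟩
            r + r + (r + r) + (ι + (ι + e) + total paths)              ≡⟨ cong (λ k → r + r + (r + r) + (ι + (ι + e) + k)) weight ⟩
            r + r + (r + r) + (ι + (ι + e) + (suc κ + suc κ))          ≡⟨ l₂ r ι e (suc κ) ⟩
            (suc κ + (r + r + ι)) + (suc κ + (r + r + ι)) + e          ≡⟨ cong (λ k → (suc κ + k) + (suc κ + k) + e) window ⟩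
            m + m + e                                                  ∎
        ; covering = λ v v< → covers v v< in-extra
        }
        where
        open ≡-Reasoning
        r e : ℕ
        r = radius W
        e = length extra
        l : ∀ r ι e → r + r + (ι + (ι + e) + (ι + ι + e)) + 2 * (r + r) ≡ ι + (ι + e) + (ι + (ι + e)) + 3 * (r + r)
        l = ℕ-Solver.solve-∀
        l₂ : ∀ r ι e k → r + r + (r + r) + (ι + (ι + e) + (k + k)) ≡ (k + (r + r + ι)) + (k + (r + r + ι)) + e
        l₂ = ℕ-Solver.solve-∀

  module Crossed (κ n ρ : ℕ) where
    open Halves κ (full n ρ) public

    c : ℕ
    c = w + n

    module Bridge (T : Track) (extra : List ℕ) where
      open Track T

      open Parts (pairs₁ ++ pairs₂ ++ [ c , m + c ]) (rest ++ map (m +_) rest ++ extra) paths public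

      bridge : (c , m + c) ∈ pairs₁ ++ pairs₂ ++ [ c , m + c ]
      bridge = ∈-++⁺ʳ pairs₁ (∈-++⁺ʳ pairs₂ (here refl))

      covers : ∀ v → v < m + m + length extra → (∀ {v} → m + m ≤ v → v < m + m + length extra → v ∈ extra) → On parts v
      covers v v< in-extra with ℕ.<-≤-connex v m
      ... | inj₁ v<m = locate (On parts) (on-path ∘ on₁) (λ { (here refl) → proj₁ (on-pair bridge) }) (λ h → on-single (∈-++⁺ˡ h))
                         (λ h → on-pair (∈-++⁺ˡ h)) v v<m
      ... | inj₂ m≤v with ℕ.m≤n⇒∃[o]m+o≡n m≤v
      ...   | u , refl with ℕ.<-≤-connex u m
      ...     | inj₁ u<m = locate (λ v → On parts (m + v)) (on-path ∘ on₂)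
                  (λ { (here refl) → proj₂ (on-pair bridge) }) (λ h → on-single (∈-++⁺ʳ rest (∈-++⁺ˡ (∈-map⁺ (m +_) h))))
                  (λ h → let p , q = on-pair (∈-++⁺ʳ pairs₁ (∈-++⁺ˡ (∈-map⁺ flip h))) in q , p) u u<m
      ...     | inj₂ m≤u = on-single (∈-++⁺ʳ rest (∈-++⁺ʳ (map (m +_) rest) (in-extra (ℕ.+-monoʳ-≤ m m≤u) v<)))

      #pairs : length (pairs₁ ++ pairs₂ ++ [ c , m + c ]) ≡ n + (n + 1)
      #pairs = trans (length-++ pairs₁) (cong₂ _+_ length-pairs₁ (trans (length-++ pairs₂) (cong (_+ 1) length-pairs₂)))

      #singles : length (rest ++ map (m +_) rest ++ extra) ≡ ρ + (ρ + length extra)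
      #singles = trans (length-++ rest) (cong₂ _+_ #rest (trans (length-++ (map (m +_) rest)) (cong (_+ length extra) (trans (length-map (m +_) rest) #rest))))
        where
        #rest : length rest ≡ ρ
        #rest = length-range (w + suc (n + n)) ρ

      layout : ∀ {s t a} → s ≡ n + (n + 1) + (ρ + (ρ + length extra) + length paths) → t ≡ m + m + length extra → a ≡ n + (n + 1) →
               (∀ {v} → m + m ≤ v → v < m + m + length extra → v ∈ extra) → length paths ≤ 2 → Layout s t a
      layout refl refl refl in-extra enough = record
        { pairs   = pairs₁ ++ pairs₂ ++ [ c , m + c ]
        ; singles = rest ++ map (m +_) rest ++ extra
        ; paths   = paths
        ; enough-pairs = ℕ.≤-reflexive (sym #pairs)
        ; enough-singles = subst (λ k → n + (n + 1) + (ρ + (ρ + e) + length paths) ≤ k + k + 3 * (n + (n + 1))) (sym #singles)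
            (ℕ.≤-trans (ℕ.+-monoʳ-≤ (n + (n + 1)) (ℕ.+-monoʳ-≤ (ρ + (ρ + e)) enough)) (ℕ.≤-trans (ℕ.m≤m+n _ (ρ + ρ + e + 2 * (n + n))) (ℕ.≤-reflexive (l n ρ e))))
        ; count   = trans count-parts (cong₂ (λ i j → i + (j + length paths)) #pairs #singles)
        ; weight  = begin
            total parts                                                        ≡⟨ weight-parts ⟩
            _                                                                  ≡⟨ cong₂ (λ i j → i + i + (j + total paths)) #pairs #singles ⟩
            n + (n + 1) + (n + (n + 1)) + (ρ + (ρ + e) + total paths)          ≡⟨ cong (λ k → n + (n + 1) + (n + (n + 1)) + (ρ + (ρ + e) + k)) weight ⟩
            n + (n + 1) + (n + (n + 1)) + (ρ + (ρ + e) + (suc κ + suc κ))      ≡⟨ l₂ n ρ e κ ⟩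
            m + m + e                                                          ∎
        ; covering = λ v v< → covers v v< in-extra
        }
        where
        open ≡-Reasoning
        e : ℕ
        e = length extra
        l : ∀ n ρ e → n + (n + 1) + (ρ + (ρ + e) + 2) + (ρ + ρ + e + 2 * (n + n)) ≡ ρ + (ρ + e) + (ρ + (ρ + e)) + 3 * (n + (n + 1))
        l = ℕ-Solver.solve-∀
        l₂ : ∀ n ρ e κ → n + (n + 1) + (n + (n + 1)) + (ρ + (ρ + e) + (suc κ + suc κ)) ≡ (suc κ + suc (n + n + ρ)) + (suc κ + suc (n + n + ρ)) + e
        l₂ = ℕ-Solver.solve-∀

  module Hooked (κ n ρ : ℕ) where
    open Crossed κ n (suc (suc ρ)) public

    r₀ : ℕ
    r₀ = w + suc (n + n)

    private
      links : List (ℕ × ℕ)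
      links = (c , m + c) ∷ (suc r₀ , r₀) ∷ []

      rest₁ : List ℕ
      rest₁ = range (suc (suc r₀)) ρ

    open Track separate
    open Parts (pairs₁ ++ pairs₂ ++ links) (rest₁ ++ map (m +_) rest) paths public

    private
      rest-cases : ∀ {v} → v ∈ rest → v ≡ r₀ ⊎ v ≡ suc r₀ ⊎ v ∈ rest₁
      rest-cases (here eq)                 = inj₁ (trans eq (ℕ.+-identityʳ r₀))
      rest-cases (there (here eq))         = inj₂ (inj₁ (trans eq (ℕ.+-comm r₀ 1)))
      rest-cases {v} (there (there v∈)) = inj₂ (inj₂ (subst (v ∈_) (applyUpTo-cong (λ i → trans (ℕ.+-suc r₀ (suc i)) (cong suc (ℕ.+-suc r₀ i))) ρ) v∈))
        where
        applyUpTo-cong : ∀ {f g : ℕ → ℕ} → (∀ i → f i ≡ g i) → ∀ k → applyUpTo f k ≡ applyUpTo g k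
        applyUpTo-cong h zero    = refl
        applyUpTo-cong h (suc k) = cong₂ _∷_ (h 0) (applyUpTo-cong (λ i → h (suc i)) k)

      bridge∈ : (c , m + c) ∈ pairs₁ ++ pairs₂ ++ links
      bridge∈ = ∈-++⁺ʳ pairs₁ (∈-++⁺ʳ pairs₂ (here refl))

      hook∈ : (suc r₀ , r₀) ∈ pairs₁ ++ pairs₂ ++ links
      hook∈ = ∈-++⁺ʳ pairs₁ (∈-++⁺ʳ pairs₂ (there (here refl)))

      covers : ∀ v → v < m + m → On parts v
      covers v v< with ℕ.<-≤-connex v m
      ... | inj₁ v<m = locate (On parts) (on-path ∘ on₁) (λ { (here refl) → proj₁ (on-pair bridge∈) }) (on-rest ∘ rest-cases)
                         (λ h → on-pair (∈-++⁺ˡ h)) v v<m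
        where
        on-rest : ∀ {v} → v ≡ r₀ ⊎ v ≡ suc r₀ ⊎ v ∈ rest₁ → On parts v
        on-rest (inj₁ refl)        = proj₂ (on-pair hook∈)
        on-rest (inj₂ (inj₁ refl)) = proj₁ (on-pair hook∈)
        on-rest (inj₂ (inj₂ v∈))   = on-single (∈-++⁺ˡ v∈)
      ... | inj₂ m≤v with ℕ.m≤n⇒∃[o]m+o≡n m≤v
      ...   | u , refl = locate (λ v → On parts (m + v)) (on-path ∘ on₂)
                  (λ { (here refl) → proj₂ (on-pair bridge∈) }) (λ h → on-single (∈-++⁺ʳ rest₁ (∈-map⁺ (m +_) h)))
                  (λ h → let p , q = on-pair (∈-++⁺ʳ pairs₁ (∈-++⁺ˡ (∈-map⁺ flip h))) in q , p) u (ℕ.+-cancelˡ-< m u m v<)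

      #pairs : length (pairs₁ ++ pairs₂ ++ links) ≡ n + (n + 2)
      #pairs = trans (length-++ pairs₁) (cong₂ _+_ length-pairs₁ (trans (length-++ pairs₂) (cong (_+ 2) length-pairs₂)))

      #singles : length (rest₁ ++ map (m +_) rest) ≡ ρ + suc (suc ρ)
      #singles = trans (length-++ rest₁) (cong₂ _+_ (length-range (suc (suc r₀)) ρ) (trans (length-map (m +_) rest) (length-range r₀ (suc (suc ρ)))))

    hook : Stepped parts (suc r₀) r₀
    hook = step-pair hook∈

    bridge : Stepped parts c (m + c)
    bridge = step-pair bridge∈

    hooked : ∀ {s t a} → s ≡ n + (n + 2) + (ρ + suc (suc ρ) + 2) → t ≡ m + m → a ≡ n + (n + 2) → Layout s t a
    hooked refl refl refl = record
      { pairs   = pairs₁ ++ pairs₂ ++ links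
      ; singles = rest₁ ++ map (m +_) rest
      ; paths   = paths
      ; enough-pairs = ℕ.≤-reflexive (sym #pairs)
      ; enough-singles = subst (λ k → n + (n + 2) + (ρ + suc (suc ρ) + 2) ≤ k + k + 3 * (n + (n + 2))) (sym #singles)
          (ℕ.≤-trans (ℕ.m≤m+n _ (ρ + ρ + 4 * n + 4)) (ℕ.≤-reflexive (l n ρ)))
      ; count   = trans count-parts (cong₂ (λ i j → i + (j + length paths)) #pairs #singles)
      ; weight  = begin
          total parts                                                        ≡⟨ weight-parts ⟩
          _                                                                  ≡⟨ cong₂ (λ i j → i + i + (j + total paths)) #pairs #singles ⟩
          n + (n + 2) + (n + (n + 2)) + (ρ + suc (suc ρ) + total paths)      ≡⟨ cong (λ k → n + (n + 2) + (n + (n + 2)) + (ρ + suc (suc ρ) + k)) weight ⟩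
          n + (n + 2) + (n + (n + 2)) + (ρ + suc (suc ρ) + (suc κ + suc κ))  ≡⟨ l₂ n ρ κ ⟩
          m + m                                                              ∎
      ; covering = covers
      }
      where
      open ≡-Reasoning
      l : ∀ n ρ → n + (n + 2) + (ρ + suc (suc ρ) + 2) + (ρ + ρ + 4 * n + 4) ≡ ρ + suc (suc ρ) + (ρ + suc (suc ρ)) + 3 * (n + (n + 2))
      l = ℕ-Solver.solve-∀
      l₂ : ∀ n ρ κ → n + (n + 2) + (n + (n + 2)) + (ρ + suc (suc ρ) + (suc κ + suc κ)) ≡ (suc κ + suc (n + n + suc (suc ρ))) + (suc κ + suc (n + n + suc (suc ρ)))
      l₂ = ℕ-Solver.solve-∀

module Extensions where
  open import Defs
  open Factors
  open ResidueClasses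
  open Assembly
  open Seating
  open ZigzagPaths
  open Scheduling
  open ComponentLayouts
  open import Data.Nat as ℕ using (ℕ; zero; suc; NonZero; _+_; _*_; _<_; s≤s; z≤n)
  import Data.Nat.Properties as ℕ
  import Data.Nat.Tactic.RingSolver as ℕ-Solver
  open import Data.Nat.Divisibility as ℕ using (_∣_; divides; ∣m+n∣m⇒∣n; ∣m∣n⇒∣m+n; ∣1⇒≡1)
  open import Data.Nat.Coprimality using (Coprime; 1-coprimeTo)
  open import Data.Integer as ℤ using (ℤ)
  import Data.Integer.Properties as ℤ
  open import Data.Integer.Tactic.RingSolver using (solve-∀)
  open import Data.Fin using (Fin)
  open import Data.List using (List; []; _∷_; _++_; [_]; length)
  open import Data.List.Membership.Propositional using (_∈_)
  open import Data.List.Membership.Propositional.Properties using (∈-++⁺ˡ; ∈-++⁺ʳ; ∈-map⁺)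
  open import Data.List.Relation.Unary.Any using (here; there)
  open import Data.List.Relation.Unary.All as All using (All; []; _∷_)
  import Data.List.Relation.Unary.All.Properties as All
  open import Data.List.Relation.Unary.Linked using (Linked; []; _∷_)
  open import Data.Product using (∃; _×_; _,_)
  open import Data.Sum as Sum using (_⊎_; inj₁; inj₂; [_,_]′)
  open import Data.Empty using (⊥-elim)
  open import Function using (_∘_)
  open import Relation.Binary.PropositionalEquality using (_≡_; refl; sym; trans; cong; cong₂; subst)

  module Differences (s t : ℕ) .{{_ : NonZero s}} .{{_ : NonZero t}} where
    open Residues t
    open Scheduling.Schedule t public
    open Assembly.Assemble s t using (Jump) public

    Has : List Component → ℤ → Set
    Has cs z = ∃ λ c → c ∈ cs × Jump (points c) z

    jump-cong : ∀ {ps z z′} k → z ≡ z′ ℤ.+ k ℤ.* ℤ.+ t → Jump ps z → Jump ps z′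
    jump-cong {z = z} {z′} k eq (i , u , v , p , q , e) = i , u , v , p , q , trans e
      (⟦⟧-cong k (trans (cong (λ y → ℤ.+ u ℤ.+ y) eq) (sym (ℤ.+-assoc (ℤ.+ u) z′ (k ℤ.* ℤ.+ t)))))

    rise : ∀ {ps} u d → Step ps u (u + d) → Jump ps (ℤ.+ d)
    rise u d st = let i , p , q = step-at st in i , u , u + d , p , q , refl

    fall : ∀ {ps} u d → Step ps (u + d) u → Jump ps (ℤ.- ℤ.+ d)
    fall u d st = let i , p , q = step-at st in i , u + d , u , p , q , cong ⟦_⟧ (l (ℤ.+ u) (ℤ.+ d))
      where
      l : ∀ u d → u ≡ u ℤ.+ d ℤ.+ ℤ.- d
      l = solve-∀

    by-length : ∀ {κ α} (W : Window α) (P : ℤ → Set) →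
                (∀ d → 0 < d → Moves (Halves.path κ W) d → P (ℤ.+ d) × P (ℤ.- ℤ.+ d)) →
                (∀ u d → (u , u + d) ∈ Halves.pairs₁ κ W → P (ℤ.+ d) × P (ℤ.- ℤ.+ d)) →
                (∀ {d} → d ∈ lengths W → P (ℤ.+ d) × P (ℤ.- ℤ.+ d)) →
                ∀ d → 0 < d → d < Halves.m κ W → P (ℤ.+ d) × P (ℤ.- ℤ.+ d)
    by-length {κ} {α} W P on-path on-pair scheduled d 0<d d<m with ℕ.<-≤-connex α d
    ... | inj₁ α<d = on-path d 0<d (up-moves (suc κ) 0 α d α<d d<m)
    ... | inj₂ d≤α with ∈-lengths W d 0<d d≤α
    ...   | inj₁ d∈ = scheduled d∈
    ...   | inj₂ (j , 0<j , j≤r , refl) with nest-rises (Halves.w κ W) (radius W) j 0<j j≤r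
    ...     | u , u∈ = on-pair u (j + j) u∈

    below : ∀ {κ α} (W : Window α) (P : ℤ → Set) (R Cut : ℕ → ℕ → Set) →
            (∀ u d → R u (u + d) → P (ℤ.+ d)) → (∀ u d → R (u + d) u → P (ℤ.- ℤ.+ d)) →
            (∀ {u v} → Step (Halves.path κ W) u v → R u v ⊎ Cut u v) → (∀ {u v} → Step (Halves.path κ W) u v → R (Halves.m κ W + v) (Halves.m κ W + u)) →
            (∀ {x y} → (x , y) ∈ Halves.pairs₁ κ W → R x y × R (Halves.m κ W + y) (Halves.m κ W + x)) →
            (∀ u d → 0 < d → Cut u (u + d) → P (ℤ.+ d)) → (∀ u d → 0 < d → Cut (u + d) u → P (ℤ.- ℤ.+ d)) →
            (∀ {d} → d ∈ lengths W → P (ℤ.+ d) × P (ℤ.- ℤ.+ d)) →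
            ∀ d → 0 < d → d < Halves.m κ W → P (ℤ.+ d) × P (ℤ.- ℤ.+ d)
    below {κ} W P R Cut up-R down-R step₁ step₂ on-pair up-Cut down-Cut = by-length W P
        (λ d 0<d → [ (λ (u , st) → [ up-R u d , up-Cut u d 0<d ]′ (step₁ st) , down-R (m + u) d (subst (λ v → R v (m + u)) (sym (ℕ.+-assoc m u d)) (step₂ st)))
                   , (λ (u , st) → up-R (m + u) d (subst (R (m + u)) (sym (ℕ.+-assoc m u d)) (step₂ st)) , [ down-R u d , down-Cut u d 0<d ]′ (step₁ st)) ]′)
        (λ u d u∈ → let p , q = on-pair u∈ in up-R u d p , down-R (m + u) d (subst (λ v → R v (m + u)) (sym (ℕ.+-assoc m u d)) q))
      where open Halves κ W

  record Extension (s t a : ℕ) .{{_ : NonZero s}} .{{_ : NonZero t}} : Set where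
    open Differences s t
    field
      layout      : Layout s t a
      zs          : List ℤ
      family      : Family [ t ] zs
      #zs         : suc (length zs) ≡ s
      differences : ∀ d → 0 < d → d < t → Covers (members family) (ℤ.+ d) ⊎ Has (Layout.components layout) (ℤ.+ d)

  module Even-or-odd (s t : ℕ) .{{_ : NonZero s}} .{{_ : NonZero t}} where
    open Differences s t

    Good : List Component → List (LFactor (Fin t) [ t ]) → ℤ → Set
    Good cs Fs z = Covers Fs z ⊎ Has cs z

    good-cong : ∀ {cs Fs z z′} k → z ≡ z′ ℤ.+ k ℤ.* ℤ.+ t → Good cs Fs z → Good cs Fs z′
    good-cong k eq (inj₁ c) = inj₁ (covers-cong k eq c)
    good-cong {z = z} {z′} k eq (inj₂ (c , c∈ , j)) = inj₂ (c , c∈ , jump-cong {z = z} {z′} k eq j)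

    module _ {cs : List Component} {Fs : List (LFactor (Fin t) [ t ])} where

      rise′ : ∀ u d → Stepped cs u (u + d) → Good cs Fs (ℤ.+ d)
      rise′ u d (c , c∈ , st) = inj₂ (c , c∈ , rise u d st)

      fall′ : ∀ u d → Stepped cs (u + d) u → Good cs Fs (ℤ.- ℤ.+ d)
      fall′ u d (c , c∈ , st) = inj₂ (c , c∈ , fall u d st)

      turn : ∀ m → Stepped cs (m + 0) 0 → Good cs Fs (ℤ.- ℤ.+ m)
      turn m st = subst (λ d → Good cs Fs (ℤ.- ℤ.+ d)) (ℕ.+-identityʳ m) (fall′ 0 (m + 0) st)

      half-turn : ∀ m → t ≡ m + m → Good cs Fs (ℤ.- ℤ.+ m) → Good cs Fs (ℤ.+ m)
      half-turn m t≡ = complement (Good cs Fs) good-cong (sym t≡)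

      scheduled : ∀ {ds} → All (Covers Fs) (signed ds) → ∀ {d} → d ∈ ds → Good cs Fs (ℤ.+ d) × Good cs Fs (ℤ.- ℤ.+ d)
      scheduled cov d∈ = let p , q = signed-covers cov d∈ in inj₁ p , inj₁ q

  ∣-odd : ∀ {d} j → d ∣ 2 → d ∣ suc (j + j) → d ≡ 1
  ∣-odd {d} j d∣2 d∣i = ∣1⇒≡1 (∣m+n∣m⇒∣n (subst (d ∣_) (ℕ.+-comm 1 (j + j)) d∣i) (ℕ.∣-trans d∣2 (divides j (l j))))
    where
    l : ∀ j → j + j ≡ j * 2
    l = ℕ-Solver.solve-∀

  coprime-half : ∀ m → Coprime m (suc (m + m))
  coprime-half m {d} (d∣m , d∣t) = ∣1⇒≡1 (∣m+n∣m⇒∣n (subst (d ∣_) (ℕ.+-comm 1 (m + m)) d∣t) (∣m∣n⇒∣m+n d∣m d∣m))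

  coprime-pred : ∀ j → let i = suc (j + j) in Coprime i (suc i + suc i)
  coprime-pred j {d} (d∣i , d∣t) = ∣-odd j (∣m+n∣m⇒∣n (subst (d ∣_) (l j) d∣t) (∣m∣n⇒∣m+n d∣i d∣i)) d∣i
    where
    l : ∀ j → suc (suc (j + j)) + suc (suc (j + j)) ≡ suc (j + j) + suc (j + j) + 2
    l = ℕ-Solver.solve-∀

  coprime-pred² : ∀ j → let i = suc (j + j) in Coprime i (suc (suc i) + suc (suc i))
  coprime-pred² j {d} (d∣i , d∣t) = ∣-odd j (∣m+n∣m⇒∣n (subst (d ∣_) (l₂ j) (∣m∣n⇒∣m+n d∣i d∣i)) (ℕ.∣-trans d∣4 (divides j (l₃ j)))) d∣i
    where
    l : ∀ j → suc (suc (suc (j + j))) + suc (suc (suc (j + j))) ≡ suc (j + j) + suc (j + j) + 4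
    l = ℕ-Solver.solve-∀
    l₂ : ∀ j → suc (j + j) + suc (j + j) ≡ j * 4 + 2
    l₂ = ℕ-Solver.solve-∀
    l₃ : ∀ j → j * 4 ≡ j * 4
    l₃ j = refl
    d∣4 : d ∣ 4
    d∣4 = ∣m+n∣m⇒∣n (subst (d ∣_) (l j) d∣t) (∣m∣n⇒∣m+n d∣i d∣i)

  2α<2m : ∀ κ α → α + α < (suc κ + α) + (suc κ + α)
  2α<2m κ α = ℕ.+-mono-<-≤ (ℕ.m<n+m α (s≤s z≤n)) (ℕ.m≤n+m α (suc κ))

  -- s odd: the pairs of the layout absorb the difference t / 2, or one of the two middle
  -- differences.
  module Odd (κ n ρ : ℕ) where
    open Crossed κ n ρ

    private
      #lengths : length (lengths (full n ρ)) ≡ suc (n + ρ)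
      #lengths = length-skipping 1 n ρ

    odd-even : ∀ {s t a} .{{_ : NonZero s}} .{{_ : NonZero t}} → s ≡ n + (n + 1) + (ρ + (ρ + 0) + 2) → t ≡ m + m + 0 → a ≡ n + (n + 1) → Extension s t a
    odd-even {s} {t} refl refl refl = record
      { layout      = layout refl refl refl (λ ≤v v< → ⊥-elim (ℕ.<⇒≱ v< (ℕ.≤-trans (ℕ.≤-reflexive (ℕ.+-identityʳ (m + m))) ≤v))) ℕ.≤-refl
      ; zs          = signed (lengths (full n ρ))
      ; family      = F
      ; #zs         = trans (cong suc (trans (length-signed (lengths (full n ρ))) (cong₂ _+_ #lengths #lengths))) (l n ρ)
      ; differences = all-differences (Good parts (members F)) good-cong m
          (below (full n ρ) (Good parts (members F)) (Stepped parts) _ rise′ fall′ (Sum.map₁ step-path ∘ step₁) (step-path ∘ step₂)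
            (λ xy∈ → step-pair (∈-++⁺ˡ xy∈) , step-pair (∈-++⁺ʳ pairs₁ (∈-++⁺ˡ (∈-map⁺ flip xy∈)))) (λ _ _ _ ()) (λ _ _ _ ()) (scheduled (covers F)))
          (rise′ c m (subst (Stepped parts c) (ℕ.+-comm m c) (step-pair bridge)))
          (inj₁ t≡′)
      }
      where
      open Differences s t
      open Even-or-odd s t
      open Bridge separate []
        renaming (covers to bridge-covers)
      open Track separate
      t≡′ : t ≡ m + m
      t≡′ = (ℕ.+-identityʳ (m + m))
      F : Family [ t ] (signed (lengths (full n ρ)))
      F = lengths-family split-cycle (full n ρ) (subst (suc (n + n + ρ) + suc (n + n + ρ) <_) (sym t≡′) (2α<2m κ (suc (n + n + ρ))))
      l : ∀ n ρ → suc (suc (n + ρ) + suc (n + ρ)) ≡ n + (n + 1) + (ρ + (ρ + 0) + 2)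
      l = ℕ-Solver.solve-∀

    odd-odd : ∀ {s t a} .{{_ : NonZero s}} .{{_ : NonZero t}} → s ≡ n + (n + 1) + (ρ + (ρ + 1) + 1) → t ≡ m + m + 1 → a ≡ n + (n + 1) → Extension s t a
    odd-odd {s} {t} refl refl refl = record
      { layout      = layout refl refl refl (λ ≤v v< → here (ℕ.≤-antisym (ℕ.≤-pred (ℕ.<-≤-trans v< (ℕ.≤-reflexive (ℕ.+-comm (m + m) 1)))) ≤v)) (s≤s z≤n)
      ; zs          = signed (lengths (full n ρ))
      ; family      = F
      ; #zs         = trans (cong suc (trans (length-signed (lengths (full n ρ))) (cong₂ _+_ #lengths #lengths))) (l n ρ)
      ; differences = all-differences (Good parts (members F)) good-cong m
          (below (full n ρ) (Good parts (members F)) (Stepped parts) _ rise′ fall′ (Sum.map₁ step-path ∘ step₁) (step-path ∘ step₂)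
            (λ xy∈ → step-pair (∈-++⁺ˡ xy∈) , step-pair (∈-++⁺ʳ pairs₁ (∈-++⁺ˡ (∈-map⁺ flip xy∈)))) (λ _ _ _ ()) (λ _ _ _ ()) (scheduled (covers F)))
          (rise′ c m (subst (Stepped parts c) (ℕ.+-comm m c) (step-pair bridge)))
          (inj₂ (t≡′ , turn m (step-path joined-turn)))
      }
      where
      open Differences s t
      open Even-or-odd s t
      open Bridge joined [ m + m ]
        renaming (covers to bridge-covers)
      open Track joined
      t≡′ : t ≡ suc (m + m)
      t≡′ = (ℕ.+-comm (m + m) 1)
      F : Family [ t ] (signed (lengths (full n ρ)))
      F = lengths-family split-cycle (full n ρ) (subst (suc (n + n + ρ) + suc (n + n + ρ) <_) (sym t≡′) (ℕ.m<n⇒m<1+n (2α<2m κ (suc (n + n + ρ)))))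
      l : ∀ n ρ → suc (suc (n + ρ) + suc (n + ρ)) ≡ n + (n + 1) + (ρ + (ρ + 1) + 1)
      l = ℕ-Solver.solve-∀

  lengths-size : ∀ {α} (W : Window α) w → length (lengths W) ≡ radius W + length (centres W w ++ others W w)
  lengths-size void       w = refl
  lengths-size (full n ρ) w = trans (length-skipping 1 n ρ) (trans (sym (ℕ.+-suc n ρ)) (cong (λ k → n + suc k) (sym (length-range (w + suc (n + n)) ρ))))

  tail-lengths : ℕ → ℕ → List ℕ
  tail-lengths zero    ρ = consecutive 2 ρ
  tail-lengths (suc n) ρ = skipping 3 n ρ

  lengths-cons : ∀ n ρ → lengths (full n ρ) ≡ 1 ∷ tail-lengths n ρ
  lengths-cons zero    ρ = refl
  lengths-cons (suc n) ρ = refl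

  length-tail : ∀ n ρ → length (tail-lengths n ρ) ≡ n + ρ
  length-tail zero    ρ = length-consecutive 2 ρ
  length-tail (suc n) ρ = length-skipping 3 n ρ

  linked-tail : ∀ n ρ → Linked Coprime (tail-lengths n ρ)
  linked-tail zero    ρ = linked-consecutive 2 ρ
  linked-tail (suc n) ρ = linked-skipping 1 n ρ

  tail-within : ∀ n ρ → All (Within 1 (suc (suc (n + n + ρ)))) (tail-lengths n ρ)
  tail-within n ρ = All.tail (subst (All (Within 1 (suc (suc (n + n + ρ))))) (lengths-cons n ρ) (lengths-within (full n ρ)))

  -- s even, t odd: one of the two middle differences is a factor by itself.
  module Even-odd (κ : ℕ) {α : ℕ} (W : Window α) where
    open Halves κ W
    open Uncrossed joined [ m + m ]
      renaming (covers to window-covers)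
    open Track joined

    even-odd : ∀ {s t a} .{{_ : NonZero s}} .{{_ : NonZero t}} → s ≡ radius W + radius W + (ι + (ι + 1) + 1) → t ≡ m + m + 1 → a ≡ radius W + radius W → Extension s t a
    even-odd {s} {t} refl refl refl = record
      { layout      = layout refl refl refl (λ ≤v v< → here (ℕ.≤-antisym (ℕ.≤-pred (ℕ.<-≤-trans v< (ℕ.≤-reflexive (ℕ.+-comm (m + m) 1)))) ≤v)) (ℕ.m≤n+m 1 (ι + ι))
      ; zs          = ℤ.+ m ∷ signed (lengths W)
      ; family      = F
      ; #zs         = trans (cong (λ k → suc (suc k)) (trans (length-signed (lengths W)) (cong₂ _+_ (lengths-size W w) (lengths-size W w)))) (l (radius W) ι)
      ; differences = all-differences (Good parts (members F)) good-cong m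
          (below W (Good parts (members F)) (Stepped parts) _ rise′ fall′ (Sum.map₁ step-path ∘ step₁) (step-path ∘ step₂)
            (λ xy∈ → step-pair (∈-++⁺ˡ xy∈) , step-pair (∈-++⁺ʳ pairs₁ (∈-map⁺ flip xy∈))) (λ _ _ _ ()) (λ _ _ _ ()) (scheduled (All.tail (covers F))))
          (inj₁ (All.head (covers F)))
          (inj₂ (t≡′ , turn m (step-path joined-turn)))
      }
      where
      open Differences s t
      open Even-or-odd s t
      t≡′ : t ≡ suc (m + m)
      t≡′ = ℕ.+-comm (m + m) 1
      F : Family [ t ] (ℤ.+ m ∷ signed (lengths W))
      F = Unit.forward m (subst (Coprime m) (sym t≡′) (coprime-half m))
            ⊹ lengths-family split-cycle W (subst (α + α <_) (sym t≡′) (ℕ.m<n⇒m<1+n (2α<2m κ α)))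
      l : ∀ r ι → suc (suc (r + ι + (r + ι))) ≡ r + r + (ι + (ι + 1) + 1)
      l = ℕ-Solver.solve-∀

  -- s and t even, t / 2 and the number of scheduled lengths odd: the differences 1 and t / 2
  -- form two Hamilton cycles.
  module Even-even-alternating (κ n ρ : ℕ) where
    private
      W : Window (suc (n + n + ρ))
      W = full n ρ
    open Halves κ W
    open Uncrossed separate []
      renaming (covers to window-covers)
    open Track separate

    alternating-even : ∀ {s t a} .{{_ : NonZero s}} .{{_ : NonZero t}} i j → m ≡ suc (i + i) → n + ρ ≡ j + j →
                       s ≡ n + n + (ι + (ι + 0) + 2) → t ≡ m + m + 0 → a ≡ n + n → Extension s t a
    alternating-even {s} {t} i j m≡ nρ≡ refl refl refl = record
      { layout      = layout refl refl refl (λ ≤v v< → ⊥-elim (ℕ.<⇒≱ v< (ℕ.≤-trans (ℕ.≤-reflexive (ℕ.+-identityʳ (m + m))) ≤v)))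
                        (s≤s (ℕ.≤-trans (ℕ.m≤n+m 1 (length rest)) (ℕ.≤-trans (ℕ.+-monoʳ-≤ (length rest) (s≤s z≤n)) (ℕ.m≤m+n _ 0))))
      ; zs          = ℤ.+ 1 ∷ ℤ.+ suc (i + i) ∷ ℤ.- ℤ.+ 1 ∷ signed (tail-lengths n ρ)
      ; family      = F
      ; #zs         = trans (cong (λ k → suc (suc (suc (suc k)))) (trans (length-signed (tail-lengths n ρ)) (cong₂ _+_ (length-tail n ρ) (length-tail n ρ))))
                        (trans (l n ρ) (cong (λ k → n + n + (suc k + (suc k + 0) + 2)) (sym (length-range (w + suc (n + n)) ρ))))
      ; differences = all-differences (Good parts (members F)) good-cong m
          (below W (Good parts (members F)) (Stepped parts) _ rise′ fall′ (Sum.map₁ step-path ∘ step₁) (step-path ∘ step₂)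
            (λ xy∈ → step-pair (∈-++⁺ˡ xy∈) , step-pair (∈-++⁺ʳ pairs₁ (∈-map⁺ flip xy∈))) (λ _ _ _ ()) (λ _ _ _ ())
            (λ d∈ → sched (subst (_ ∈_) (lengths-cons n ρ) d∈)))
          (inj₁ (subst (λ k → Covers (members F) (ℤ.+ k)) (sym m≡) (All.head (All.tail (covers F)))))
          (inj₁ t≡′)
      }
      where
      open Differences s t
      open Even-or-odd s t
      t≡′ : t ≡ m + m
      t≡′ = ℕ.+-identityʳ (m + m)
      F : Family [ t ] (ℤ.+ 1 ∷ ℤ.+ suc (i + i) ∷ ℤ.- ℤ.+ 1 ∷ signed (tail-lengths n ρ))
      F = Alternating.one-and-half i (trans t≡′ (cong₂ _+_ m≡ m≡))
            ⊹ Unit.backward 1 (1-coprimeTo t)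
            ⊹ even-chain split-cycle j (tail-lengths n ρ) (trans (length-tail n ρ) nρ≡) (linked-tail n ρ)
                (small (subst (suc (n + n + ρ) + suc (n + n + ρ) <_) (sym t≡′) (2α<2m κ (suc (n + n + ρ)))) (tail-within n ρ))
      sched : ∀ {d} → d ∈ 1 ∷ tail-lengths n ρ → Good parts (members F) (ℤ.+ d) × Good parts (members F) (ℤ.- ℤ.+ d)
      sched (here refl) = inj₁ (All.head (covers F)) , inj₁ (All.head (All.tail (All.tail (covers F))))
      sched (there d∈)  = scheduled (All.tail (All.tail (All.tail (covers F)))) d∈
      l : ∀ n ρ → suc (suc (suc (suc (n + ρ + (n + ρ))))) ≡ n + n + (suc ρ + (suc ρ + 0) + 2)
      l = ℕ-Solver.solve-∀

module LongPathExtensions where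
  open import Defs
  open Factors
  open ResidueClasses
  open CycleFamilies using (module Families)
  open Assembly
  open Seating
  open ZigzagPaths
  open Scheduling
  open ComponentLayouts
  open Extensions
  open import Data.Nat as ℕ using (ℕ; zero; suc; NonZero; _+_; _*_; _<_; _≤_; s≤s; z≤n)
  import Data.Nat.Properties as ℕ
  import Data.Nat.Tactic.RingSolver as ℕ-Solver
  open import Data.Nat.Coprimality using (Coprime; 1-coprimeTo)
  open import Data.Integer as ℤ using (ℤ)
  open import Data.List using ([]; _∷_; _++_; [_]; length)
  open import Data.List.Membership.Propositional using (_∈_)
  open import Data.List.Membership.Propositional.Properties using (∈-++⁺ˡ; ∈-++⁺ʳ; ∈-map⁺)
  open import Data.List.Relation.Unary.Any using (here; there)
  open import Data.List.Relation.Unary.All as All using (All; []; _∷_)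
  open import Data.Product using (_×_; _,_)
  open import Data.Sum as Sum using (inj₁; inj₂)
  open import Data.Empty using (⊥-elim)
  open import Function using (_∘_)
  open import Relation.Binary.PropositionalEquality using (_≡_; refl; sym; trans; cong; cong₂; subst)

  consecutive-snoc : ∀ i k → consecutive i (suc k) ≡ consecutive i k ++ [ i + k ]
  consecutive-snoc i zero    = cong [_] (sym (ℕ.+-identityʳ i))
  consecutive-snoc i (suc k) = cong (i ∷_) (trans (consecutive-snoc (suc i) k) (cong (λ j → consecutive (suc i) k ++ [ j ]) (sym (ℕ.+-suc i k))))

  skipping-snoc : ∀ i n ρ → skipping i n (suc ρ) ≡ skipping i n ρ ++ [ i + (n + n) + suc ρ ]
  skipping-snoc i zero    ρ = trans (consecutive-snoc i (suc ρ)) (cong (λ j → consecutive i (suc ρ) ++ [ j + suc ρ ]) (sym (ℕ.+-identityʳ i)))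
  skipping-snoc i (suc n) ρ = cong (i ∷_) (trans (skipping-snoc (suc (suc i)) n ρ) (cong (λ j → skipping (suc (suc i)) n ρ ++ [ j ]) (l i n ρ)))
    where
    l : ∀ i n ρ → suc (suc i) + (n + n) + suc ρ ≡ i + (suc n + suc n) + suc ρ
    l = ℕ-Solver.solve-∀

  tail-snoc : ∀ n ρ → tail-lengths n (suc ρ) ≡ tail-lengths n ρ ++ [ suc (n + n + suc ρ) ]
  tail-snoc zero    ρ = consecutive-snoc 2 ρ
  tail-snoc (suc n) ρ = trans (skipping-snoc 3 n ρ) (cong (λ j → skipping 3 n ρ ++ [ j ]) (l n ρ))
    where
    l : ∀ n ρ → 3 + (n + n) + suc ρ ≡ suc (suc n + suc n + suc ρ)
    l = ℕ-Solver.solve-∀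

  -- s and t even: the difference 1 is a factor by itself, and - 1 joins two points of the window.
  module Even-even-hooked (κ n ρ : ℕ) where
    open Hooked κ n ρ

    private
      W : Window (suc (n + n + suc (suc ρ)))
      W = full n (suc (suc ρ))
    open Track separate

    hooked-even : ∀ {s t a} .{{_ : NonZero s}} .{{_ : NonZero t}} → s ≡ n + (n + 2) + (ρ + suc (suc ρ) + 2) → t ≡ m + m → a ≡ n + (n + 2) →
                  CycleFamilies.Families.Family t [ t ] (CycleFamilies.Families.signed t (tail-lengths n (suc (suc ρ)))) → Extension s t a
    hooked-even {s} {t} refl refl refl G = record
      { layout      = hooked refl refl refl
      ; zs          = ℤ.+ 1 ∷ signed (tail-lengths n (suc (suc ρ)))
      ; family      = F
      ; #zs         = trans (cong (λ k → suc (suc k)) (trans (length-signed (tail-lengths n (suc (suc ρ)))) (cong₂ _+_ (length-tail n (suc (suc ρ))) (length-tail n (suc (suc ρ)))))) (l n ρ)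
      ; differences = all-differences (Good parts (members F)) good-cong m
          (below W (Good parts (members F)) (Stepped parts) _ rise′ fall′ (Sum.map₁ step-path ∘ step₁) (step-path ∘ step₂)
            (λ xy∈ → step-pair (∈-++⁺ˡ xy∈) , step-pair (∈-++⁺ʳ pairs₁ (∈-++⁺ˡ (∈-map⁺ flip xy∈)))) (λ _ _ _ ()) (λ _ _ _ ())
            (λ d∈ → sched (subst (_ ∈_) (lengths-cons n (suc (suc ρ))) d∈)))
          (rise′ c m (subst (Stepped parts c) (ℕ.+-comm m c) bridge))
          (inj₁ refl)
      }
      where
      open Differences s t
      open Even-or-odd s t
      F : Family [ t ] (ℤ.+ 1 ∷ signed (tail-lengths n (suc (suc ρ))))
      F = Unit.forward 1 (1-coprimeTo t) ⊹ G
      sched : ∀ {d} → d ∈ 1 ∷ tail-lengths n (suc (suc ρ)) → Good parts (members F) (ℤ.+ d) × Good parts (members F) (ℤ.- ℤ.+ d)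
      sched (here refl) = inj₁ (All.head (covers F)) , fall′ r₀ 1 (subst (λ k → Stepped parts k r₀) (ℕ.+-comm 1 r₀) hook)
      sched (there d∈)  = scheduled (All.tail (covers F)) d∈
      l : ∀ n ρ → suc (suc (n + suc (suc ρ) + (n + suc (suc ρ)))) ≡ n + (n + 2) + (ρ + suc (suc ρ) + 2)
      l = ℕ-Solver.solve-∀

    module _ (t : ℕ) .{{_ : NonZero t}} (t≡ : t ≡ m + m) where
      open Scheduling.Schedule t

      private
        tail-small : ∀ ρ′ → ρ′ ≤ suc (suc ρ) → All (λ d → 0 < d × d + d < t) (tail-lengths n ρ′)
        tail-small ρ′ le = small (ℕ.≤-<-trans (ℕ.+-mono-≤ le′ le′) (subst (suc (n + n + suc (suc ρ)) + suc (n + n + suc (suc ρ)) <_) (sym t≡) (2α<2m κ (suc (n + n + suc (suc ρ)))))) (tail-within n ρ′)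
          where
          le′ : suc (n + n + ρ′) ≤ suc (n + n + suc (suc ρ))
          le′ = s≤s (ℕ.+-monoʳ-≤ (n + n) le)

      tail-family-even : ∀ j → n + suc (suc ρ) ≡ j + j → Family [ t ] (signed (tail-lengths n (suc (suc ρ))))
      tail-family-even j eq = even-chain split-cycle j (tail-lengths n (suc (suc ρ))) (trans (length-tail n (suc (suc ρ))) eq)
        (linked-tail n (suc (suc ρ))) (tail-small (suc (suc ρ)) ℕ.≤-refl)

      signed-++ : ∀ ds es → signed (ds ++ es) ≡ signed ds ++ signed es
      signed-++ []       es = refl
      signed-++ (d ∷ ds) es = cong (λ zs → ℤ.+ d ∷ ℤ.- ℤ.+ d ∷ zs) (signed-++ ds es)

      -- The last length m - 1 is coprime to 2 m, as m is even.
      tail-family-odd : ∀ j i → n + suc ρ ≡ j + j → κ ≡ 0 → suc (n + n + suc (suc ρ)) ≡ suc (i + i) → Family [ t ] (signed (tail-lengths n (suc (suc ρ))))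
      tail-family-odd j i eq refl last-odd = subst (Family [ t ]) (sym (trans (cong signed (tail-snoc n (suc ρ))) (signed-++ (tail-lengths n (suc ρ)) _)))
        (even-chain split-cycle j (tail-lengths n (suc ρ)) (trans (length-tail n (suc ρ)) eq) (linked-tail n (suc ρ)) (tail-small (suc ρ) (ℕ.n≤1+n _))
          ⊹ unit-family split-cycle (suc (n + n + suc (suc ρ))) (subst (λ k → Coprime k t) (sym last-odd) (subst (Coprime (suc (i + i))) (sym (trans t≡ (cong (λ k → suc k + suc k) last-odd))) (coprime-pred i))))

  -- s and t even, with room for a long path: one of the differences m - 1 and - (m - 2) is a
  -- factor by itself, and the long path is cut where it would be used.
  module Cut₁ (κ : ℕ) {α : ℕ} (W : Window α) where
    open Halves (suc κ) W

    cut : Track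
    cut = record
      { paths  = (back ⋈ [ 0 ]) ∷ (1 + (κ + α) , up κ 1 α) ∷ []
      ; on₁    = λ { (here refl) → here (∈-++⁺ʳ (points back) (here refl)) ; (there v∈) → there (here v∈) }
      ; on₂    = λ v∈ → here (∈-join (∈-back v∈))
      ; weight = trans (cong₂ _+_ (length-join [ 0 ]) (cong (λ k → suc k + 0) (length-up κ 1 α))) (l κ)
      ; Cut    = λ u v → u ≡ 0 × v ≡ 1 + (κ + α)
      ; step₁  = λ { first → inj₂ (refl , refl) ; (later st) → inj₁ (_ , there (here refl) , st) }
      ; step₂  = λ st → _ , here refl , step-++ˡ (step-back st)
      }
      where
      l : ∀ κ → suc (suc κ) + 1 + (suc κ + 0) ≡ suc (suc κ) + suc (suc κ)
      l = ℕ-Solver.solve-∀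

    cut-turn : Stepped (Track.paths cut) (m + 0) 0
    cut-turn = _ , here refl , step-turn 0 []

  module Cut₂ (κ : ℕ) {α : ℕ} (W : Window α) where
    open Halves (suc (suc κ)) W

    cut : Track
    cut = record
      { paths  = (back ⋈ 0 ∷ 1 + (suc κ + α) ∷ []) ∷ (1 , down κ 2 α) ∷ []
      ; on₁    = λ { (here refl) → here (∈-++⁺ʳ (points back) (here refl)) ; (there (here refl)) → here (∈-++⁺ʳ (points back) (there (here refl))) ; (there (there v∈)) → there (here v∈) }
      ; on₂    = λ v∈ → here (∈-join (∈-back v∈))
      ; weight = trans (cong₂ _+_ (length-join (0 ∷ 1 + (suc κ + α) ∷ [])) (cong (λ k → suc k + 0) (length-down κ 2 α))) (l κ)
      ; Cut    = λ u v → u ≡ 1 + (suc κ + α) × v ≡ 1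
      ; step₁  = λ { first → inj₁ (_ , here refl , step-++ʳ (points back) first) ; (later first) → inj₂ (refl , refl) ; (later (later st)) → inj₁ (_ , there (here refl) , st) }
      ; step₂  = λ st → _ , here refl , step-++ˡ (step-back st)
      }
      where
      l : ∀ κ → suc (suc (suc κ)) + 2 + (suc κ + 0) ≡ suc (suc (suc κ)) + suc (suc (suc κ))
      l = ℕ-Solver.solve-∀

    cut-turn : Stepped (Track.paths cut) (m + 0) 0
    cut-turn = _ , here refl , step-turn 0 (1 + (suc κ + α) ∷ [])

  module Even-even-cut (κ n ρ : ℕ) where
    private
      α : ℕ
      α = suc (n + n + ρ)
      W : Window α
      W = full n ρ

    module _ (κ : ℕ) (T : Halves.Track κ W) where
      open Halves κ W
      open Track T
      open Uncrossed T []
        renaming (covers to window-covers)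

      cut-even : ∀ {s t a} .{{_ : NonZero s}} .{{_ : NonZero t}} → length paths ≡ 2 → Stepped paths (m + 0) 0 →
                 s ≡ n + n + (suc ρ + suc ρ + 2) → t ≡ m + m → a ≡ n + n →
                 ∀ z → CycleFamilies.Families.Family t [ t ] [ z ] →
                 (∀ u d → 0 < d → Cut u (u + d) → ℤ.+ d ≡ z) → (∀ u d → 0 < d → Cut (u + d) u → ℤ.- ℤ.+ d ≡ z) → Extension s t a
      cut-even {s} {t} #paths turns refl refl refl z G up-Cut down-Cut = record
        { layout      = layout′
        ; zs          = z ∷ signed (lengths W)
        ; family      = F
        ; #zs         = trans (cong (λ k → suc (suc k)) (trans (length-signed (lengths W)) (cong₂ _+_ (length-skipping 1 n ρ) (length-skipping 1 n ρ)))) (l n ρ)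
        ; differences = all-differences (Good parts (members F)) good-cong m
            (below W (Good parts (members F)) (Stepped parts) Cut rise′ fall′ (Sum.map₁ step-path ∘ step₁) (step-path ∘ step₂)
              (λ xy∈ → step-pair (∈-++⁺ˡ xy∈) , step-pair (∈-++⁺ʳ pairs₁ (∈-map⁺ flip xy∈)))
              (λ u d 0<d c → subst (Good parts (members F)) (sym (up-Cut u d 0<d c)) (inj₁ (All.head (covers F))))
              (λ u d 0<d c → subst (Good parts (members F)) (sym (down-Cut u d 0<d c)) (inj₁ (All.head (covers F))))
              (scheduled (All.tail (covers F))))
            (half-turn {parts} {members F} m refl (turn m (step-path turns)))
            (inj₁ refl)
        }
        where
        open Differences s t
        open Even-or-odd s t
        F : Family [ t ] (z ∷ signed (lengths W))
        F = G ⊹ lengths-family split-cycle W (2α<2m κ α)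
        ι≡ : ι ≡ suc ρ
        ι≡ = cong suc (length-range (w + suc (n + n)) ρ)
        layout′ : Layout s t (n + n)
        layout′ = record
          { pairs = Layout.pairs L ; singles = Layout.singles L ; paths = Layout.paths L
          ; enough-pairs = Layout.enough-pairs L ; enough-singles = subst (_≤ length (Layout.singles L) + length (Layout.singles L) + 3 * (n + n)) s≡ (Layout.enough-singles L)
          ; count = trans (Layout.count L) s≡ ; weight = trans (Layout.weight L) (ℕ.+-identityʳ (m + m))
          ; covering = λ v v< → Layout.covering L v (subst (v <_) (sym (ℕ.+-identityʳ (m + m))) v<) }
          where
          L : Layout (n + n + (ι + (ι + 0) + length paths)) (m + m + 0) (n + n)
          L = layout refl refl refl (λ ≤v v< → ⊥-elim (ℕ.<⇒≱ v< (ℕ.≤-trans (ℕ.≤-reflexive (ℕ.+-identityʳ (m + m))) ≤v)))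
                (room #paths ι≡)
            where
            room : length paths ≡ 2 → ι ≡ suc ρ → length paths ≤ ι + ι + 0
            room p q = ℕ.≤-trans (ℕ.≤-reflexive p) (subst (λ k → 2 ≤ k + k + 0) (sym q) (s≤s (subst (1 ≤_) (sym (trans (ℕ.+-identityʳ (ρ + suc ρ)) (ℕ.+-suc ρ ρ))) (s≤s z≤n))))
          s≡ : n + n + (ι + (ι + 0) + length paths) ≡ n + n + (suc ρ + suc ρ + 2)
          s≡ = trans (cong₂ (λ i p → n + n + (i + (i + 0) + p)) ι≡ #paths) (l′ n ρ)
            where
            l′ : ∀ n ρ → n + n + (suc ρ + (suc ρ + 0) + 2) ≡ n + n + (suc ρ + suc ρ + 2)
            l′ = ℕ-Solver.solve-∀
        l : ∀ n ρ → suc (suc (suc (n + ρ) + suc (n + ρ))) ≡ n + n + (suc ρ + suc ρ + 2)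
        l = ℕ-Solver.solve-∀

    cut-even₁ : ∀ {s t a} .{{_ : NonZero s}} .{{_ : NonZero t}} → let m = Halves.m (suc κ) W in ∀ i → m ≡ suc (suc (i + i)) →
                s ≡ n + n + (suc ρ + suc ρ + 2) → t ≡ m + m → a ≡ n + n → Extension s t a
    cut-even₁ {t = t} i m≡ s≡ refl a≡ = cut-even (suc κ) cut refl cut-turn s≡ refl a≡ (ℤ.+ (1 + (κ + α))) (Unit.forward (1 + (κ + α)) coprime)
        (λ { _ d _ (refl , eq) → cong ℤ.+_ eq }) (λ { u (suc d) _ (eq , _) → ⊥-elim (ℕ.0≢1+n (trans (sym eq) (ℕ.+-suc u d))) })
      where
      open Cut₁ κ W
      open CycleFamilies.Families t
      coprime : Coprime (1 + (κ + α)) t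
      coprime = subst (λ k → Coprime k (suc k + suc k)) (sym (ℕ.suc-injective m≡)) (coprime-pred i)

  module Even-even-cut′ (κ n ρ : ℕ) where
    private
      α : ℕ
      α = suc (n + n + ρ)
      W : Window α
      W = full n ρ

    cut-even₂ : ∀ {s t a} .{{_ : NonZero s}} .{{_ : NonZero t}} → let m = Halves.m (suc (suc κ)) W in ∀ i → m ≡ suc (suc (suc (i + i))) →
                s ≡ n + n + (suc ρ + suc ρ + 2) → t ≡ m + m → a ≡ n + n → Extension s t a
    cut-even₂ {t = t} i m≡ s≡ refl a≡ = Even-even-cut.cut-even κ n ρ (suc (suc κ)) cut refl cut-turn s≡ refl a≡ (ℤ.- ℤ.+ (1 + (κ + α))) (Unit.backward (1 + (κ + α)) coprime)
        (λ { u (suc d) _ (refl , eq) → ⊥-elim (ℕ.0≢1+n (sym (ℕ.suc-injective (trans (sym (cong (λ k → suc (suc k)) (ℕ.+-suc (κ + α) d))) eq)))) })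
        (λ { u d _ (eq , refl) → cong (λ k → ℤ.- ℤ.+ k) (ℕ.suc-injective eq) })
      where
      open Cut₂ κ W
      open CycleFamilies.Families t
      coprime : Coprime (1 + (κ + α)) t
      coprime = subst (λ k → Coprime k (suc (suc k) + suc (suc k))) (sym (ℕ.suc-injective (ℕ.suc-injective m≡))) (coprime-pred² i)

module DigonExtensions where
  open import Defs
  open Factors
  open ResidueClasses
  open CycleFamilies using (module Families)
  open Assembly
  open Seating
  open ZigzagPaths
  open Scheduling
  open ComponentLayouts
  open Extensions
  open import Data.Nat as ℕ using (ℕ; zero; suc; NonZero; _+_; _*_; _<_; s≤s; z≤n)
  import Data.Nat.Properties as ℕ
  import Data.Nat.Tactic.RingSolver as ℕ-Solver
  open import Data.Nat.Coprimality using (1-coprimeTo)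
  open import Data.Integer as ℤ using (ℤ)
  import Data.Integer.Properties as ℤ
  open import Data.Fin using (Fin; toℕ)
  open import Data.Fin.Properties using (toℕ<n)
  open import Data.List using (List; []; _∷_; _++_; [_]; map; length; reverse; replicate; applyUpTo)
  open import Data.List.Properties using (length-++; length-map; length-reverse; unfold-reverse; ++-identityʳ)
  open import Data.List.Membership.Propositional using (_∈_)
  open import Data.List.Membership.Propositional.Properties using (∈-++⁺ˡ; ∈-++⁺ʳ; ∈-map⁺)
  open import Data.List.Relation.Unary.Any as Any using (Any; here; there)
  open import Data.List.Relation.Unary.Any.Properties as Any using (reverse⁺)
  open import Data.List.Relation.Unary.All as All using (All; []; _∷_)
  open import Data.Product using (∃; ∃₂; _×_; _,_; proj₁; proj₂)
  open import Data.Sum as Sum using (_⊎_; inj₁; inj₂; [_,_]′)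
  open import Relation.Binary.PropositionalEquality using (_≡_; refl; sym; trans; cong; cong₂; subst; module ≡-Reasoning)

  up-prefix : ∀ k lo r → ∃ λ x → up (suc k) lo r ≡ up k lo (suc r) ++ [ x ]
  down-prefix : ∀ k lo r → ∃ λ x → down (suc k) lo r ≡ down k lo (suc r) ++ [ x ]
  up-prefix zero    lo r = lo , refl
  up-prefix (suc k) lo r = let x , eq = down-prefix k (suc lo) r in x , cong (lo ∷_) eq
  down-prefix zero    lo r = lo + r , refl
  down-prefix (suc k) lo r = let x , eq = up-prefix k lo r in x , cong₂ _∷_ (cong (lo +_) (sym (ℕ.+-suc k r))) eq

  -- s = 2 and t even: a single point, and a path through all the others that uses
  -- every difference but 1 or - 1.
  module Two (κ : ℕ) where
    open Halves (suc κ) void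

    private
      path′ : List ℕ
      path′ = up (suc κ) 0 1

      w′ : ℕ
      w′ = floor (suc κ) 0

      back′ : Component
      back′ = snoc (reverse (map (m +_) (down κ 1 1))) (m + 0)

      points-back′ : points back′ ≡ reverse (map (m +_) path′)
      points-back′ = trans (points-snoc _ (m + 0)) (sym (unfold-reverse (m + 0) (map (m +_) (down κ 1 1))))

      length-back′ : length (points back′) ≡ suc κ
      length-back′ = trans (cong length points-back′) (trans (length-reverse (map (m +_) path′)) (trans (length-map (m +_) path′) (length-up (suc κ) 0 1)))

      open Parts [] [ m + w′ ] [ back′ ⋈ path ]

      step-path′ : ∀ {u v} → Step path′ u v → Step path u v
      step-path′ {u} {v} st = let x , eq = up-prefix (suc κ) 0 0 in subst (λ l → Step l u v) (sym eq) (step-++ˡ st)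

      stepped : ∀ {u v} → Step path u v → Stepped parts u v
      stepped st = step-path (_ , here refl , step-++ʳ (points back′) st)

      stepped′ : ∀ {u v} → Step path′ u v → Stepped parts (m + v) (m + u)
      stepped′ {u} {v} st = step-path (_ , here refl , step-++ˡ (subst (λ l → Step l (m + v) (m + u)) (sym points-back′) (step-reverse (step-map (m +_) st))))

      turn′ : Stepped parts (m + 0) 0
      turn′ = step-path (_ , here refl , turning (reverse (map (m +_) (down κ 1 1))))
        where
        turning : ∀ xs → Step (points (snoc xs (m + 0) ⋈ path)) (m + 0) 0
        turning []       = first
        turning (x ∷ xs) = later (go xs)
          where
          go : ∀ xs → Step ((xs ++ [ m + 0 ]) ++ path) (m + 0) 0
          go []       = first
          go (x ∷ xs) = later (go xs)

      covering : ∀ v → v < m + m → On parts v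
      covering v v< with ℕ.<-≤-connex v m
      ... | inj₁ v<m = locate (On parts) (λ h → on-path (here (∈-++⁺ʳ (points back′) h))) (λ ()) (λ ()) (λ ()) v v<m
      ... | inj₂ m≤v with ℕ.m≤n⇒∃[o]m+o≡n m≤v
      ...   | u , refl with up-cover (suc κ) 0 1 u z≤n (subst (u <_) (trans (ℕ.+-identityʳ (suc (suc κ))) (ℕ.+-comm 1 (suc κ))) (ℕ.+-cancelˡ-< m u m v<))
      ...     | inj₁ u∈ = on-path (here (∈-++⁺ˡ (subst (m + u ∈_) (sym points-back′) (reverse⁺ (∈-map⁺ (m +_) u∈)))))
      ...     | inj₂ (w≤u , u<) = on-single (here (cong (m +_) (ℕ.≤-antisym (ℕ.≤-pred (subst (u <_) (ℕ.+-comm w′ 1) u<)) w≤u)))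

      layout : Layout 2 (m + m) 0
      layout = record
        { pairs = [] ; singles = [ m + w′ ] ; paths = [ back′ ⋈ path ]
        ; enough-pairs = z≤n ; enough-singles = ℕ.≤-refl ; count = refl
        ; weight = trans (cong (λ k → suc (k + 0)) (trans (length-++ (points back′)) (cong₂ _+_ length-back′ (length-up (suc (suc κ)) 0 0)))) (l κ)
        ; covering = covering }
        where
        l : ∀ κ → suc (suc κ + suc (suc κ) + 0) ≡ suc (suc κ) + 0 + (suc (suc κ) + 0)
        l = ℕ-Solver.solve-∀

    two-even : ∀ {s t a} .{{_ : NonZero s}} .{{_ : NonZero t}} → s ≡ 2 → t ≡ m + m → a ≡ 0 → Extension s t a
    two-even {s} {t} refl refl refl = build (up-moves (suc (suc κ)) 0 0 1 (s≤s z≤n) (s≤s (s≤s z≤n)))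
      where
      open Differences s t
      open Even-or-odd s t
      module _ {z : ℤ} (F : Family [ t ] [ z ]) (one : Good parts (members F) (ℤ.+ 1) × Good parts (members F) (ℤ.- ℤ.+ 1)) where
        low : ∀ d → 0 < d → d < m → Good parts (members F) (ℤ.+ d) × Good parts (members F) (ℤ.- ℤ.+ d)
        low d 0<d d<m with ℕ.m≤n⇒m<n∨m≡n 0<d
        ... | inj₂ refl = one
        ... | inj₁ 1<d with up-moves (suc κ) 0 1 d 1<d (subst (d <_) (trans (ℕ.+-identityʳ (suc (suc κ))) (ℕ.+-comm 1 (suc κ))) d<m)
        ...   | inj₁ (u , st) = rise′ {parts} u d (stepped (step-path′ st)) , fall′ {parts} (m + u) d (subst (λ v → Stepped parts v (m + u)) (sym (ℕ.+-assoc m u d)) (stepped′ st))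
        ...   | inj₂ (u , st) = rise′ {parts} (m + u) d (subst (Stepped parts (m + u)) (sym (ℕ.+-assoc m u d)) (stepped′ st)) , fall′ {parts} u d (stepped (step-path′ st))
        all : ∀ d → 0 < d → d < t → Good parts (members F) (ℤ.+ d)
        all = all-differences (Good parts (members F)) good-cong m low (half-turn {parts} {members F} m refl (turn m turn′)) (inj₁ refl)
      build : Moves path 1 → Extension s t 0
      build (inj₁ (u , st)) = record { layout = layout ; zs = [ ℤ.- ℤ.+ 1 ] ; family = F ; #zs = refl
                                     ; differences = all F (rise′ {parts} u 1 (stepped st) , inj₁ (All.head (covers F))) }
        where
        F : Family [ t ] [ ℤ.- ℤ.+ 1 ]
        F = Unit.backward 1 (1-coprimeTo t)
      build (inj₂ (u , st)) = record { layout = layout ; zs = [ ℤ.+ 1 ] ; family = F ; #zs = refl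
                                     ; differences = all F (inj₁ (All.head (covers F)) , fall′ {parts} u 1 (stepped st)) }
        where
        F : Family [ t ] [ ℤ.+ 1 ]
        F = Unit.forward 1 (1-coprimeTo t)

  Has₂ : (s t : ℕ) .{{_ : NonZero s}} .{{_ : NonZero t}} → List Component → List (ℕ × ℕ) → ℤ → Set
  Has₂ s t cs ds z = (∃ λ c → c ∈ cs × Jump (points c) z) ⊎ (∃₂ λ x y → (x , y) ∈ ds × (Jump (x ∷ y ∷ []) z ⊎ Jump (y ∷ x ∷ []) z))
    where open Differences s t

  record Extension₂ (s t a m : ℕ) .{{_ : NonZero s}} .{{_ : NonZero t}} : Set where
    open Differences s t
    field
      layout      : Layout₂ s t a
      zs          : List ℤ
      family      : Family (replicate m 2) zs
      #zs         : suc (length zs) ≡ s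
      differences : ∀ d → 0 < d → d < t → Covers (members family) (ℤ.+ d) ⊎ Has₂ s t (Layout₂.components layout) (Layout₂.digons layout) (ℤ.+ d)

  -- The zigzag paths are replaced by digons on their alternate steps.
  module Digons (κ : ℕ) {α : ℕ} (W : Window α) (links : List (ℕ × ℕ)) (X : List ℕ) where
    open Halves κ W

    tail : List ℕ
    tail = down κ 1 α

    digons : List (ℕ × ℕ)
    digons = chunks path ++ map (λ (x , y) → m + x , m + y) (chunks tail)

    singles : List ℕ
    singles = X ++ remainder path ++ (m + 0) ∷ map (m +_) (remainder tail)

    pairs : List (ℕ × ℕ)
    pairs = pairs₁ ++ pairs₂ ++ links

    open Parts pairs singles []

    components : List Component
    components = map pair pairs ++ map single singles

    parts≡ : parts ≡ components
    parts≡ = cong (map pair pairs ++_) (++-identityʳ (map single singles))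

    InDigon : ℕ → Set
    InDigon v = Any (λ (x , y) → v ≡ x ⊎ v ≡ y) digons

    Placed : ℕ → Set
    Placed v = On components v ⊎ InDigon v

    private
      on-parts : ∀ {v} → On parts v → Placed v
      on-parts {v} o = inj₁ (subst (λ cs → On cs v) parts≡ o)

      digon : ∀ {x y} → (x , y) ∈ digons → ∀ {v} → v ≡ x ⊎ v ≡ y → Placed v
      digon xy∈ h = inj₂ (Any.map (λ { refl → h }) xy∈)

      shift : ∀ {x y v} → v ≡ x ⊎ v ≡ y → m + v ≡ m + x ⊎ m + v ≡ m + y
      shift = Sum.map (cong (m +_)) (cong (m +_))

      on₁ : ∀ {v} → v ∈ path → Placed v
      on₁ v∈ with chunk-cover path v∈
      ... | inj₁ r = on-parts (on-single (∈-++⁺ʳ X (∈-++⁺ˡ r)))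
      ... | inj₂ (x , y , xy∈ , h) = digon (∈-++⁺ˡ xy∈) h

      on₂ : ∀ {v} → v ∈ path → Placed (m + v)
      on₂ (here refl) = on-parts (on-single (∈-++⁺ʳ X (∈-++⁺ʳ (remainder path) (here refl))))
      on₂ (there v∈) with chunk-cover tail v∈
      ... | inj₁ r = on-parts (on-single (∈-++⁺ʳ X (∈-++⁺ʳ (remainder path) (there (∈-map⁺ (m +_) r)))))
      ... | inj₂ (x , y , xy∈ , h) = digon (∈-++⁺ʳ (chunks path) (∈-map⁺ _ xy∈)) (shift h)

    covering : (∀ {v} → v ∈ centre ⊎ v ∈ rest → (v ∈ X × m + v ∈ X) ⊎ (v , m + v) ∈ links) → ∀ v → v < m + m → Placed v
    covering on-window v v< with ℕ.<-≤-connex v m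
    ... | inj₁ v<m = locate Placed on₁ (λ h → in-window (on-window (inj₁ h))) (λ h → in-window (on-window (inj₂ h)))
                       (λ h → let p , q = on-pair (∈-++⁺ˡ h) in on-parts p , on-parts q) v v<m
      where
      in-window : ∀ {v} → (v ∈ X × m + v ∈ X) ⊎ (v , m + v) ∈ links → Placed v
      in-window (inj₁ (h , _)) = on-parts (on-single (∈-++⁺ˡ h))
      in-window (inj₂ h)       = on-parts (proj₁ (on-pair (∈-++⁺ʳ pairs₁ (∈-++⁺ʳ pairs₂ h))))
    ... | inj₂ m≤v with ℕ.m≤n⇒∃[o]m+o≡n m≤v
    ...   | u , refl = locate (λ v → Placed (m + v)) on₂ (λ h → in-window (on-window (inj₁ h))) (λ h → in-window (on-window (inj₂ h)))
                         (λ h → let p , q = on-pair (∈-++⁺ʳ pairs₁ (∈-++⁺ˡ (∈-map⁺ flip h))) in on-parts q , on-parts p) u (ℕ.+-cancelˡ-< m u m v<)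
      where
      in-window : ∀ {v} → (v ∈ X × m + v ∈ X) ⊎ (v , m + v) ∈ links → Placed (m + v)
      in-window (inj₁ (_ , h)) = on-parts (on-single (∈-++⁺ˡ h))
      in-window (inj₂ h)       = on-parts (proj₂ (on-pair (∈-++⁺ʳ pairs₁ (∈-++⁺ʳ pairs₂ h))))

    #digons : length digons ≡ κ
    #digons = trans (length-++ (chunks path)) (trans (cong (length (chunks path) +_) (length-map _ (chunks tail))) (trans (length-chunks 0 tail) (length-down κ 1 α)))

    #pairs : length pairs ≡ radius W + (radius W + length links)
    #pairs = trans (length-++ pairs₁) (cong₂ _+_ length-pairs₁ (trans (length-++ pairs₂) (cong (_+ length links) length-pairs₂)))

    #singles : length singles ≡ length X + 2
    #singles = trans (length-++ X) (cong (length X +_) (trans (length-++ (remainder path)) (trans (ℕ.+-suc (length (remainder path)) _)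
      (cong suc (trans (cong (length (remainder path) +_) (length-map (m +_) (remainder tail))) (length-remainders 0 tail))))))

    layout₂ : ∀ {s t a} → s ≡ radius W + (radius W + length links) + (length X + 2) → t ≡ m + m → a ≡ radius W + (radius W + length links) →
              radius W + (radius W + length links) + (radius W + (radius W + length links)) + length X ≡ α + α →
              (∀ {v} → v ∈ centre ⊎ v ∈ rest → (v ∈ X × m + v ∈ X) ⊎ (v , m + v) ∈ links) → Layout₂ s t a
    layout₂ s≡ t≡ a≡ balance on-window = record
      { pairs = pairs ; singles = singles ; digons = digons
      ; exact-pairs = trans #pairs (sym a≡)
      ; count  = trans (cong length (sym parts≡)) (trans count-parts (trans (cong (length pairs +_) (ℕ.+-identityʳ (length singles))) (trans (cong₂ _+_ #pairs #singles) (sym s≡))))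
      ; weight = begin
          total components + (length digons + length digons)                 ≡⟨ cong (λ cs → total cs + (length digons + length digons)) parts≡ ⟨
          total parts + (length digons + length digons)                      ≡⟨ cong₂ (λ i j → i + (j + j)) weight-parts #digons ⟩
          length pairs + length pairs + (length singles + 0) + (κ + κ)       ≡⟨ cong₂ (λ i j → i + i + (j + 0) + (κ + κ)) #pairs #singles ⟩
          a + a + (length X + 2 + 0) + (κ + κ)                               ≡⟨ l a (length X) κ ⟩
          a + a + length X + (suc κ + suc κ)                                 ≡⟨ cong (_+ (suc κ + suc κ)) balance ⟩
          α + α + (suc κ + suc κ)                                            ≡⟨ l′ α (suc κ) ⟩
          m + m                                                              ≡⟨ t≡ ⟨
          _                                                                  ∎
      ; covering = λ v v<t → covering on-window v (subst (v <_) t≡ v<t) }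
      where
      open ≡-Reasoning
      a : ℕ
      a = radius W + (radius W + length links)
      l : ∀ a x κ → a + a + (x + 2 + 0) + (κ + κ) ≡ a + a + x + (suc κ + suc κ)
      l = ℕ-Solver.solve-∀
      l′ : ∀ α k → α + α + (k + k) ≡ (k + α) + (k + α)
      l′ = ℕ-Solver.solve-∀

    module Good₂ (s t : ℕ) .{{_ : NonZero s}} .{{_ : NonZero t}} (Fs : List (LFactor (Fin t) (replicate m 2))) where
      open Differences s t

      Good : ℤ → Set
      Good z = Covers Fs z ⊎ Has₂ s t components digons z

      good-cong : ∀ {z z′} k → z ≡ z′ ℤ.+ k ℤ.* ℤ.+ t → Good z → Good z′
      good-cong k eq (inj₁ c) = inj₁ (covers-cong k eq c)
      good-cong {z} {z′} k eq (inj₂ (inj₁ (c , c∈ , j))) = inj₂ (inj₁ (c , c∈ , jump-cong {z = z} {z′} k eq j))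
      good-cong {z} {z′} k eq (inj₂ (inj₂ (x , y , xy∈ , j))) = inj₂ (inj₂ (x , y , xy∈ , Sum.map (jump-cong {z = z} {z′} k eq) (jump-cong {z = z} {z′} k eq) j))

      R : ℕ → ℕ → Set
      R u v = Stepped parts u v ⊎ ((u , v) ∈ digons ⊎ (v , u) ∈ digons)

      rise₂ : ∀ u d → R u (u + d) → Good (ℤ.+ d)
      rise₂ u d (inj₁ (c , c∈ , st))  = inj₂ (inj₁ (c , subst (c ∈_) parts≡ c∈ , rise u d st))
      rise₂ u d (inj₂ (inj₁ h))       = inj₂ (inj₂ (_ , _ , h , inj₁ (rise u d first)))
      rise₂ u d (inj₂ (inj₂ h))       = inj₂ (inj₂ (_ , _ , h , inj₂ (rise u d first)))

      fall₂ : ∀ u d → R (u + d) u → Good (ℤ.- ℤ.+ d)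
      fall₂ u d (inj₁ (c , c∈ , st))  = inj₂ (inj₁ (c , subst (c ∈_) parts≡ c∈ , fall u d st))
      fall₂ u d (inj₂ (inj₁ h))       = inj₂ (inj₂ (_ , _ , h , inj₁ (fall u d first)))
      fall₂ u d (inj₂ (inj₂ h))       = inj₂ (inj₂ (_ , _ , h , inj₂ (fall u d first)))

      private
        both : ∀ {u v} → Step path u v → (R u v × R v u) ⊎ (R (m + u) (m + v) × R (m + v) (m + u))
        both st with step-chunk st
        ... | inj₁ h = inj₁ (inj₂ (inj₁ (∈-++⁺ˡ h)) , inj₂ (inj₂ (∈-++⁺ˡ h)))
        ... | inj₂ h = let h′ = ∈-++⁺ʳ (chunks path) (∈-map⁺ (λ (x , y) → m + x , m + y) h) in inj₂ (inj₂ (inj₁ h′) , inj₂ (inj₂ h′))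

      below₂ : (∀ {d} → d ∈ lengths W → Good (ℤ.+ d) × Good (ℤ.- ℤ.+ d)) → ∀ d → 0 < d → d < m → Good (ℤ.+ d) × Good (ℤ.- ℤ.+ d)
      below₂ = by-length W Good
          (λ d _ → [ (λ (u , st) → [ (λ (p , q) → rise₂ u d p , fall₂ u d q)
                                   , (λ (p , q) → rise₂ (m + u) d (subst (R (m + u)) (assoc u d) p) , fall₂ (m + u) d (subst (λ v → R v (m + u)) (assoc u d) q)) ]′ (both st))
                   , (λ (u , st) → [ (λ (p , q) → rise₂ u d q , fall₂ u d p)
                                   , (λ (p , q) → rise₂ (m + u) d (subst (R (m + u)) (assoc u d) q) , fall₂ (m + u) d (subst (λ v → R v (m + u)) (assoc u d) p)) ]′ (both st)) ]′)
          (λ u d u∈ → rise₂ u d (inj₁ (step-pair (∈-++⁺ˡ u∈)))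
                    , fall₂ (m + u) d (subst (λ v → R v (m + u)) (assoc u d) (inj₁ (step-pair (∈-++⁺ʳ pairs₁ (∈-++⁺ˡ (∈-map⁺ flip u∈)))))))
        where
        assoc : ∀ u d → m + (u + d) ≡ m + u + d
        assoc u d = sym (ℕ.+-assoc m u d)

  module Odd₂ (κ n ρ : ℕ) where
    open Crossed κ n ρ
    open Digons κ (full n ρ) [ c , m + c ] (rest ++ map (m +_) rest)

    odd-even₂ : ∀ {s t a} .{{_ : NonZero s}} .{{_ : NonZero t}} → s ≡ n + (n + 1) + (ρ + ρ + 2) → t ≡ m + m → a ≡ n + (n + 1) → Extension₂ s t a m
    odd-even₂ {s} {t} refl refl refl = record
      { layout = L ; zs = signed (lengths (full n ρ)) ; family = F
      ; #zs = trans (cong suc (trans (length-signed (lengths (full n ρ))) (cong₂ _+_ (length-skipping 1 n ρ) (length-skipping 1 n ρ)))) (l n ρ)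
      ; differences = all-differences Good good-cong m (below₂ (λ d∈ → let p , q = signed-covers (covers F) d∈ in inj₁ p , inj₁ q))
          (rise₂ c m (inj₁ (subst (Stepped parts c) (ℕ.+-comm m c) (step-pair (∈-++⁺ʳ pairs₁ (∈-++⁺ʳ pairs₂ (here refl))))))) (inj₁ refl) }
      where
      open Differences s t
      open Parts pairs singles []
      F : Family (replicate m 2) (signed (lengths (full n ρ)))
      F = lengths-family (split-matching m refl) (full n ρ) (2α<2m κ (suc (n + n + ρ)))
      open Good₂ s t (members F)
      #X : length (rest ++ map (m +_) rest) ≡ ρ + ρ
      #X = trans (length-++ rest) (cong₂ _+_ (length-range _ ρ) (trans (length-map (m +_) rest) (length-range _ ρ)))
      L : Layout₂ s t (n + (n + 1))
      L = layout₂ (cong (λ k → n + (n + 1) + (k + 2)) (sym #X)) refl refl (trans (cong (λ k → n + (n + 1) + (n + (n + 1)) + k) #X) (l′ n ρ))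
            λ { (inj₁ (here refl)) → inj₂ (here refl) ; (inj₂ h) → inj₁ (∈-++⁺ˡ h , ∈-++⁺ʳ rest (∈-map⁺ (m +_) h)) }
        where
        l′ : ∀ n ρ → n + (n + 1) + (n + (n + 1)) + (ρ + ρ) ≡ suc (n + n + ρ) + suc (n + n + ρ)
        l′ = ℕ-Solver.solve-∀
      l : ∀ n ρ → suc (suc (n + ρ) + suc (n + ρ)) ≡ n + (n + 1) + (ρ + ρ + 2)
      l = ℕ-Solver.solve-∀

  module Even₂ (κ : ℕ) {α : ℕ} (W : Window α) where
    open Halves κ W

    private
      inner : List ℕ
      inner = centre ++ rest
      ι r : ℕ
      ι = length inner
      r = radius W
    open Digons κ W [] (inner ++ map (m +_) inner)

    module _ (t : ℕ) .{{_ : NonZero t}} (t≡ : t ≡ m + m) where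
      open Residues t
      open CycleFamilies.Families t

      private
        antipodal : ℕ → List (Fin t)
        antipodal i = ⟦ ℤ.+ i ⟧ ∷ ⟦ ℤ.+ (m + i) ⟧ ∷ []

        locate-antipodal : ∀ n → n < m + m → ∃ λ i → i < m × (n ≡ i ⊎ n ≡ m + i)
        locate-antipodal n n< with ℕ.<-≤-connex n m
        ... | inj₁ n<m = n , n<m , inj₁ refl
        ... | inj₂ m≤n with ℕ.m≤n⇒∃[o]m+o≡n m≤n
        ...   | i , refl = i , ℕ.+-cancelˡ-< m i m n< , inj₂ refl

        half : ∀ v → ∃ λ i → i < m × (v ≡ ⟦ ℤ.+ i ⟧ ⊎ v ≡ ⟦ ℤ.+ (m + i) ⟧)
        half v = let i , i<m , h = locate-antipodal (toℕ v) (subst (toℕ v <_) t≡ (toℕ<n v)) in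
          i , i<m , Sum.map (λ eq → trans (sym (⟦toℕ⟧ v)) (cong (λ k → ⟦ ℤ.+ k ⟧) eq)) (λ eq → trans (sym (⟦toℕ⟧ v)) (cong (λ k → ⟦ ℤ.+ k ⟧) eq)) h

      antipodes : Family (replicate m 2) [ ℤ.+ m ]
      antipodes = record { members = [ F ] ; size = refl ; covers = (λ v → here (arc v (half v))) ∷ [] }
        where
        F : LFactor (Fin t) (replicate m 2)
        F = record
          { cycles = applyUpTo antipodal m ; shape = CycleFamilies.map-applyUpTo-const antipodal 2 m (λ _ → refl)
          ; complete = λ v → let i , i<m , h = half v in Any.applyUpTo⁺ antipodal ([ here , (λ eq → there (here eq)) ]′ h) i<m }
        arc : ∀ v → (∃ λ i → i < m × (v ≡ ⟦ ℤ.+ i ⟧ ⊎ v ≡ ⟦ ℤ.+ (m + i) ⟧)) → Arc F v (v ⊕ ℤ.+ m)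
        arc v (i , i<m , inj₁ refl) = Any.applyUpTo⁺ antipodal (subst (Follows (antipodal i) ⟦ ℤ.+ i ⟧) (sym eq) (step Factors.At.here (Factors.At.there Factors.At.here))) i<m
          where
          eq : ⟦ ℤ.+ i ⟧ ⊕ ℤ.+ m ≡ ⟦ ℤ.+ (m + i) ⟧
          eq = trans (⟦⟧-⊕ (ℤ.+ i) (ℤ.+ m)) (cong (λ k → ⟦ ℤ.+ k ⟧) (ℕ.+-comm i m))
        arc v (i , i<m , inj₂ refl) = Any.applyUpTo⁺ antipodal (subst (Follows (antipodal i) ⟦ ℤ.+ (m + i) ⟧) (sym eq) (wrap (Factors.At.there Factors.At.here) refl Factors.At.here)) i<m
          where
          eq : ⟦ ℤ.+ (m + i) ⟧ ⊕ ℤ.+ m ≡ ⟦ ℤ.+ i ⟧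
          eq = trans (⟦⟧-⊕ (ℤ.+ (m + i)) (ℤ.+ m)) (⟦⟧-cong (ℤ.+ 1) (trans (cong ℤ.+_ (l m i)) (cong (λ k → ℤ.+ i ℤ.+ k) (trans (cong ℤ.+_ (sym t≡)) (sym (ℤ.*-identityˡ (ℤ.+ t)))))))
            where
            l : ∀ m i → m + i + m ≡ i + (m + m)
            l = ℕ-Solver.solve-∀

    even-even₂ : ∀ {s t a} .{{_ : NonZero s}} .{{_ : NonZero t}} → s ≡ r + (r + 0) + (ι + ι + 2) → t ≡ m + m → a ≡ r + (r + 0) → Extension₂ s t a m
    even-even₂ {s} {t} refl refl refl = record
      { layout = L ; zs = ℤ.+ m ∷ signed (lengths W) ; family = F
      ; #zs = trans (cong (λ k → suc (suc k)) (trans (length-signed (lengths W)) (cong₂ _+_ (lengths-size W w) (lengths-size W w)))) (l r ι)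
      ; differences = all-differences Good good-cong m (below₂ (λ d∈ → let p , q = signed-covers (All.tail (covers F)) d∈ in inj₁ p , inj₁ q))
          (inj₁ (All.head (covers F))) (inj₁ refl) }
      where
      open Differences s t
      F : Family (replicate m 2) (ℤ.+ m ∷ signed (lengths W))
      F = antipodes t refl ⊹ lengths-family (split-matching m refl) W (2α<2m κ α)
      open Good₂ s t (members F)
      #X : length (inner ++ map (m +_) inner) ≡ ι + ι
      #X = trans (length-++ inner) (cong (ι +_) (length-map (m +_) inner))
      L : Layout₂ s t (r + (r + 0))
      L = layout₂ (cong (λ k → r + (r + 0) + (k + 2)) (sym #X)) refl refl (trans (cong (λ k → r + (r + 0) + (r + (r + 0)) + k) #X) (trans (l′ r ι) (cong₂ _+_ (window-size W w) (window-size W w))))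
            λ { (inj₁ h) → inj₁ (∈-++⁺ˡ (∈-++⁺ˡ h) , ∈-++⁺ʳ inner (∈-map⁺ (m +_) (∈-++⁺ˡ h)))
              ; (inj₂ h) → inj₁ (∈-++⁺ˡ (∈-++⁺ʳ centre h) , ∈-++⁺ʳ inner (∈-map⁺ (m +_) (∈-++⁺ʳ centre h))) }
        where
        l′ : ∀ r ι → r + (r + 0) + (r + (r + 0)) + (ι + ι) ≡ (r + r + ι) + (r + r + ι)
        l′ = ℕ-Solver.solve-∀
      l : ∀ r ι → suc (suc (r + ι + (r + ι))) ≡ r + (r + 0) + (ι + ι + 2)
      l = ℕ-Solver.solve-∀

open import Defs
open Factors
open Exchanges using (Parity; even; odd; parity)
open CycleFamilies using (module Families)
open Dealing using (oddCount; oddCount≡numOdd; oddCount≡sum-mod-2; 3oddCount≤sum)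
open Assembly
open Seating
open ZigzagPaths using (length-range)
open Scheduling
open ComponentLayouts
open Extensions
open LongPathExtensions
open DigonExtensions
open import Data.Nat as ℕ using (ℕ; zero; suc; NonZero; _+_; _*_; _∸_; _/_; _%_; _<_; _≤_; s≤s; z≤n)
import Data.Nat.Properties as ℕ
import Data.Nat.DivMod as ℕ
open import Data.Nat.ListAction using (sum)
import Data.Nat.Tactic.RingSolver as ℕ-Solver
open import Data.List using (List; []; _∷_; _++_; [_]; length; replicate)
open import Data.Fin using (Fin)
open import Data.List.Relation.Unary.Any using (Any)
open import Data.List.Relation.Unary.All as All using (All; []; _∷_)
open import Data.Product using (∃; _×_; _,_; proj₁; proj₂)
open import Data.Sum as Sum using (_⊎_; inj₁; inj₂; [_,_]′)
open import Data.Empty using (⊥-elim)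
open import Relation.Binary.PropositionalEquality using (_≡_; _≢_; refl; sym; trans; cong; cong₂; subst)

module _ {ms : List ℕ} {s t : ℕ} .{{_ : NonZero s}} .{{_ : NonZero t}} (long : All (2 ≤_) ms) (sum-ms : sum ms ≡ s) (given : OPSolvable ms) where

  private
    given-covering : ∃ λ (As : List (LFactor (Fin s) ms)) → suc (length As) ≡ s × (∀ u v → u ≢ v → Any (λ F → Arc F u v) As)
    given-covering = go s refl
      where
      go : ∀ n → s ≡ n → ∃ λ (As : List (LFactor (Fin s) ms)) → suc (length As) ≡ s × (∀ u v → u ≢ v → Any (λ F → Arc F u v) As)
      go zero    s≡0  = ⊥-elim (ℕ.≢-nonZero⁻¹ s s≡0)
      go (suc n) refl = let As , len , covers = solvable⇒covering long (subst (λ n → Solvable n ms) sum-ms given) in As , cong suc len , covers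

    As = proj₁ given-covering
    As≡s = proj₁ (proj₂ given-covering)

  open Assembly.Assemble s t using (assemble)
  open Seating.Seat s t using (layout-base; layout-base₂)
  open CycleFamilies.Families t using (members; size)

  extend : Extension s t (oddCount ms) → OPSolvable (ms ++ [ t ])
  extend X = assemble sum-ms (ℕ.+-identityʳ t) As (proj₂ (proj₂ given-covering)) (members family) As≡s
      (ℕ.suc-injective (trans As≡s (trans (sym #zs) (cong suc (sym (size family)))))) (layout-base long sum-ms layout)
      (λ d 0<d d<t → Sum.map₂ inj₁ (differences d 0<d d<t))
    where open Extension X

  extend₂ : ∀ {m} → t ≡ m + m → Extension₂ s t (oddCount ms) m → OPSolvable (ms ++ replicate m 2)
  extend₂ {m} t≡2m X = assemble sum-ms (trans (sum-twos m) (sym t≡2m)) As (proj₂ (proj₂ given-covering)) (members family) As≡s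
      (ℕ.suc-injective (trans As≡s (trans (sym #zs) (cong suc (sym (size family)))))) (layout-base₂ long sum-ms m t≡2m layout) differences
    where
    open Extension₂ X
    sum-twos : ∀ m → sum (replicate m 2) ≡ m + m
    sum-twos zero    = refl
    sum-twos (suc m) = cong suc (trans (cong suc (sum-twos m)) (sym (ℕ.+-suc m m)))

-- The parameters of a layout are read off from s = a + 2 k, 3 a ≤ s and a + s ≤ 2 h.
module Arithmetic where

  third : ∀ a k → 3 * a ≤ a + (k + k) → a ≤ k
  third a k le = ℕ.*-cancelˡ-≤ 2 (ℕ.+-cancelˡ-≤ a (2 * a) (2 * k) (ℕ.≤-trans le (ℕ.≤-reflexive (cong (a +_) (l k)))))
    where
    l : ∀ k → k + k ≡ 2 * k
    l = ℕ-Solver.solve-∀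

  room : ∀ {n} h x → n ≡ 2 * x → n ≤ 2 * h → ∃ λ κ → h ≡ κ + x
  room h x eq le = let κ , e = ℕ.m≤n⇒∃[o]m+o≡n (ℕ.*-cancelˡ-≤ {x} {h} 2 (ℕ.≤-trans (ℕ.≤-reflexive (sym eq)) le)) in κ , trans (sym e) (ℕ.+-comm x κ)

odd≢even : ∀ i j → suc (i + i) ≢ j + j
odd≢even zero    (suc j) eq = ℕ.0≢1+n (ℕ.suc-injective (trans eq (cong suc (ℕ.+-suc j j))))
odd≢even (suc i) (suc j) eq = odd≢even i j (ℕ.suc-injective (ℕ.suc-injective (trans (cong (λ k → suc (suc k)) (sym (ℕ.+-suc i i))) (trans eq (cong suc (ℕ.+-suc j j))))))

even-even : ∀ r ρ κ {s t a} .{{_ : NonZero s}} .{{_ : NonZero t}} → let m = Halves.m κ (full r ρ) in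
            s ≡ r + r + (suc ρ + suc ρ + 2) → t ≡ m + m → a ≡ r + r → s < t → Extension s t a
even-even r ρ κ {s} {t} {a} s≡ t≡ a≡ s<t = by-parity (κ) refl (parity (κ + suc (r + r + ρ)))
  where
  hooking : ∀ r κ → let m = suc κ + suc (r + r + ρ) in s ≡ r + r + (suc ρ + suc ρ + 2) → t ≡ m + m → a ≡ r + r → r ≢ 0 →
            (∀ n → r ≡ suc n → (∃ λ j → n + suc (suc ρ) ≡ j + j) ⊎ (κ ≡ 0 × ∃ λ i → suc κ + suc (r + r + ρ) ≡ suc (suc (i + i)))) → Extension s t a
  hooking zero    κ _ _ _ r≢0 _ = ⊥-elim (r≢0 refl)
  hooking (suc n) κ s≡ t≡ a≡ _ parities = hooked-even (trans s≡ (l₁ n ρ)) t≡′ (trans a≡ (l₂ n)) (tail (parities n refl))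
    where
    open Even-even-hooked κ n ρ
    l₁ : ∀ n ρ → suc n + suc n + (suc ρ + suc ρ + 2) ≡ n + (n + 2) + (ρ + suc (suc ρ) + 2)
    l₁ = ℕ-Solver.solve-∀
    l₂ : ∀ n → suc n + suc n ≡ n + (n + 2)
    l₂ = ℕ-Solver.solve-∀
    l₃ : ∀ n ρ → suc n + suc n + ρ ≡ n + n + suc (suc ρ)
    l₃ = ℕ-Solver.solve-∀
    m≡ : suc κ + suc (suc n + suc n + ρ) ≡ suc κ + suc (n + n + suc (suc ρ))
    m≡ = cong (λ x → suc κ + suc x) (l₃ n ρ)
    t≡′ : t ≡ suc κ + suc (n + n + suc (suc ρ)) + (suc κ + suc (n + n + suc (suc ρ)))
    t≡′ = trans t≡ (cong₂ _+_ m≡ m≡)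
    open CycleFamilies.Families t
    tail : (∃ λ j → n + suc (suc ρ) ≡ j + j) ⊎ (κ ≡ 0 × ∃ λ i → suc κ + suc (suc n + suc n + ρ) ≡ suc (suc (i + i))) →
           Family [ t ] (signed (tail-lengths n (suc (suc ρ))))
    tail (inj₁ (j , eq)) = tail-family-even t t≡′ j eq
    tail (inj₂ (κ≡0 , i , eq)) with parity (n + suc ρ)
      | ℕ.suc-injective (trans (sym (cong (λ k → suc k + suc (n + n + suc (suc ρ))) κ≡0)) (trans (sym m≡) eq))
    ... | p | last = go (n + suc ρ) refl p
      where
      go : ∀ x → n + suc ρ ≡ x → Parity x → Family [ t ] (signed (tail-lengths n (suc (suc ρ))))
      go _ e (even j) = tail-family-odd t t≡′ j i e κ≡0 last
      go _ e (odd j)  = tail-family-even t t≡′ (suc j) (trans (ℕ.+-suc n (suc ρ)) (trans (cong suc e) (cong suc (sym (ℕ.+-suc j j)))))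

  tight : κ ≡ 0 → r ≢ 0
  tight refl refl = ℕ.<⇒≢ s<t (trans s≡ (trans (l ρ) (sym t≡)))
    where
    l : ∀ ρ → 0 + 0 + (suc ρ + suc ρ + 2) ≡ suc 0 + suc (0 + 0 + ρ) + (suc 0 + suc (0 + 0 + ρ))
    l = ℕ-Solver.solve-∀

  narrow : ∀ i → κ + suc (r + r + ρ) ≡ i + i → (κ ≡ 0 ⊎ κ ≡ 1) → ∀ x → r + ρ ≡ x → Parity x → Extension s t a
  narrow i m-odd _ _ e (even j) = alternating-even i j (cong suc m-odd) e (trans s≡ (trans (l r ρ) (cong (λ k → r + r + (suc k + (suc k + 0) + 2)) (sym (length-range (w + suc (r + r)) ρ))))) (trans t≡ (sym (ℕ.+-identityʳ (m + m)))) a≡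
    where
    open Even-even-alternating κ r ρ
    open Halves κ (full r ρ)
    l : ∀ r ρ → r + r + (suc ρ + suc ρ + 2) ≡ r + r + (suc ρ + (suc ρ + 0) + 2)
    l = ℕ-Solver.solve-∀
  narrow i m-odd small _ e (odd j) = hooking r κ s≡ t≡ a≡ r≢0 parities
    where
    r≢0 : r ≢ 0
    r≢0 = [ tight , one ]′ small
      where
      one : κ ≡ 1 → r ≢ 0
      one refl refl = odd≢even (suc j) i (trans (cong (λ k → suc (suc k)) (trans (ℕ.+-suc j j) (sym e))) m-odd)
    parities : ∀ n → r ≡ suc n → (∃ λ j → n + suc (suc ρ) ≡ j + j) ⊎ (κ ≡ 0 × ∃ λ i → suc κ + suc (r + r + ρ) ≡ suc (suc (i + i)))
    parities n refl = inj₁ (suc j , trans (ℕ.+-suc n (suc ρ)) (cong suc (trans (ℕ.+-suc n ρ) (trans e (sym (ℕ.+-suc j j))))))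

  by-parity : ∀ k → κ ≡ k → Parity (κ + suc (r + r + ρ)) → Extension s t a
  by-parity k κ≡ p = go (κ + suc (r + r + ρ)) refl p k κ≡
    where
    go : ∀ x → κ + suc (r + r + ρ) ≡ x → Parity x → ∀ k → κ ≡ k → Extension s t a
    go _ e (odd i) zero κ≡0 = hooking r κ s≡ t≡ a≡ (tight κ≡0) (λ _ _ → inj₂ (κ≡0 , i , cong suc e))
    go _ e (odd i) (suc k) refl = Even-even-cut.cut-even₁ k r ρ i (cong suc e) s≡ t≡ a≡
    go _ e (even i) zero κ≡0 = narrow i e (inj₁ κ≡0) (r + ρ) refl (parity (r + ρ))
    go _ e (even i) (suc zero) κ≡1 = narrow i e (inj₂ κ≡1) (r + ρ) refl (parity (r + ρ))
    go _ e (even zero) (suc (suc k)) refl = ⊥-elim (ℕ.0≢1+n (sym e))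
    go _ e (even (suc i)) (suc (suc k)) refl = Even-even-cut′.cut-even₂ k r ρ i (cong suc (trans e (cong suc (ℕ.+-suc i i)))) s≡ t≡ a≡

module _ (s t a k h : ℕ) .{{_ : NonZero s}} .{{_ : NonZero t}} (s≡ : s ≡ a + (k + k)) (3a≤s : 3 * a ≤ s) (s<t : s < t) (a+s≤2h : a + s ≤ 2 * h) where
  open Arithmetic

  private
    a≤k : a ≤ k
    a≤k = third a k (subst (3 * a ≤_) s≡ 3a≤s)

    0<k : 0 < k
    0<k = ℕ.n≢0⇒n>0 λ where
      refl → ℕ.≢-nonZero⁻¹ s (trans s≡ (trans (ℕ.+-identityʳ a) (ℕ.n≤0⇒n≡0 a≤k)))

    k≡ : ∃ λ ρ → k ≡ suc ρ
    k≡ = ℕ.pred k , sym (ℕ.suc-pred k {{ℕ.>-nonZero 0<k}})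

    data Shape : ℕ → ℕ → Set where
      two  : Shape 0 0
      more : ∀ r ρ → Shape r (suc ρ)

    window-shape : ∀ r ι → r + r ≤ suc ι → Shape r ι
    window-shape zero    zero    _ = two
    window-shape (suc r) zero    (s≤s le) = ⊥-elim (ℕ.<⇒≱ (s≤s z≤n) (subst (_≤ 0) (ℕ.+-suc r r) le))
    window-shape r       (suc ρ) _ = more r ρ

  extension : t ≡ h + h ⊎ t ≡ suc (h + h) → Extension s t a
  extension t≡ = go (parity a) k≡ refl
    where
    go : Parity a → (∃ λ ρ → k ≡ suc ρ) → ∀ {a′} → a′ ≡ a → Extension s t a
    go p (ρ , refl) refl = by-parity a refl p
      where
      by-parity : ∀ b → a ≡ b → Parity b → Extension s t a
      by-parity _ a≡ (odd n) with room h (suc (suc (n + n + ρ))) (trans (cong₂ _+_ a≡ (trans s≡ (cong (_+ (suc ρ + suc ρ)) a≡))) (l n ρ)) a+s≤2h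
        where
        l : ∀ n ρ → suc (n + n) + (suc (n + n) + (suc ρ + suc ρ)) ≡ 2 * suc (suc (n + n + ρ))
        l = ℕ-Solver.solve-∀
      ... | κ , h≡ = cases t≡
        where
        m≡ : h ≡ suc κ + suc (n + n + ρ)
        m≡ = trans h≡ (ℕ.+-suc κ (suc (n + n + ρ)))
        l₀ : ∀ n → suc (n + n) ≡ n + (n + 1)
        l₀ = ℕ-Solver.solve-∀
        l₁ : ∀ n ρ → suc (n + n) + (suc ρ + suc ρ) ≡ n + (n + 1) + (ρ + (ρ + 0) + 2)
        l₁ = ℕ-Solver.solve-∀
        l₂ : ∀ n ρ → suc (n + n) + (suc ρ + suc ρ) ≡ n + (n + 1) + (ρ + (ρ + 1) + 1)
        l₂ = ℕ-Solver.solve-∀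
        s≡′ : s ≡ suc (n + n) + (suc ρ + suc ρ)
        s≡′ = trans s≡ (cong (_+ (suc ρ + suc ρ)) a≡)
        cases : t ≡ h + h ⊎ t ≡ suc (h + h) → Extension s t a
        cases (inj₁ e) = Odd.odd-even κ n ρ (trans s≡′ (l₁ n ρ)) (trans e (trans (cong₂ _+_ m≡ m≡) (sym (ℕ.+-identityʳ _)))) (trans a≡ (l₀ n))
        cases (inj₂ e) = Odd.odd-odd κ n ρ (trans s≡′ (l₂ n ρ)) (trans e (trans (cong suc (cong₂ _+_ m≡ m≡)) (ℕ.+-comm 1 _))) (trans a≡ (l₀ n))
      by-parity _ a≡ (even r) with room h (suc (r + r + ρ)) (trans (cong₂ _+_ a≡ (trans s≡ (cong (_+ (suc ρ + suc ρ)) a≡))) (l r ρ)) a+s≤2h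
                                 | window-shape r ρ (subst (_≤ suc ρ) a≡ a≤k)
        where
        l : ∀ r ρ → r + r + (r + r + (suc ρ + suc ρ)) ≡ 2 * suc (r + r + ρ)
        l = ℕ-Solver.solve-∀
      ... | κ , h≡ | two = cases t≡
        where
        s≡2 : s ≡ 2
        s≡2 = trans s≡ (cong (_+ 2) a≡)
        m≡ : h ≡ suc κ + 0
        m≡ = trans h≡ (trans (ℕ.+-comm κ 1) (sym (ℕ.+-identityʳ (suc κ))))
        cases : t ≡ h + h ⊎ t ≡ suc (h + h) → Extension s t a
        cases (inj₂ e) = Even-odd.even-odd κ void s≡2 (trans e (trans (cong suc (cong₂ _+_ m≡ m≡)) (ℕ.+-comm 1 _))) a≡
        cases (inj₁ e) = room-for-two κ m≡
          where
          room-for-two : ∀ κ → h ≡ suc κ + 0 → Extension s t a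
          room-for-two zero    h≡1 = ⊥-elim (ℕ.<⇒≢ s<t (trans s≡2 (sym (trans e (cong₂ _+_ h≡1 h≡1)))))
          room-for-two (suc κ) m≡  = Two.two-even κ s≡2 (trans e (cong₂ _+_ m≡ m≡)) a≡
      ... | κ , h≡ | more r ρ = cases t≡
        where
        m≡ : h ≡ suc κ + suc (r + r + ρ)
        m≡ = trans h≡ (trans (ℕ.+-suc κ (r + r + suc ρ)) (cong (λ x → suc (κ + x)) (ℕ.+-suc (r + r) ρ)))
        s≡′ : s ≡ r + r + (suc (suc ρ) + suc (suc ρ))
        s≡′ = trans s≡ (cong (_+ (suc (suc ρ) + suc (suc ρ))) a≡)
        l₁ : ∀ r ρ → r + r + (suc (suc ρ) + suc (suc ρ)) ≡ r + r + (suc ρ + suc ρ + 2)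
        l₁ = ℕ-Solver.solve-∀
        l₂ : ∀ r ρ → r + r + (suc (suc ρ) + suc (suc ρ)) ≡ r + r + (suc ρ + (suc ρ + 1) + 1)
        l₂ = ℕ-Solver.solve-∀
        cases : t ≡ h + h ⊎ t ≡ suc (h + h) → Extension s t a
        cases (inj₁ e) = even-even r ρ κ (trans s≡′ (l₁ r ρ)) (trans e (cong₂ _+_ m≡ m≡)) a≡ s<t
        cases (inj₂ e) = Even-odd.even-odd κ (full r ρ) (trans s≡′ (trans (l₂ r ρ) (cong (λ x → r + r + (suc x + (suc x + 1) + 1)) (sym (length-range _ ρ)))))
                           (trans e (trans (cong suc (cong₂ _+_ m≡ m≡)) (ℕ.+-comm 1 _))) a≡

  extension₂ : t ≡ h + h → Extension₂ s t a h
  extension₂ t≡ = go k≡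
    where
    go : (∃ λ ρ → k ≡ suc ρ) → Extension₂ s t a h
    go (ρ , refl) = by-parity a refl (parity a)
      where
      by-parity : ∀ b → a ≡ b → Parity b → Extension₂ s t a h
      by-parity _ a≡ (odd n) with room h (suc (suc (n + n + ρ))) (trans (cong₂ _+_ a≡ (trans s≡ (cong (_+ (suc ρ + suc ρ)) a≡))) (l n ρ)) a+s≤2h
        where
        l : ∀ n ρ → suc (n + n) + (suc (n + n) + (suc ρ + suc ρ)) ≡ 2 * suc (suc (n + n + ρ))
        l = ℕ-Solver.solve-∀
      ... | κ , h≡ = subst (λ m → Extension₂ s t a m) (sym m≡) (Odd₂.odd-even₂ κ n ρ (trans s≡ (trans (cong (_+ (suc ρ + suc ρ)) a≡) (l₁ n ρ))) (trans t≡ (cong₂ _+_ m≡ m≡)) (trans a≡ (l₀ n)))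
        where
        m≡ : h ≡ suc κ + suc (n + n + ρ)
        m≡ = trans h≡ (ℕ.+-suc κ (suc (n + n + ρ)))
        l₀ : ∀ n → suc (n + n) ≡ n + (n + 1)
        l₀ = ℕ-Solver.solve-∀
        l₁ : ∀ n ρ → suc (n + n) + (suc ρ + suc ρ) ≡ n + (n + 1) + (ρ + ρ + 2)
        l₁ = ℕ-Solver.solve-∀
      by-parity _ a≡ (even r) with room h (suc (r + r + ρ)) (trans (cong₂ _+_ a≡ (trans s≡ (cong (_+ (suc ρ + suc ρ)) a≡))) (l r ρ)) a+s≤2h
                                 | window-shape r ρ (subst (_≤ suc ρ) a≡ a≤k)
        where
        l : ∀ r ρ → r + r + (r + r + (suc ρ + suc ρ)) ≡ 2 * suc (r + r + ρ)
        l = ℕ-Solver.solve-∀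
      ... | κ , h≡ | two = subst (λ m → Extension₂ s t a m) (sym m≡) (Even₂.even-even₂ κ void (trans s≡ (cong (_+ 2) a≡)) (trans t≡ (cong₂ _+_ m≡ m≡)) a≡)
        where
        m≡ : h ≡ suc κ + 0
        m≡ = trans h≡ (trans (ℕ.+-comm κ 1) (sym (ℕ.+-identityʳ (suc κ))))
      ... | κ , h≡ | more r ρ = subst (λ m → Extension₂ s t a m) (sym m≡) (Even₂.even-even₂ κ (full r ρ)
                (trans s≡ (trans (cong (_+ (suc (suc ρ) + suc (suc ρ))) a≡) (trans (l₁ r ρ) (cong (λ x → r + (r + 0) + (suc x + suc x + 2)) (sym (length-range _ ρ))))))
                (trans t≡ (cong₂ _+_ m≡ m≡)) (trans a≡ (cong (r +_) (sym (ℕ.+-identityʳ r)))))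
        where
        m≡ : h ≡ suc κ + suc (r + r + ρ)
        m≡ = trans h≡ (trans (ℕ.+-suc κ (r + r + suc ρ)) (cong (λ x → suc (κ + x)) (ℕ.+-suc (r + r) ρ)))
        l₁ : ∀ r ρ → r + r + (suc (suc ρ) + suc (suc ρ)) ≡ r + (r + 0) + (suc ρ + suc ρ + 2)
        l₁ = ℕ-Solver.solve-∀

half-of : ∀ t → ∃ λ h → t / 2 ≡ h × (t ≡ h + h ⊎ t ≡ suc (h + h))
half-of t with parity t
... | even j = j , trans (cong (_/ 2) (l j)) (ℕ.m*n/n≡m j 2) , inj₁ refl
  where
  l : ∀ j → j + j ≡ j * 2
  l = ℕ-Solver.solve-∀
... | odd j = j , trans (cong (_/ 2) (l j)) (trans (ℕ.+-distrib-/ 1 (j * 2) (subst (λ r → 1 + r < 2) (sym (ℕ.m*n%n≡0 j 2)) ℕ.≤-refl)) (ℕ.m*n/n≡m j 2)) , inj₂ refl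
  where
  l : ∀ j → suc (j + j) ≡ 1 + j * 2
  l = ℕ-Solver.solve-∀

theorem1p6 : (ms : List ℕ) → ms ≢ [] → All (2 ≤_) ms →
    (t : ℕ) → sum ms < t → numOdd ms ≤ 2 * (t / 2) ∸ sum ms →
    OPSolvable ms →
    OPSolvable (ms ++ t ∷ []) × (t % 2 ≡ 0 → OPSolvable (ms ++ replicate (t / 2) 2))
theorem1p6 []           ms≢[] _    t s<t bound given = ⊥-elim (ms≢[] refl)
theorem1p6 ms@(m₀ ∷ ms′) _    long t s<t bound given with oddCount≡sum-mod-2 long | half-of t
... | k , s≡ | h , refl , t≡ =
    extend long refl given (extension s t (oddCount ms) k h s≡ (3oddCount≤sum long) s<t a+s≤2h t≡) ,
    (λ t-even → extend₂ long refl given (twice t≡ t-even) (extension₂ s t (oddCount ms) k h s≡ (3oddCount≤sum long) s<t a+s≤2h (twice t≡ t-even)))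
  where
  s : ℕ
  s = sum ms
  instance
    s≢0 : NonZero s
    s≢0 = ℕ.>-nonZero (ℕ.≤-trans (ℕ.≤-trans (s≤s z≤n) (All.head long)) (ℕ.m≤m+n m₀ (sum ms′)))
    t≢0 : NonZero t
    t≢0 = ℕ.>-nonZero (ℕ.≤-trans (s≤s z≤n) s<t)
  double : ∀ h → h + h ≡ 2 * h
  double = ℕ-Solver.solve-∀
  s≤2h : s ≤ 2 * h
  s≤2h = [ (λ e → ℕ.≤-trans (ℕ.<⇒≤ s<t) (ℕ.≤-reflexive (trans e (double h)))) , (λ e → ℕ.≤-trans (ℕ.≤-pred (ℕ.≤-trans s<t (ℕ.≤-reflexive e))) (ℕ.≤-reflexive (double h))) ]′ t≡
  a+s≤2h : oddCount ms + s ≤ 2 * h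
  a+s≤2h = ℕ.≤-trans (ℕ.+-monoˡ-≤ s (subst (_≤ 2 * h ∸ s) (sym (oddCount≡numOdd ms)) bound)) (ℕ.≤-reflexive (ℕ.m∸n+n≡m s≤2h))
  twice : t ≡ h + h ⊎ t ≡ suc (h + h) → t % 2 ≡ 0 → t ≡ h + h
  twice (inj₁ e) _ = e
  twice (inj₂ e) t-even = ⊥-elim (ℕ.0≢1+n (trans (sym t-even) (trans (cong (_% 2) (trans e (cong suc (trans (double h) (ℕ.*-comm 2 h))))) (ℕ.[m+kn]%n≡m%n 1 h 2))))
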